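{- Input: a matrix $(A,-\mathbf{b})\in\mathbb{Z}^{r\times(n+1)}$ (with $A\in\mathbb{Z}^{r\times n}$, $\mathbf{b}\in\mathbb{Z}^r$) and a strategy $S$. Output: a simplicial cone decomposition of the polyhedron $P(A,\mathbf{b})=\{\alpha\in\mathbb{R}_{\ge 0}^n: A\alpha=\mathbf{b}\}$. That is, the algorithm SimpCone[S] described in the context, run on $(A,-\mathbf{b})$, outputs a finite list $\{(s_1,O_{r,1},J_{r,1}),\dots,(s_N,O_{r,N},J_{r,N})\}$ such that each $K_i^{v_i}:=K^{\cdot}(O_{r,i})$ (with rows $n+1,\dots,n+r$ and the columns in $J_{r,i}$ of $O_{r,i}$ deleted) is a shifted simplicial cone, and $$\sigma_{P(A,\mathbf{b})}(\mathbf{y})=\sum_{i=1}^N s_i\,\sigma_{K_i^{v_i}}(\mathbf{y})$$ as rational functions.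
   Context: For $T\subseteq\mathbb{R}^n$, $\sigma_T(\mathbf{y})=\sum_{\alpha\in T\cap\mathbb{Z}^n}y_1^{\alpha_1}\cdots y_n^{\alpha_n}$. For rational polyhedra containing no straight line this is identified with the rational function it represents. For an $n\times(m+1)$ rational matrix with columns $w_1,\dots,w_m,v$, set $K^{\cdot}(w_1,\dots,w_m,v)=\{v+\sum_i k_iw_i: k_i\in\mathbb{R}_{\ge0}\}$. It is called a shifted simplicial cone if $w_1,\dots,w_m$ are linearly independent. Matrix forms. Let $M=\begin{pmatrix} \mathrm{id}_n & \mathbf{0}\\ A&-\mathbf{b}\end{pmatrix}$, an $(n+r)\times(n+1)$ matrix. For a matrix $O$ of this size, $i\in[r]=\{1,\dots,r\}$ and $j\in[n]$ with the $(n+i,j)$ entry nonzero, $O\leftarrow(i,j)$ is the matrix obtained from $O$ by adding $-O_{n+i,s}/O_{n+i,j}$ times column $j$ to column $s$ for every $s\ne j$. The entry $O_{n+i,j}$ is the pivot item; after the operation row $n+i$ and column $j$ are ignored. A term is a tuple $(s,O,I,J)$ with $s\in\{\pm1\}$, $I\subseteq[r]$ the set of indices $i$ whose rows $n+i$ are ignored, and $J\subseteq[n]$ the set of ignored columns. Contributing columns. Fix a term $(s,O,I,J)$ and $i\in[r]\setminus I$. For $j\in[n]\setminus J$ let $\gamma_j$ be the $j$th column of $O$ with the rows $n+I$ ignored, and let $p_j$ be its entry in row $n+i$. A column vector is small if its first nonzero entry is positive and large otherwise. Column $j$ is contributing (with respect to the variable $\lambda_i$ attached to row $n+i$) if $p_j\neq0$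 and $p_j\gamma_j$ is small, and dually contributing if $p_j\ne0$ and $p_j\gamma_j$ is large. Let $b_0=O_{n+i,n+1}$, $\deg=b_0-\sum_{j\notin J,\,p_j>0}p_j$ and $\mathrm{ord}=-b_0+\sum_{j\notin J,\,p_j<0}p_j$. The contributing formula is applicable for $i$ if $\deg<0$; the dual formula is applicable for $i$ if $\mathrm{ord}<0$. Algorithm SimpCone[S]. Start with the collection $O_0=\{(1,M,\varnothing,\varnothing)\}$. For $t=0,1,\dots,r-1$, build the collection $O_{t+1}$ from $O_t$ as follows. For each term $(s,O,I,J)$ of $O_t$, choose, according to the strategy $S$, an index $i\in[r]\setminus I$ and one formula applicable for $i$ (contributing or dual). If the contributing formula is chosen, add to $O_{t+1}$ the terms $(s\cdot\mathrm{sgn}(p_j),\,O\leftarrow(i,j),\,I\cup\{i\},\,J\cup\{j\})$ for all contributing $j$. If the dual formula is chosen, add the terms $(-s\cdot\mathrm{sgn}(p_j),\,O\leftarrow(i,j),\,I\cup\{i\},\,J\cup\{j\})$ for all dually contributing $j$. Output $O_r$ (in which $I=[r]$ for every term, so $I$ is dropped). A strategy is a rule for making these choices. -}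

module Defs where

open import Data.Bool.Base using (if_then_else_)
open import Data.Fin.Base using (Fin; zero; splitAt; _↑ˡ_; _↑ʳ_)
open import Data.Fin.Properties using (_≟_)
open import Data.Fin.Subset using (Subset; ⊥; ⁅_⁆; _∪_; _∉_)
open import Data.Fin.Subset.Properties using (_∈?_)
open import Data.Integer.Base as ℤ using (ℤ; 0ℤ; 1ℤ)
import Data.Integer.Properties as ℤ
open import Data.List.Base as List
  using (List; []; _∷_; _++_; allFin; cartesianProductWith; concat; filter; length; lookup; mapMaybe; tabulate)
open import Data.List.Relation.Unary.All using (All; reduce)
import Data.Maybe.Base as Maybe
open import Data.Nat.Base using (ℕ; suc; _+_; _⊔_; _≥_)
import Data.Nat.Properties as ℕ
open import Data.Product.Base using (∃-syntax; Σ-syntax; _×_; _,_; proj₁)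
open import Data.Rational.Base as ℚ using (ℚ; 0ℚ; 1ℚ; ½; ∣_∣; _<_)
import Data.Rational.Properties as ℚ
open import Data.Rational.Solver using (module +-*-Solver)
open import Data.Sign.Base using (Sign; opposite) renaming (_*_ to _*ₛ_; + to pos)
open import Data.Sum.Base using (_⊎_; inj₁; inj₂)
open import Data.Vec.Base as Vec using (Vec)
import Data.Vec.Properties as Vec
open import Data.Vec.Functional as Vector using (Vector)
open import Function.Base using (_∘_)
open import Relation.Binary.PropositionalEquality
  using (_≡_; _≢_; refl; sym; trans; cong; subst)
open import Relation.Nullary using (¬_; Dec; yes; no; does)
open import Relation.Nullary.Decidable using (dec⇒maybe; ¬?; _×-dec_)
open import Relation.Unary using (Pred; Decidable)
open import Level using (0ℓ)

private
  variable
    m n r : ℕ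

Matrix : ℕ → ℕ → Set
Matrix a b = Vector (Vector ℚ b) a

fromℤ : ℤ → ℚ
fromℤ z = z ℚ./ 1

∑ℚ : List ℚ → ℚ
∑ℚ = List.foldr ℚ._+_ 0ℚ

∑ℤ : List ℤ → ℤ
∑ℤ = List.foldr ℤ._+_ 0ℤ

-- Cauchy sequences of rationals modulo null sequences (_≈_). All the matrices
-- that occur are rational, so multiplication by a rational is the only
-- multiplication required.

record ℝ : Set where
  field
    seq    : ℕ → ℚ
    cauchy : ∀ ε → 0ℚ < ε →
             ∃[ N ] (∀ k l → k ≥ N → l ≥ N → ∣ seq k ℚ.- seq l ∣ < ε)

open ℝ public

infix 4 _≈_ _≤_
infixl 6 _⊕_
infixr 7 _⊙_

_≈_ : ℝ → ℝ → Set
x ≈ y = ∀ ε → 0ℚ < ε → ∃[ N ] (∀ k → k ≥ N → ∣ seq x k ℚ.- seq y k ∣ < ε)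

_≤_ : ℝ → ℝ → Set
x ≤ y = ∀ ε → 0ℚ < ε → ∃[ N ] (∀ k → k ≥ N → seq x k < seq y k ℚ.+ ε)

fromℚ : ℚ → ℝ
fromℚ q .seq _ = q
fromℚ q .cauchy ε 0<ε = 0 , λ _ _ _ _ →
  subst (_< ε) (sym (cong ∣_∣ (ℚ.+-inverseʳ q))) 0<ε

0ℝ : ℝ
0ℝ = fromℚ 0ℚ

private
  half-pos : ∀ {ε} → 0ℚ < ε → 0ℚ < ½ ℚ.* ε
  half-pos {ε} 0<ε =
    subst (_< ½ ℚ.* ε) (ℚ.*-zeroʳ ½) (ℚ.*-monoʳ-<-pos ½ 0<ε)

  halves : ∀ ε → ½ ℚ.* ε ℚ.+ ½ ℚ.* ε ≡ ε
  halves ε = trans (sym (ℚ.*-distribʳ-+ ε ½ ½)) (ℚ.*-identityˡ ε)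

  +-interchange : ∀ a b c d →
    (a ℚ.+ b) ℚ.- (c ℚ.+ d) ≡ (a ℚ.- c) ℚ.+ (b ℚ.- d)
  +-interchange = solve 4
    (λ a b c d → (a :+ b) :- (c :+ d) := (a :- c) :+ (b :- d)) refl
    where open +-*-Solver

  *-distrib-minus : ∀ q a b → q ℚ.* a ℚ.- q ℚ.* b ≡ q ℚ.* (a ℚ.- b)
  *-distrib-minus = solve 3 (λ q a b → q :* a :- q :* b := q :* (a :- b)) refl
    where open +-*-Solver

_⊕_ : ℝ → ℝ → ℝ
(x ⊕ y) .seq k = seq x k ℚ.+ seq y k
(x ⊕ y) .cauchy ε 0<ε =
  let (N₁ , h₁) = cauchy x (½ ℚ.* ε) (half-pos 0<ε)
      (N₂ , h₂) = cauchy y (½ ℚ.* ε) (half-pos 0<ε)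
  in N₁ ⊔ N₂ , λ k l k≥ l≥ →
    let u = seq x k ℚ.- seq x l
        v = seq y k ℚ.- seq y l
    in begin-strict
      ∣ (seq x k ℚ.+ seq y k) ℚ.- (seq x l ℚ.+ seq y l) ∣
        ≡⟨ cong ∣_∣ (+-interchange (seq x k) (seq y k) (seq x l) (seq y l)) ⟩
      ∣ u ℚ.+ v ∣
        ≤⟨ ℚ.∣p+q∣≤∣p∣+∣q∣ u v ⟩
      ∣ u ∣ ℚ.+ ∣ v ∣
        <⟨ ℚ.+-mono-< (h₁ k l (ℕ.m⊔n≤o⇒m≤o N₁ N₂ k≥) (ℕ.m⊔n≤o⇒m≤o N₁ N₂ l≥))
                      (h₂ k l (ℕ.m⊔n≤o⇒n≤o N₁ N₂ k≥) (ℕ.m⊔n≤o⇒n≤o N₁ N₂ l≥)) ⟩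
      ½ ℚ.* ε ℚ.+ ½ ℚ.* ε
        ≡⟨ halves ε ⟩
      ε ∎
  where open ℚ.≤-Reasoning

_⊙_ : ℚ → ℝ → ℝ
(q ⊙ x) .seq k = q ℚ.* seq x k
(q ⊙ x) .cauchy ε 0<ε =
  let (N , h) = cauchy x δ 0<δ
  in N , λ k l k≥ l≥ →
    let u = seq x k ℚ.- seq x l
    in begin-strict
      ∣ q ℚ.* seq x k ℚ.- q ℚ.* seq x l ∣
        ≡⟨ cong ∣_∣ (*-distrib-minus q (seq x k) (seq x l)) ⟩
      ∣ q ℚ.* u ∣
        ≡⟨ ℚ.∣p*q∣≡∣p∣*∣q∣ q u ⟩
      ∣ q ∣ ℚ.* ∣ u ∣
        ≤⟨ ℚ.*-monoʳ-≤-nonNeg ∣ u ∣ {{ℚ.∣-∣-nonNeg u}} (ℚ.<⇒≤ ∣q∣<B) ⟩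
      B ℚ.* ∣ u ∣
        <⟨ ℚ.*-monoʳ-<-pos B {{B-pos}} (h k l k≥ l≥) ⟩
      B ℚ.* δ
        ≡⟨ sym (ℚ.*-assoc B (ℚ.1/ B) ε) ⟩
      B ℚ.* ℚ.1/ B ℚ.* ε
        ≡⟨ cong (ℚ._* ε) (ℚ.*-inverseʳ B) ⟩
      1ℚ ℚ.* ε
        ≡⟨ ℚ.*-identityˡ ε ⟩
      ε ∎
  where
  open ℚ.≤-Reasoning
  B : ℚ
  B = 1ℚ ℚ.+ ∣ q ∣
  ∣q∣<B : ∣ q ∣ < B
  ∣q∣<B = subst (_< B) (ℚ.+-identityˡ ∣ q ∣)
                (ℚ.+-monoˡ-< ∣ q ∣ (ℚ.positive⁻¹ 1ℚ))
  B-pos : ℚ.Positive B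
  B-pos = ℚ.positive (ℚ.≤-<-trans (ℚ.0≤∣p∣ q) ∣q∣<B)
  instance
    B≢0 : ℚ.NonZero B
    B≢0 = ℚ.pos⇒nonZero B {{B-pos}}
  δ : ℚ
  δ = ℚ.1/ B ℚ.* ε
  0<δ : 0ℚ < δ
  0<δ = subst (_< δ) (ℚ.*-zeroʳ (ℚ.1/ B))
              (ℚ.*-monoʳ-<-pos (ℚ.1/ B) {{ℚ.1/pos⇒pos B {{B-pos}}}} 0<ε)

∑ℝ : Vector ℝ n → ℝ
∑ℝ = Vector.foldr _⊕_ 0ℝ

P : Vector (Vector ℤ n) r → Vector ℤ r → Pred (Vector ℝ n) 0ℓ
P A b α = (∀ j → 0ℝ ≤ α j) ×
          (∀ i → ∑ℝ (λ j → fromℤ (A i j) ⊙ α j) ≈ fromℚ (fromℤ (b i)))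

-- The columns of W are w₁, …, wₘ.
K· : Matrix n m → Vector ℚ n → Pred (Vector ℝ n) 0ℓ
K· {m = m} W v x = Σ[ k ∈ Vector ℝ m ] (∀ i → 0ℝ ≤ k i) ×
  (∀ j → x j ≈ fromℚ (v j) ⊕ ∑ℝ (λ i → W j i ⊙ k i))

-- K· W v is a shifted simplicial cone when the columns of W are independent.
LinearlyIndependentColumns : Matrix n m → Set
LinearlyIndependentColumns {m = m} W = (c : Vector ℝ m) →
  (∀ j → ∑ℝ (λ i → W j i ⊙ c i) ≈ 0ℝ) → ∀ i → c i ≈ 0ℝ

-- Finite sums of monomials c·y^u with repetitions of u allowed, so equality is
-- equality of all coefficients (_≋_).
LaurentPolynomial : ℕ → Set
LaurentPolynomial n = List (ℤ × Vec ℤ n)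

coeff : LaurentPolynomial n → Vec ℤ n → ℤ
coeff p α = ∑ℤ (List.map
  (λ (c , u) → if does (Vec.≡-dec ℤ._≟_ u α) then c else 0ℤ) p)

infix 4 _≋_ _≃_

_≋_ : LaurentPolynomial n → LaurentPolynomial n → Set
p ≋ q = ∀ α → coeff p α ≡ coeff q α

_⊛_ : LaurentPolynomial n → LaurentPolynomial n → LaurentPolynomial n
_⊛_ = cartesianProductWith (λ (c , u) (d , v) → c ℤ.* d , Vec.zipWith ℤ._+_ u v)

monomial : ℤ → LaurentPolynomial n
monomial c = (c , Vec.replicate _ 0ℤ) ∷ []

record Fraction (n : ℕ) : Set where
  constructor _÷_
  field
    num den : LaurentPolynomial n

open Fraction public

-- Fractions with zero denominator are not excluded from the type, but only
-- genuine rational functions can be related by _≃_.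
_≃_ : Fraction n → Fraction n → Set
f ≃ g = ¬ den f ≋ [] × ¬ den g ≋ [] × num f ⊛ den g ≋ num g ⊛ den f

_+ᶠ_ : Fraction n → Fraction n → Fraction n
f +ᶠ g = (num f ⊛ den g ++ num g ⊛ den f) ÷ (den f ⊛ den g)

_*ᶠ_ : Sign → Fraction n → Fraction n
s *ᶠ f = (monomial (s ℤ.◃ 1) ⊛ num f) ÷ den f

∑ᶠ : Vector (Fraction n) m → Fraction n
∑ᶠ = Vector.foldr _+ᶠ_ ([] ÷ monomial 1ℤ)

-- Formal sums ∑ f(α) y^α over all of ℤⁿ; Laurent polynomials act on them.
Series : ℕ → Set
Series n = Vec ℤ n → ℤ

_•_ : LaurentPolynomial n → Series n → Series n
(p • f) α = ∑ℤ (List.map (λ (c , u) → c ℤ.* f (Vec.zipWith ℤ._-_ α u)) p)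

latticePoint : Vec ℤ n → Vector ℝ n
latticePoint α j = fromℚ (fromℤ (Vec.lookup α j))

σ : {T : Pred (Vector ℝ n) 0ℓ} → Decidable (T ∘ latticePoint) → Series n
σ T? α = if does (T? α) then 1ℤ else 0ℤ

-- σ_T represents the rational function p/q when q ≠ 0 and q·σ_T = p. At most
-- one rational function has this property: q·σ_T = p and q′·σ_T = p′ give
-- q′p = q′q·σ_T = qp′.
record σ[_]represents_ (T : Pred (Vector ℝ n) 0ℓ) (f : Fraction n) : Set where
  field
    den≉0      : ¬ den f ≋ []
    member?    : Decidable (T ∘ latticePoint)
    den·σ≡num  : ∀ α → (den f • σ {T = T} member?) α ≡ coeff (num f) α

data Small : List ℚ → Set where
  here  : ∀ {x xs} → 0ℚ < x → Small (x ∷ xs)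
  there : ∀ {x xs} → x ≡ 0ℚ → Small xs → Small (x ∷ xs)

Large : List ℚ → Set
Large xs = ¬ Small xs

small? : Decidable Small
small? []       = no λ ()
small? (x ∷ xs) with 0ℚ ℚ.<? x | x ℚ.≟ 0ℚ | small? xs
... | yes 0<x | _       | _     = yes (here 0<x)
... | no  0≮x | no  x≢0 | _     = no λ { (here 0<x) → 0≮x 0<x ; (there x≡0 _) → x≢0 x≡0 }
... | no  _   | yes x≡0 | yes s = yes (there x≡0 s)
... | no  0≮x | yes _   | no ¬s = no λ { (here 0<x) → 0≮x 0<x ; (there _ s) → ¬s s }

-- The indices that are not ignored, in increasing order.
remaining : Subset n → List (Fin n)
remaining J = filter (λ j → ¬? (j ∈? J)) (allFin _)

-- The matrix (idₙ 0; A -b).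
M : Vector (Vector ℤ n) r → Vector ℤ r → Matrix (n + r) (n + 1)
M {n = n} A b k l = entry (splitAt n k) (splitAt n l)
  where
  entry : Fin n ⊎ Fin _ → Fin n ⊎ Fin 1 → ℚ
  entry (inj₁ i) (inj₁ j) = if does (i ≟ j) then 1ℚ else 0ℚ
  entry (inj₁ i) (inj₂ _) = 0ℚ
  entry (inj₂ i) (inj₁ j) = fromℤ (A i j)
  entry (inj₂ i) (inj₂ _) = ℚ.- fromℤ (b i)

record Term (n r : ℕ) : Set where
  constructor term
  field
    s : Sign
    O : Matrix (n + r) (n + 1)
    I : Subset r
    J : Subset n

  top : Fin n → Fin (n + 1) → ℚ
  top k = O (k ↑ˡ r)

  bottom : Fin r → Fin (n + 1) → ℚ
  bottom i = O (n ↑ʳ i)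

  col : Fin n → Fin (n + 1)
  col j = j ↑ˡ 1

  lastCol : Fin (n + 1)
  lastCol = n ↑ʳ zero

  p : Fin r → Fin n → ℚ
  p i j = bottom i (col j)

  γ : Fin n → List ℚ
  γ j = tabulate (λ k → top k (col j)) ++
        List.map (λ i → bottom i (col j)) (remaining I)

  b₀ : Fin r → ℚ
  b₀ i = bottom i lastCol

  deg ord : Fin r → ℚ
  deg i = b₀ i ℚ.- ∑ℚ (filter (0ℚ ℚ.<?_) (List.map (p i) (remaining J)))
  ord i = ℚ.- b₀ i ℚ.+ ∑ℚ (filter (ℚ._<? 0ℚ) (List.map (p i) (remaining J)))

  pivot : (i : Fin r) (j : Fin n) .{{_ : ℚ.NonZero (p i j)}} →
          Matrix (n + r) (n + 1)
  pivot i j k l =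
    if does (l ≟ col j) then O k l
    else O k l ℚ.+ (ℚ.- (bottom i l ℚ.÷ p i j)) ℚ.* O k (col j)

  -- The cone K·(O) with the bottom rows and the columns in J deleted.
  generators : Matrix n (length (remaining J))
  generators k c = top k (col (lookup (remaining J) c))

  vertex : Vector ℚ n
  vertex k = top k lastCol

  cone : Pred (Vector ℝ n) 0ℓ
  cone = K· generators vertex

data Formula : Set where
  contributing dual : Formula

module _ (τ : Term n r) where
  open Term τ

  Applicable : Formula → Fin r → Set
  Applicable contributing i = deg i < 0ℚ
  Applicable dual         i = ord i < 0ℚ

  Contributing DuallyContributing : Fin r → Fin n → Set
  Contributing       i j = p i j ≢ 0ℚ × Small (List.map (p i j ℚ.*_) (γ j))
  DuallyContributing i j = p i j ≢ 0ℚ × Large (List.map (p i j ℚ.*_) (γ j))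

  contributing? : ∀ i j → Dec (Contributing i j)
  contributing? i j = ¬? (p i j ℚ.≟ 0ℚ) ×-dec small? _

  duallyContributing? : ∀ i j → Dec (DuallyContributing i j)
  duallyContributing? i j = ¬? (p i j ℚ.≟ 0ℚ) ×-dec ¬? (small? _)

  child : Sign → (i : Fin r) (j : Fin n) → p i j ≢ 0ℚ → Term n r
  child s′ i j p≢0 = term
    (s′ *ₛ ℤ.sign (ℚ.numerator (p i j)))
    (pivot i j {{ℚ.≢-nonZero p≢0}})
    (I ∪ ⁅ i ⁆) (J ∪ ⁅ j ⁆)

  children : Formula → Fin r → List (Term n r)
  children contributing i = mapMaybe
    (λ j → Maybe.map (child s i j ∘ proj₁) (dec⇒maybe (contributing? i j)))
    (remaining J)
  children dual i = mapMaybe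
    (λ j → Maybe.map (child (opposite s) i j ∘ proj₁) (dec⇒maybe (duallyContributing? i j)))
    (remaining J)

  record Choice : Set where
    field
      index      : Fin r
      index∉I    : index ∉ I
      formula    : Formula
      applicable : Applicable formula index

  expand : Choice → List (Term n r)
  expand c = children (Choice.formula c) (Choice.index c)

nextTerms : {ts : List (Term n r)} → All Choice ts → List (Term n r)
nextTerms cs = concat (reduce (λ {τ} → expand τ) cs)

-- The choices of a strategy during t successive rounds started from a given
-- collection: a legal choice for each of its terms, followed by the choices for
-- the remaining rounds. Legality is built in because no choice is legal once
-- all rows not in I vanish (e.g. a redundant equation in Aα = b).
data Rounds {n r : ℕ} : ℕ → List (Term n r) → Set where
  stop : ∀ {ts} → Rounds 0 ts
  _▸_  : ∀ {t ts} (cs : All Choice ts) → Rounds t (nextTerms cs) → Rounds (suc t) ts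

final : ∀ {t} {ts : List (Term n r)} → Rounds t ts → List (Term n r)
final {ts = ts} stop = ts
final (_ ▸ S)        = final S

Strategy : Vector (Vector ℤ n) r → Vector ℤ r → Set
Strategy {r = r} A b = Rounds r (term pos (M A b) ⊥ ⊥ ∷ [])

SimpCone : (A : Vector (Vector ℤ n) r) (b : Vector ℤ r) → Strategy A b → List (Term n r)
SimpCone A b S = final S

-- At a term (s, O, I, J) the columns not in J correspond to the
-- coordinates αₜ, t ∉ J, and the cone of the term is {α : αₜ ≥ 0 for t ∉ J} on
-- the plane (Aα = b)_I. Expanding its rational function in the order
-- small/large replaces αₜ ≥ 0 by -[αₜ < 0] whenever column t is large, and
-- taking the full constant term in the remaining λᵢ restricts to Aα = b. The
-- resulting series of a term is the sum of the series of its children, point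
-- by point: after scaling the columns by 1/pₜ and ordering them
-- lexicographically, the sum over the (dually) contributing columns
-- telescopes, and deg < 0 (ord < 0) kills the far end of the telescope.
-- Initially the series is σ of P(A, b). A final term has I = [r], and its series
-- differs from ±σ of its cone only by flips [k ≥ 0] ↦ -[k < 0], which do not
-- change the rational function with denominator ∏ (1 - y^(N wₜ)).

module Submission where

open import Defs
open import Algebra.Structures using (IsCommutativeMonoid)
import Algebra.Properties.Group as GroupProperties
open import Data.Bool.Base using (Bool; true; false; if_then_else_; not; _∧_)
open import Data.Bool.Properties using (∧-identityʳ)
open import Data.Empty using (⊥-elim)
open import Data.Fin.Base as Fin using (Fin; zero; suc; splitAt; _↑ˡ_; _↑ʳ_)
import Data.Fin.Properties as Fin
open import Data.Fin.Subset as Subset using (Subset; ⁅_⁆; _∪_) renaming (_∈_ to _∈ₛ_; _∉_ to _∉ₛ_)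
import Data.Fin.Subset.Properties as Subset
open import Data.Integer.Base as ℤ using (ℤ; 0ℤ; 1ℤ; -1ℤ; +_; -[1+_])
import Data.Integer.Properties as ℤ
open import Data.Integer.Solver using () renaming (module +-*-Solver to ℤ-Solver)
open import Data.List.Base as List
  using (List; []; _∷_; _++_; allFin; cartesianProductWith; deduplicate; filter; foldr; length; lookup;
         map; mapMaybe; tabulate; upTo)
import Data.List.Membership.DecPropositional as DecMembership
open import Data.List.Membership.Propositional using (_∈_; _∉_)
open import Data.List.Membership.Propositional.Properties
  using (∈-allFin; ∈-cartesianProductWith⁺; ∈-deduplicate⁺; ∈-filter⁺; ∈-filter⁻; ∈-lookup;
         ∈-map⁺; ∈-map⁻; ∈-upTo⁺; ∈-++⁺ˡ; ∈-++⁺ʳ)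
import Data.List.Properties as List
open import Data.List.Relation.Unary.All as All using (All; []; _∷_)
open import Data.List.Relation.Unary.All.Properties using () renaming (++⁺ to All-++⁺)
open import Data.List.Relation.Unary.AllPairs using ([]; _∷_)
open import Data.List.Relation.Unary.Any using (here; there)
open import Data.List.Relation.Unary.Unique.DecPropositional.Properties using (deduplicate-!)
open import Data.List.Relation.Unary.Unique.Propositional using (Unique)
import Data.List.Relation.Unary.Unique.Propositional.Properties as Unique
open import Data.Maybe.Base as Maybe using (Maybe; just; nothing; maybe)
open import Data.Nat.Base as ℕ using (ℕ)
open import Data.Nat.ListAction using (sum)
import Data.Nat.Properties as ℕ
open import Data.Product.Base using (∃-syntax; Σ-syntax; _×_; _,_; proj₁; proj₂)
open import Data.Rational.Base as ℚ using (ℚ; 0ℚ; 1ℚ; ½)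
import Data.Rational.Properties as ℚ
open import Data.Rational.Solver using () renaming (module +-*-Solver to ℚ-Solver)
import Data.Rational.Unnormalised.Base as ℚᵘ
import Data.Rational.Unnormalised.Properties as ℚᵘ
open import Data.Sign.Base as Sign using (Sign)
open import Data.Sum.Base using (_⊎_; inj₁; inj₂; [_,_])
open import Data.Vec.Base as Vec using (Vec; []; _∷_)
import Data.Vec.Properties as Vec
open import Data.Vec.Functional as Vector using (Vector)
open import Function.Base using (_∘_; id; const)
open import Function.Bundles using (mk⇔)
open import Relation.Binary.Definitions using (DecidableEquality; Tri; tri<; tri≈; tri>)
open import Relation.Binary.PropositionalEquality hiding ([_]; J)
open import Relation.Nullary using (¬_; Dec; yes; no; does)
open import Relation.Nullary.Decidable
  using (dec-true; dec-false; dec⇒maybe; decidable-stable; does-⇔; map′; ¬?; _×-dec_)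
open import Relation.Unary using (Pred; Decidable)

-- No rational function is compared before the leaves of the recursion. With the constant term in
-- the `λᵢ` already taken, a term carries one integer for every lattice point, so conservation is an
-- identity between finite products of integers at each fixed `α`, and no expansion ring enters. For
-- `α` on the plane the coordinates `αₜ`, `t ∉ J`, are exactly the coefficients of the generators,
-- hence integers. `P` itself offers no denominator, so its rational function is assembled from
-- those of the leaves. The obstacle is then that a product of many denominators has to be non-zero.
-- Each factor `1 - y^u` is shown to annihilate no non-zero Laurent polynomial, a property that
-- passes to products at once. The exponents `u` must be integral although the generators are
-- rational; this is the origin of the common denominator `N`.

private variable n r : ℕ

-- Finite sums and products over lists

module BigOp {C : Set} {_∙_ : C → C → C} {ε : C}
             (isCM : IsCommutativeMonoid _≡_ _∙_ ε) where
  open IsCommutativeMonoid isCM using (assoc; comm; identityˡ; identityʳ)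

  -- This is the form to which `coeff` and `_•_` unfold, so the lemmas below apply to them without
  -- conversion.
  fold : ∀ {A : Set} → List A → (A → C) → C
  fold xs f = foldr _∙_ ε (map f xs)

  module _ {A : Set} where

    fold-cong : ∀ {f g : A → C} xs → (∀ {x} → x ∈ xs → f x ≡ g x) → fold xs f ≡ fold xs g
    fold-cong []       _   = refl
    fold-cong (x ∷ xs) f≗g = cong₂ _∙_ (f≗g (here refl)) (fold-cong xs (f≗g ∘ there))

    fold-ε : ∀ (xs : List A) → fold xs (λ _ → ε) ≡ ε
    fold-ε []       = refl
    fold-ε (x ∷ xs) = trans (identityˡ _) (fold-ε xs)

    interchange : ∀ a b c d → (a ∙ b) ∙ (c ∙ d) ≡ (a ∙ c) ∙ (b ∙ d)
    interchange a b c d = begin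
      (a ∙ b) ∙ (c ∙ d)  ≡⟨ assoc a b _ ⟩
      a ∙ (b ∙ (c ∙ d))  ≡⟨ cong (a ∙_) (assoc b c d) ⟨
      a ∙ ((b ∙ c) ∙ d)  ≡⟨ cong (λ z → a ∙ (z ∙ d)) (comm b c) ⟩
      a ∙ ((c ∙ b) ∙ d)  ≡⟨ cong (a ∙_) (assoc c b d) ⟩
      a ∙ (c ∙ (b ∙ d))  ≡⟨ assoc a c _ ⟨
      (a ∙ c) ∙ (b ∙ d)  ∎
      where open ≡-Reasoning

    fold-∙ : ∀ (xs : List A) f g → fold xs (λ x → f x ∙ g x) ≡ fold xs f ∙ fold xs g
    fold-∙ []       f g = sym (identityˡ ε)
    fold-∙ (x ∷ xs) f g = trans (cong ((f x ∙ g x) ∙_) (fold-∙ xs f g)) (interchange _ _ _ _)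

    fold-++ : ∀ (xs ys : List A) f → fold (xs ++ ys) f ≡ fold xs f ∙ fold ys f
    fold-++ []       ys f = sym (identityˡ _)
    fold-++ (x ∷ xs) ys f = trans (cong (f x ∙_) (fold-++ xs ys f)) (sym (assoc _ _ _))

    fold-filter : ∀ {p} {P : Pred A p} (P? : Decidable P) xs f →
      fold (filter P? xs) f ≡ fold xs (λ x → if does (P? x) then f x else ε)
    fold-filter P? []       f = refl
    fold-filter P? (x ∷ xs) f with does (P? x)
    ... | true  = cong (f x ∙_) (fold-filter P? xs f)
    ... | false = trans (fold-filter P? xs f) (sym (identityˡ _))

    fold-lookup : ∀ xs (f : A → C) → Vector.foldr _∙_ ε (f ∘ lookup xs) ≡ fold xs f
    fold-lookup []       f = refl
    fold-lookup (x ∷ xs) f = cong (f x ∙_) (fold-lookup xs f)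

    module _ (_≟_ : DecidableEquality A) where

      fold-remove-∉ : ∀ {x} xs f → x ∉ xs → fold xs (λ y → if does (y ≟ x) then ε else f y) ≡ fold xs f
      fold-remove-∉ {x} xs f x∉xs = fold-cong xs λ {y} y∈xs →
        cong (if_then ε else f y) (dec-false (y ≟ x) λ { refl → x∉xs y∈xs })

      -- The value at `x` is overwritten by the unit instead of deleting `x` from the list, so that
      -- the remaining fold runs over the same list and can be compared entry by entry.
      fold-remove : ∀ {x xs} f → Unique xs → x ∈ xs →
        fold xs f ≡ f x ∙ fold xs (λ y → if does (y ≟ x) then ε else f y)
      fold-remove {x} {_ ∷ xs} f (x∉ ∷ _) (here refl)
        rewrite dec-true (x ≟ x) refl =
        cong (f x ∙_) (trans (sym (fold-remove-∉ xs f λ x∈ → All.lookup x∉ x∈ refl)) (sym (identityˡ _)))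
      fold-remove {x} {y ∷ xs} f (y∉ ∷ uniq) (there x∈)
        rewrite dec-false (y ≟ x) (All.lookup y∉ x∈) = begin
        f y ∙ fold xs f  ≡⟨ cong (f y ∙_) (fold-remove f uniq x∈) ⟩
        f y ∙ (f x ∙ R)  ≡⟨ assoc _ _ _ ⟨
        (f y ∙ f x) ∙ R  ≡⟨ cong (_∙ R) (comm _ _) ⟩
        (f x ∙ f y) ∙ R  ≡⟨ assoc _ _ _ ⟩
        f x ∙ (f y ∙ R)  ∎
        where
        open ≡-Reasoning
        R = fold xs (λ z → if does (z ≟ x) then ε else f z)

  fold-∘ : ∀ {A B : Set} xs (g : A → B) (f : B → C) → fold (map g xs) f ≡ fold xs (f ∘ g)
  fold-∘ xs g f = cong (foldr _∙_ ε) (sym (List.map-∘ xs))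

  fold-swap : ∀ {A B : Set} xs ys (f : A → B → C) →
    fold xs (λ x → fold ys (f x)) ≡ fold ys (λ y → fold xs (λ x → f x y))
  fold-swap []       ys f = sym (fold-ε ys)
  fold-swap (x ∷ xs) ys f = trans (cong (fold ys (f x) ∙_) (fold-swap xs ys f)) (sym (fold-∙ ys _ _))

  fold-allFin : ∀ {n} (f : Fin n → C) → Vector.foldr _∙_ ε f ≡ fold (allFin n) f
  fold-allFin f = trans (tab f) (cong (foldr _∙_ ε) (sym (List.map-tabulate id f)))
    where
    tab : ∀ {n} (f : Fin n → C) → Vector.foldr _∙_ ε f ≡ foldr _∙_ ε (List.tabulate f)
    tab {ℕ.zero}  f = refl
    tab {ℕ.suc n} f = cong (f zero ∙_) (tab (f ∘ suc))

module ∑ℤ = BigOp ℤ.+-0-isCommutativeMonoid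
module ∏ℤ = BigOp ℤ.*-1-isCommutativeMonoid
module ∑ℚ = BigOp ℚ.+-0-isCommutativeMonoid

sumℤ prodℤ : ∀ {A : Set} → List A → (A → ℤ) → ℤ
sumℤ  = ∑ℤ.fold
prodℤ = ∏ℤ.fold

sumℚ : ∀ {A : Set} → List A → (A → ℚ) → ℚ
sumℚ = ∑ℚ.fold

module _ {A : Set} where

  sumℤ-* : ∀ c (xs : List A) f → sumℤ xs (λ x → c ℤ.* f x) ≡ c ℤ.* sumℤ xs f
  sumℤ-* c []       f = sym (ℤ.*-zeroʳ c)
  sumℤ-* c (x ∷ xs) f =
    trans (cong (λ z → c ℤ.* f x ℤ.+ z) (sumℤ-* c xs f)) (sym (ℤ.*-distribˡ-+ c _ _))

  sumℚ-* : ∀ c (xs : List A) f → sumℚ xs (λ x → c ℚ.* f x) ≡ c ℚ.* sumℚ xs f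
  sumℚ-* c []       f = sym (ℚ.*-zeroʳ c)
  sumℚ-* c (x ∷ xs) f =
    trans (cong (λ z → c ℚ.* f x ℚ.+ z) (sumℚ-* c xs f)) (sym (ℚ.*-distribˡ-+ c _ _))

  sumℚ-mono : ∀ (xs : List A) {f g} → (∀ x → x ∈ xs → f x ℚ.≤ g x) → sumℚ xs f ℚ.≤ sumℚ xs g
  sumℚ-mono []       f≤g = ℚ.≤-refl
  sumℚ-mono (x ∷ xs) f≤g = ℚ.+-mono-≤ (f≤g x (here refl)) (sumℚ-mono xs λ y → f≤g y ∘ there)

  prodℤ-zero : ∀ {x} (xs : List A) f → x ∈ xs → f x ≡ 0ℤ → prodℤ xs f ≡ 0ℤ
  prodℤ-zero (x ∷ xs) f (here refl) fx≡0 = cong (ℤ._* prodℤ xs f) fx≡0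
  prodℤ-zero (x ∷ xs) f (there x∈)  fx≡0 =
    trans (cong (f x ℤ.*_) (prodℤ-zero xs f x∈ fx≡0)) (ℤ.*-zeroʳ (f x))

module ℚ-Group = GroupProperties ℚ.+-0-group

-- The embedding of ℤ in ℚ

private
  toℚᵘ-fromℤ : ∀ z → ℚ.toℚᵘ (fromℤ z) ℚᵘ.≃ ℚᵘ.mkℚᵘ z 0
  toℚᵘ-fromℤ z = ℚ.toℚᵘ-fromℚᵘ (ℚᵘ.mkℚᵘ z 0)

fromℤ-+ : ∀ a b → fromℤ (a ℤ.+ b) ≡ fromℤ a ℚ.+ fromℤ b
fromℤ-+ a b = ℚ.toℚᵘ-injective (begin
  ℚ.toℚᵘ (fromℤ (a ℤ.+ b))              ≈⟨ toℚᵘ-fromℤ (a ℤ.+ b) ⟩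
  ℚᵘ.mkℚᵘ (a ℤ.+ b) 0                   ≈⟨ ℚᵘ.*≡*
      (cong (ℤ._* 1ℤ) (sym (cong₂ ℤ._+_ (ℤ.*-identityʳ a) (ℤ.*-identityʳ b)))) ⟩
  ℚᵘ.mkℚᵘ a 0 ℚᵘ.+ ℚᵘ.mkℚᵘ b 0          ≈⟨ ℚᵘ.+-cong (toℚᵘ-fromℤ a) (toℚᵘ-fromℤ b) ⟨
  ℚ.toℚᵘ (fromℤ a) ℚᵘ.+ ℚ.toℚᵘ (fromℤ b) ≈⟨ ℚ.toℚᵘ-homo-+ (fromℤ a) (fromℤ b) ⟨
  ℚ.toℚᵘ (fromℤ a ℚ.+ fromℤ b)          ∎)
  where open ℚᵘ.≃-Reasoning

fromℤ-* : ∀ a b → fromℤ (a ℤ.* b) ≡ fromℤ a ℚ.* fromℤ b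
fromℤ-* a b = ℚ.toℚᵘ-injective (begin
  ℚ.toℚᵘ (fromℤ (a ℤ.* b))              ≈⟨ toℚᵘ-fromℤ (a ℤ.* b) ⟩
  ℚᵘ.mkℚᵘ (a ℤ.* b) 0                   ≈⟨ ℚᵘ.≃-refl ⟩
  ℚᵘ.mkℚᵘ a 0 ℚᵘ.* ℚᵘ.mkℚᵘ b 0          ≈⟨ ℚᵘ.*-cong (toℚᵘ-fromℤ a) (toℚᵘ-fromℤ b) ⟨
  ℚ.toℚᵘ (fromℤ a) ℚᵘ.* ℚ.toℚᵘ (fromℤ b) ≈⟨ ℚ.toℚᵘ-homo-* (fromℤ a) (fromℤ b) ⟨
  ℚ.toℚᵘ (fromℤ a ℚ.* fromℤ b)          ∎)
  where open ℚᵘ.≃-Reasoning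

fromℤ-sum : ∀ {X : Set} (xs : List X) (f g : X → ℤ) →
  fromℤ (sumℤ xs (λ x → f x ℤ.* g x)) ≡ sumℚ xs (λ x → fromℤ (f x) ℚ.* fromℤ (g x))
fromℤ-sum []       f g = refl
fromℤ-sum (x ∷ xs) f g =
  trans (fromℤ-+ (f x ℤ.* g x) _) (cong₂ ℚ._+_ (fromℤ-* (f x) (g x)) (fromℤ-sum xs f g))

fromℤ-injective : ∀ {a b} → fromℤ a ≡ fromℤ b → a ≡ b
fromℤ-injective {a} {b} eq with ℚᵘ.≃-trans (ℚᵘ.≃-sym (toℚᵘ-fromℤ a))
    (ℚᵘ.≃-trans (ℚᵘ.≃-reflexive (cong ℚ.toℚᵘ eq)) (toℚᵘ-fromℤ b))
... | ℚᵘ.*≡* e = trans (sym (ℤ.*-identityʳ a)) (trans e (ℤ.*-identityʳ b))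

fromℤ-mono : ∀ {a b} → a ℤ.≤ b → fromℤ a ℚ.≤ fromℤ b
fromℤ-mono {a} {b} a≤b = ℚ.toℚᵘ-cancel-≤
  (ℚᵘ.≤-respˡ-≃ (ℚᵘ.≃-sym (toℚᵘ-fromℤ a)) (ℚᵘ.≤-respʳ-≃ (ℚᵘ.≃-sym (toℚᵘ-fromℤ b))
    (ℚᵘ.*≤* (ℤ.*-monoʳ-≤-nonNeg 1ℤ a≤b))))

fromℤ-cancel : ∀ {a b} → fromℤ a ℚ.≤ fromℤ b → a ℤ.≤ b
fromℤ-cancel {a} {b} le with ℚᵘ.≤-respˡ-≃ (toℚᵘ-fromℤ a) (ℚᵘ.≤-respʳ-≃ (toℚᵘ-fromℤ b) (ℚ.toℚᵘ-mono-≤ le))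
... | ℚᵘ.*≤* e = subst₂ ℤ._≤_ (ℤ.*-identityʳ a) (ℤ.*-identityʳ b) e

-- Laurent polynomials acting on formal series

_≟ᵛ_ : (u v : Vec ℤ n) → Dec (u ≡ v)
_≟ᵛ_ = Vec.≡-dec ℤ._≟_

0⃗ : Vec ℤ n
0⃗ = Vec.replicate _ 0ℤ

infixl 6 _⊖_ _⊞_

_⊖_ _⊞_ : Vec ℤ n → Vec ℤ n → Vec ℤ n
_⊖_ = Vec.zipWith ℤ._-_
_⊞_ = Vec.zipWith ℤ._+_

⊖-⊞ : (α u v : Vec ℤ n) → α ⊖ (u ⊞ v) ≡ α ⊖ u ⊖ v
⊖-⊞ []      []      []      = refl
⊖-⊞ (a ∷ α) (x ∷ u) (y ∷ v) = cong₂ _∷_ (lem a x y) (⊖-⊞ α u v)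
  where
  open ℤ-Solver
  lem : ∀ a x y → a ℤ.- (x ℤ.+ y) ≡ a ℤ.- x ℤ.- y
  lem = solve 3 (λ a x y → a :- (x :+ y) := a :- x :- y) refl

⊞-comm : (u v : Vec ℤ n) → u ⊞ v ≡ v ⊞ u
⊞-comm = Vec.zipWith-comm ℤ.+-comm

⊖-0⃗ : (α : Vec ℤ n) → α ⊖ 0⃗ ≡ α
⊖-0⃗ []      = refl
⊖-0⃗ (a ∷ α) = cong₂ _∷_ (ℤ.+-identityʳ a) (⊖-0⃗ α)

≡⇒⊖≡0⃗ : {u α : Vec ℤ n} → u ≡ α → α ⊖ u ≡ 0⃗
≡⇒⊖≡0⃗ {u = []}    refl = refl
≡⇒⊖≡0⃗ {u = x ∷ u} refl = cong₂ _∷_ (ℤ.+-inverseʳ x) (≡⇒⊖≡0⃗ refl)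

⊖≡0⃗⇒≡ : {u α : Vec ℤ n} → α ⊖ u ≡ 0⃗ → u ≡ α
⊖≡0⃗⇒≡ {u = []}    {[]}    _  = refl
⊖≡0⃗⇒≡ {u = x ∷ u} {a ∷ α} eq =
  cong₂ _∷_ (sym (ℤ.i-j≡0⇒i≡j a x (Vec.∷-injectiveˡ eq))) (⊖≡0⃗⇒≡ (Vec.∷-injectiveʳ eq))

-- The series of the constant 1. Since `coeff p` is `p • δ₀`, identities about products of Laurent
-- polynomials reduce to identities about the action.
δ₀ : Series n
δ₀ β = if does (0⃗ ≟ᵛ β) then 1ℤ else 0ℤ

•-cong : (p : LaurentPolynomial n) {f g : Series n} → (∀ α → f α ≡ g α) → ∀ α → (p • f) α ≡ (p • g) α
•-cong p f≗g α = ∑ℤ.fold-cong p λ {(c , u)} _ → cong (c ℤ.*_) (f≗g (α ⊖ u))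

•-zero : (p : LaurentPolynomial n) {f : Series n} → (∀ α → f α ≡ 0ℤ) → ∀ α → (p • f) α ≡ 0ℤ
•-zero p f≗0 α = trans
  (∑ℤ.fold-cong p λ {(c , u)} _ → trans (cong (c ℤ.*_) (f≗0 (α ⊖ u))) (ℤ.*-zeroʳ c))
  (∑ℤ.fold-ε p)

•-+ : (p : LaurentPolynomial n) (f g : Series n) → ∀ α →
  (p • (λ β → f β ℤ.+ g β)) α ≡ (p • f) α ℤ.+ (p • g) α
•-+ p f g α = trans
  (∑ℤ.fold-cong p λ {(c , u)} _ → ℤ.*-distribˡ-+ c (f (α ⊖ u)) (g (α ⊖ u)))
  (∑ℤ.fold-∙ p _ _)

•-scale : (p : LaurentPolynomial n) (d : ℤ) (f : Series n) → ∀ α →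
  (p • (λ β → d ℤ.* f β)) α ≡ d ℤ.* (p • f) α
•-scale p d f α = trans
  (∑ℤ.fold-cong p λ {(c , u)} _ → lem c d (f (α ⊖ u)))
  (sumℤ-* d p _)
  where
  open ℤ-Solver
  lem : ∀ a x y → a ℤ.* (x ℤ.* y) ≡ x ℤ.* (a ℤ.* y)
  lem = solve 3 (λ a x y → a :* (x :* y) := x :* (a :* y)) refl

⊛-• : (p q : LaurentPolynomial n) (f : Series n) → ∀ α → ((p ⊛ q) • f) α ≡ (p • (q • f)) α
⊛-• []            q f α = refl
⊛-• ((c , u) ∷ p) q f α = trans (∑ℤ.fold-++ (map _ q) (p ⊛ q) _) (cong₂ ℤ._+_ row (⊛-• p q f α))
  where
  row = begin
    sumℤ (map (λ (d , v) → c ℤ.* d , u ⊞ v) q) (λ (d , v) → d ℤ.* f (α ⊖ v))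
      ≡⟨ ∑ℤ.fold-∘ q _ _ ⟩
    sumℤ q (λ (d , v) → c ℤ.* d ℤ.* f (α ⊖ (u ⊞ v)))
      ≡⟨ ∑ℤ.fold-cong q (λ {(d , v)} _ →
           trans (ℤ.*-assoc c d _) (cong (λ β → c ℤ.* (d ℤ.* f β)) (⊖-⊞ α u v))) ⟩
    sumℤ q (λ (d , v) → c ℤ.* (d ℤ.* f (α ⊖ u ⊖ v)))
      ≡⟨ sumℤ-* c q _ ⟩
    c ℤ.* (q • f) (α ⊖ u) ∎
    where open ≡-Reasoning

•-comm : (p q : LaurentPolynomial n) (f : Series n) → ∀ α → (p • (q • f)) α ≡ (q • (p • f)) α
•-comm p q f α = begin
  sumℤ p (λ (c , u) → c ℤ.* sumℤ q (λ (d , v) → d ℤ.* f (α ⊖ u ⊖ v)))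
    ≡⟨ ∑ℤ.fold-cong p (λ {(c , u)} _ → sym (sumℤ-* c q _)) ⟩
  sumℤ p (λ (c , u) → sumℤ q (λ (d , v) → c ℤ.* (d ℤ.* f (α ⊖ u ⊖ v))))
    ≡⟨ ∑ℤ.fold-swap p q _ ⟩
  sumℤ q (λ (d , v) → sumℤ p (λ (c , u) → c ℤ.* (d ℤ.* f (α ⊖ u ⊖ v))))
    ≡⟨ ∑ℤ.fold-cong q (λ {(d , v)} _ → ∑ℤ.fold-cong p λ {(c , u)} _ →
         trans (lem c d _) (cong (λ β → d ℤ.* (c ℤ.* f β)) (⊖-swap u v))) ⟩
  sumℤ q (λ (d , v) → sumℤ p (λ (c , u) → d ℤ.* (c ℤ.* f (α ⊖ v ⊖ u))))
    ≡⟨ ∑ℤ.fold-cong q (λ {(d , v)} _ → sumℤ-* d p _) ⟩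
  sumℤ q (λ (d , v) → d ℤ.* sumℤ p (λ (c , u) → c ℤ.* f (α ⊖ v ⊖ u))) ∎
  where
  open ≡-Reasoning
  open ℤ-Solver using (solve; _:*_; _:=_)
  lem : ∀ a x y → a ℤ.* (x ℤ.* y) ≡ x ℤ.* (a ℤ.* y)
  lem = solve 3 (λ a x y → a :* (x :* y) := x :* (a :* y)) refl
  ⊖-swap : ∀ u v → α ⊖ u ⊖ v ≡ α ⊖ v ⊖ u
  ⊖-swap u v = trans (sym (⊖-⊞ α u v)) (trans (cong (α ⊖_) (⊞-comm u v)) (⊖-⊞ α v u))

coeff-δ₀ : (p : LaurentPolynomial n) → ∀ α → coeff p α ≡ (p • δ₀) α
coeff-δ₀ p α = ∑ℤ.fold-cong p λ {(c , u)} _ → lem c u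
  where
  lem : ∀ c u → (if does (u ≟ᵛ α) then c else 0ℤ) ≡ c ℤ.* δ₀ (α ⊖ u)
  lem c u rewrite does-⇔ (mk⇔ (sym ∘ ≡⇒⊖≡0⃗) (⊖≡0⃗⇒≡ ∘ sym)) (u ≟ᵛ α) (0⃗ ≟ᵛ (α ⊖ u))
    with does (0⃗ ≟ᵛ (α ⊖ u))
  ... | true  = sym (ℤ.*-identityʳ c)
  ... | false = sym (ℤ.*-zeroʳ c)

coeff-⊛ : (p q : LaurentPolynomial n) → ∀ α → coeff (p ⊛ q) α ≡ (p • coeff q) α
coeff-⊛ p q α = begin
  coeff (p ⊛ q) α     ≡⟨ coeff-δ₀ (p ⊛ q) α ⟩
  ((p ⊛ q) • δ₀) α    ≡⟨ ⊛-• p q δ₀ α ⟩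
  (p • (q • δ₀)) α    ≡⟨ •-cong p (λ β → coeff-δ₀ q β) α ⟨
  (p • coeff q) α     ∎
  where open ≡-Reasoning

⊛-comm : (p q : LaurentPolynomial n) → p ⊛ q ≋ q ⊛ p
⊛-comm p q α = begin
  coeff (p ⊛ q) α   ≡⟨ coeff-δ₀ (p ⊛ q) α ⟩
  ((p ⊛ q) • δ₀) α  ≡⟨ ⊛-• p q δ₀ α ⟩
  (p • (q • δ₀)) α  ≡⟨ •-comm p q δ₀ α ⟩
  (q • (p • δ₀)) α  ≡⟨ ⊛-• q p δ₀ α ⟨
  ((q ⊛ p) • δ₀) α  ≡⟨ coeff-δ₀ (q ⊛ p) α ⟨
  coeff (q ⊛ p) α   ∎
  where open ≡-Reasoning

monomial-• : ∀ c (f : Series n) α → (monomial c • f) α ≡ c ℤ.* f α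
monomial-• c f α = trans (ℤ.+-identityʳ _) (cong (λ β → c ℤ.* f β) (⊖-0⃗ α))

-- Non-zero-divisors

-- Only finitely supported series are tested: `1-y^ u` does annihilate non-zero infinite series,
-- namely those constant along `u`.
NonZeroDivisor : LaurentPolynomial n → Set
NonZeroDivisor p = ∀ r → (∀ α → (p • coeff r) α ≡ 0ℤ) → ∀ α → coeff r α ≡ 0ℤ

-- A zero `p` would annihilate the constant 1, whose coefficient at `0⃗` is not zero.
nzd⇒≉[] : (p : LaurentPolynomial n) → NonZeroDivisor p → ¬ p ≋ []
nzd⇒≉[] {n = n} p nzd p≋[] = 1≢0 (trans (sym 1-at-0⃗) (nzd (monomial 1ℤ) p•1≡0 0⃗))
  where
  1≢0 : ¬ 1ℤ ≡ 0ℤ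
  1≢0 ()
  1-at-0⃗ : coeff (monomial 1ℤ) (0⃗ {n}) ≡ 1ℤ
  1-at-0⃗ rewrite dec-true (0⃗ {n} ≟ᵛ 0⃗) refl = refl
  p•1≡0 : ∀ α → (p • coeff (monomial 1ℤ)) α ≡ 0ℤ
  p•1≡0 α = begin
    (p • coeff (monomial 1ℤ)) α  ≡⟨ coeff-⊛ p (monomial 1ℤ) α ⟨
    coeff (p ⊛ monomial 1ℤ) α    ≡⟨ ⊛-comm p (monomial 1ℤ) α ⟩
    coeff (monomial 1ℤ ⊛ p) α    ≡⟨ coeff-⊛ (monomial 1ℤ) p α ⟩
    (monomial 1ℤ • coeff p) α    ≡⟨ •-zero (monomial 1ℤ) p≋[] α ⟩
    0ℤ                           ∎
    where open ≡-Reasoning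

nzd-1 : NonZeroDivisor (monomial {n} 1ℤ)
nzd-1 r 1•r≡0 α =
  trans (sym (trans (monomial-• 1ℤ (coeff r) α) (ℤ.*-identityˡ _))) (1•r≡0 α)

-- The hypothesis on `p` applies because `q • coeff r` is again the coefficient function of a
-- Laurent polynomial, `q ⊛ r`.
nzd-⊛ : (p q : LaurentPolynomial n) → NonZeroDivisor p → NonZeroDivisor q → NonZeroDivisor (p ⊛ q)
nzd-⊛ p q nzd-p nzd-q r pq•r≡0 =
  nzd-q r λ α → trans (sym (coeff-⊛ q r α)) (nzd-p (q ⊛ r) (λ β → trans (p•qr β) (pq•r≡0 β)) α)
  where
  p•qr : ∀ β → (p • coeff (q ⊛ r)) β ≡ ((p ⊛ q) • coeff r) β
  p•qr β = trans (•-cong p (coeff-⊛ q r) β) (sym (⊛-• p q (coeff r) β))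

1-y^ : Vec ℤ n → LaurentPolynomial n
1-y^ u = (1ℤ , 0⃗) ∷ (-1ℤ , u) ∷ []

1-y^-• : (u : Vec ℤ n) (f : Series n) → ∀ α → (1-y^ u • f) α ≡ f α ℤ.- f (α ⊖ u)
1-y^-• u f α = trans (cong (λ β → 1ℤ ℤ.* f β ℤ.+ (-1ℤ ℤ.* f (α ⊖ u) ℤ.+ 0ℤ)) (⊖-0⃗ α)) (lem (f α) (f (α ⊖ u)))
  where
  open ℤ-Solver
  lem : ∀ x y → 1ℤ ℤ.* x ℤ.+ (-1ℤ ℤ.* y ℤ.+ 0ℤ) ≡ x ℤ.- y
  lem = solve 2 (λ x y → con 1ℤ :* x :+ (con -1ℤ :* y :+ con 0ℤ) := x :- y) refl

coeff-vanishes-below : (r : LaurentPolynomial n) (c : Fin n) →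
  ∃[ z ] ∀ α → Vec.lookup α c ℤ.< z → coeff r α ≡ 0ℤ
coeff-vanishes-below []            c = 0ℤ , λ _ _ → refl
coeff-vanishes-below ((d , u) ∷ r) c =
  let (z , h) = coeff-vanishes-below r c in
  z ℤ.⊓ Vec.lookup u c , λ α α<z → cong₂ ℤ._+_
    (cong (if_then d else 0ℤ) (dec-false (u ≟ᵛ α) λ { refl →
      ℤ.<-irrefl refl (ℤ.<-≤-trans α<z (ℤ.i⊓j≤j z (Vec.lookup u c))) }))
    (h α (ℤ.<-≤-trans α<z (ℤ.i⊓j≤i z (Vec.lookup u c))))

i≤∣i∣ : ∀ i → i ℤ.≤ + ℤ.∣ i ∣
i≤∣i∣ (+ n)      = ℤ.≤-refl
i≤∣i∣ (-[1+ n ]) = ℤ.-≤+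

-- A series fixed by translation by u and vanishing far below in a coordinate in
-- which u is positive is zero.
nzd-1-y^ : (u : Vec ℤ n) (c : Fin n) → 0ℤ ℤ.< Vec.lookup u c → NonZeroDivisor (1-y^ u)
nzd-1-y^ u c 0<uc r u•r≡0 α = vanish (ℕ.suc ℤ.∣ a ℤ.- z ∣) α a<z+
  where
  z = proj₁ (coeff-vanishes-below r c)
  a = Vec.lookup α c
  vanish : ∀ k β → Vec.lookup β c ℤ.< z ℤ.+ + k → coeff r β ≡ 0ℤ
  vanish ℕ.zero    β lt = proj₂ (coeff-vanishes-below r c) β (subst (Vec.lookup β c ℤ.<_) (ℤ.+-identityʳ z) lt)
  vanish (ℕ.suc k) β lt = trans
    (ℤ.i-j≡0⇒i≡j _ _ (trans (sym (1-y^-• u (coeff r) β)) (u•r≡0 β)))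
    (vanish k (β ⊖ u) (begin-strict
      Vec.lookup (β ⊖ u) c             ≡⟨ Vec.lookup-zipWith ℤ._-_ c β u ⟩
      b ℤ.- Vec.lookup u c             ≤⟨ ℤ.+-monoʳ-≤ b (ℤ.neg-mono-≤ (ℤ.i<j⇒suc[i]≤j 0<uc)) ⟩
      b ℤ.- 1ℤ                         <⟨ ℤ.+-monoˡ-< (ℤ.- 1ℤ) lt ⟩
      z ℤ.+ + ℕ.suc k ℤ.- 1ℤ           ≡⟨ ℤ.+-assoc z (+ ℕ.suc k) (ℤ.- 1ℤ) ⟩
      z ℤ.+ (+ ℕ.suc k ℤ.- 1ℤ)         ≡⟨⟩
      z ℤ.+ + k                        ∎))
    where
    open ℤ.≤-Reasoning
    b = Vec.lookup β c
  a<z+ : a ℤ.< z ℤ.+ + ℕ.suc ℤ.∣ a ℤ.- z ∣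
  a<z+ = begin-strict
    a                              ≡⟨ lem a z ⟩
    z ℤ.+ (a ℤ.- z)                ≤⟨ ℤ.+-monoʳ-≤ z (i≤∣i∣ _) ⟩
    z ℤ.+ + ℤ.∣ a ℤ.- z ∣          <⟨ ℤ.+-monoʳ-< z (ℤ.+<+ (ℕ.n<1+n _)) ⟩
    z ℤ.+ + ℕ.suc ℤ.∣ a ℤ.- z ∣    ∎
    where
    open ℤ.≤-Reasoning
    open ℤ-Solver using (solve; _:+_; _:-_; _:=_)
    lem : ∀ a z → a ≡ z ℤ.+ (a ℤ.- z)
    lem = solve 2 (λ a z → a := z :+ (a :- z)) refl

-- Fractions that represent formal series

module _ {n : ℕ} where

  -- The condition `den·σ≡num` freed from sets: signed sums and flipped series are not indicator
  -- functions. Non-vanishing of the denominator is treated separately.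
  _Represents_ : Fraction n → Series n → Set
  f Represents h = ∀ α → (den f • h) α ≡ coeff (num f) α

  represents-+ : ∀ f g h k → f Represents h → g Represents k → (f +ᶠ g) Represents (λ α → h α ℤ.+ k α)
  represents-+ f g h k fh gk α = begin
    ((den f ⊛ den g) • h+k) α
      ≡⟨ ⊛-• (den f) (den g) h+k α ⟩
    (den f • (den g • h+k)) α
      ≡⟨ •-cong (den f) (•-+ (den g) h k) α ⟩
    (den f • (λ β → (den g • h) β ℤ.+ (den g • k) β)) α
      ≡⟨ •-+ (den f) (den g • h) (den g • k) α ⟩
    (den f • (den g • h)) α ℤ.+ (den f • (den g • k)) α
      ≡⟨ cong₂ ℤ._+_ (trans (•-comm (den f) (den g) h α) (•-cong (den g) fh α)) (•-cong (den f) gk α) ⟩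
    (den g • coeff (num f)) α ℤ.+ (den f • coeff (num g)) α
      ≡⟨ cong₂ ℤ._+_ (comm (den g) (num f)) (comm (den f) (num g)) ⟩
    coeff (num f ⊛ den g) α ℤ.+ coeff (num g ⊛ den f) α
      ≡⟨ ∑ℤ.fold-++ (num f ⊛ den g) (num g ⊛ den f) _ ⟨
    coeff (num f ⊛ den g ++ num g ⊛ den f) α ∎
    where
    open ≡-Reasoning
    h+k = λ β → h β ℤ.+ k β
    comm : ∀ p q → (p • coeff q) α ≡ coeff (q ⊛ p) α
    comm p q = trans (sym (coeff-⊛ p q α)) (⊛-comm p q α)

  represents-*ᶠ : ∀ s f h → f Represents h → (s *ᶠ f) Represents (λ α → (s ℤ.◃ 1) ℤ.* h α)
  represents-*ᶠ s f h fh α = begin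
    (den f • (λ β → c ℤ.* h β)) α      ≡⟨ •-scale (den f) c h α ⟩
    c ℤ.* (den f • h) α                ≡⟨ cong (c ℤ.*_) (fh α) ⟩
    c ℤ.* coeff (num f) α              ≡⟨ monomial-• c (coeff (num f)) α ⟨
    (monomial c • coeff (num f)) α     ≡⟨ coeff-⊛ (monomial c) (num f) α ⟨
    coeff (monomial c ⊛ num f) α       ∎
    where
    open ≡-Reasoning
    c = s ℤ.◃ 1

  represents-∑ᶠ : ∀ {m} (f : Vector (Fraction n) m) (h : Vector (Series n) m) →
    (∀ i → f i Represents h i) → ∑ᶠ f Represents (λ α → Vector.foldr ℤ._+_ 0ℤ (λ i → h i α))
  represents-∑ᶠ {ℕ.zero}  f h fh α = •-zero (monomial 1ℤ) (λ _ → refl) α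
  represents-∑ᶠ {ℕ.suc m} f h fh =
    represents-+ (f zero) (∑ᶠ (f ∘ suc)) (h zero)
      (λ α → Vector.foldr ℤ._+_ 0ℤ (λ i → h (suc i) α)) (fh zero) (represents-∑ᶠ (f ∘ suc) (h ∘ suc) (fh ∘ suc))

  nzd-∑ᶠ : ∀ {m} (f : Vector (Fraction n) m) → (∀ i → NonZeroDivisor (den (f i))) → NonZeroDivisor (den (∑ᶠ f))
  nzd-∑ᶠ {ℕ.zero}  f nzd = nzd-1
  nzd-∑ᶠ {ℕ.suc m} f nzd = nzd-⊛ (den (f zero)) (den (∑ᶠ (f ∘ suc))) (nzd zero) (nzd-∑ᶠ (f ∘ suc) (nzd ∘ suc))

-- Lexicographic positivity

module _ {A : Set} where

  Pos : List A → (A → ℚ) → Set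
  Pos xs f = Small (map f xs)

  pos-cong : ∀ xs {f g : A → ℚ} → (∀ x → f x ≡ g x) → Pos xs f → Pos xs g
  pos-cong xs f≗g = subst Small (List.map-cong f≗g xs)

  pos-+ : ∀ xs {f g : A → ℚ} → Pos xs f → Pos xs g → Pos xs (λ x → f x ℚ.+ g x)
  pos-+ (x ∷ xs) (here 0<f)    (here 0<g)    = here (ℚ.+-mono-< 0<f 0<g)
  pos-+ (x ∷ xs) {f} (here 0<f) (there g≡0 _) =
    here (subst (0ℚ ℚ.<_) (sym (trans (cong (f x ℚ.+_) g≡0) (ℚ.+-identityʳ _))) 0<f)
  pos-+ (x ∷ xs) {g = g} (there f≡0 _) (here 0<g) =
    here (subst (0ℚ ℚ.<_) (sym (trans (cong (ℚ._+ g x) f≡0) (ℚ.+-identityˡ _))) 0<g)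
  pos-+ (x ∷ xs) (there f≡0 p) (there g≡0 q) = there (cong₂ ℚ._+_ f≡0 g≡0) (pos-+ xs p q)

  pos-* : ∀ xs {f : A → ℚ} c → 0ℚ ℚ.< c → Pos xs f → Pos xs (λ x → c ℚ.* f x)
  pos-* (x ∷ xs) {f} c 0<c (here 0<f)    =
    here (subst (ℚ._< c ℚ.* f x) (ℚ.*-zeroʳ c) (ℚ.*-monoʳ-<-pos c {{ℚ.positive 0<c}} 0<f))
  pos-* (x ∷ xs) c 0<c (there f≡0 p) =
    there (trans (cong (c ℚ.*_) f≡0) (ℚ.*-zeroʳ c)) (pos-* xs c 0<c p)

  ¬pos-0 : ∀ xs {f : A → ℚ} → (∀ x → f x ≡ 0ℚ) → ¬ Pos xs f
  ¬pos-0 (x ∷ xs) f≗0 (here 0<f)  = ℚ.<-irrefl (sym (f≗0 x)) 0<f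
  ¬pos-0 (x ∷ xs) f≗0 (there _ p) = ¬pos-0 xs f≗0 p

  pos-asym : ∀ xs {f : A → ℚ} → Pos xs f → ¬ Pos xs (ℚ.-_ ∘ f)
  pos-asym xs {f} p q = ¬pos-0 xs (λ x → ℚ.+-inverseʳ (f x)) (pos-+ xs p q)

  -- `Large` is the bare negation of `Small` and includes the zero column; one non-zero entry
  -- anywhere excludes that case.
  pos-total : ∀ xs {f : A → ℚ} {x} → x ∈ xs → f x ≢ 0ℚ → ¬ Pos xs f → Pos xs (ℚ.-_ ∘ f)
  pos-total (y ∷ xs) {f} x∈ fx≢0 ¬p with ℚ.<-cmp 0ℚ (f y)
  ... | tri< 0<f _ _ = ⊥-elim (¬p (here 0<f))
  ... | tri> _ _ f<0 = here (ℚ.neg-antimono-< f<0)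
  ... | tri≈ _ 0≡f _ with x∈
  ...   | here refl = ⊥-elim (fx≢0 (sym 0≡f))
  ...   | there x∈′ = there (cong ℚ.-_ (sym 0≡f)) (pos-total xs x∈′ fx≢0 (¬p ∘ there (sym 0≡f)))

  -- Zero entries do not affect the sign of the first non-zero one. This lets the ignored rows,
  -- which vanish on the columns in use, be kept in the order.
  pos-filter⁺ : ∀ {p} {P : Pred A p} (P? : Decidable P) xs {f} → (∀ x → ¬ P x → f x ≡ 0ℚ) →
    Pos xs f → Pos (filter P? xs) f
  pos-filter⁺ P? (x ∷ xs) f≡0 p with P? x | p
  ... | yes _  | here 0<f    = here 0<f
  ... | yes _  | there f≡ q  = there f≡ (pos-filter⁺ P? xs f≡0 q)
  ... | no ¬Px | here 0<f    = ⊥-elim (ℚ.<-irrefl (sym (f≡0 x ¬Px)) 0<f)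
  ... | no _   | there _ q   = pos-filter⁺ P? xs f≡0 q

  pos-filter⁻ : ∀ {p} {P : Pred A p} (P? : Decidable P) xs {f} → (∀ x → ¬ P x → f x ≡ 0ℚ) →
    Pos (filter P? xs) f → Pos xs f
  pos-filter⁻ P? (x ∷ xs) f≡0 p with P? x | p
  ... | yes _  | here 0<f    = here 0<f
  ... | yes _  | there f≡ q  = there f≡ (pos-filter⁻ P? xs f≡0 q)
  ... | no ¬Px | q           = there (f≡0 x ¬Px) (pos-filter⁻ P? xs f≡0 q)

  pos-++ : ∀ xs {ys zs} {f : A → ℚ} → (Pos ys f → Pos zs f) → Pos (xs ++ ys) f → Pos (xs ++ zs) f
  pos-++ []       h p           = h p
  pos-++ (x ∷ xs) h (here 0<f)  = here 0<f
  pos-++ (x ∷ xs) h (there e p) = there e (pos-++ xs h p)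

-- In a list sorted by gt, the product whose factors are H above a cut C and L
-- below it changes by (H j - L j) times the product of the other factors when
-- the cut moves past j. Induction over all cuts makes sorting unnecessary.
module Telescope {A : Set} (_≟_ : DecidableEquality A)
  (act : A → Bool) (gt : A → A → Bool) (H L : A → ℤ)
  (inactive  : ∀ a → act a ≡ false → H a ≡ L a)
  (gt-trans  : ∀ a b c → act a ≡ true → act b ≡ true → act c ≡ true →
               gt a b ≡ true → gt b c ≡ true → gt a c ≡ true)
  (connected : ∀ a b → act a ≡ true → act b ≡ true → a ≢ b → gt a b ≡ not (gt b a))
  where

  sel : Bool → A → ℤ
  sel h a = if h then H a else L a

  UpClosed : (A → Bool) → Set
  UpClosed C = ∀ a b → act a ≡ true → act b ≡ true → C a ≡ true → gt b a ≡ true → C b ≡ true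

  others : List A → A → ℤ
  others xs j = prodℤ xs (λ s → if does (s ≟ j) then 1ℤ else sel (gt s j) s)

  term-at : (A → Bool) → List A → A → ℤ
  term-at C xs j = if act j ∧ C j then (H j ℤ.- L j) ℤ.* others xs j else 0ℤ

  private
    factor : ∀ a j → ℤ
    factor a j = sel (gt a j) a

    head-others : ∀ {a} xs → a ∉ xs → others (a ∷ xs) a ≡ prodℤ xs (λ s → sel (gt s a) s)
    head-others {a} xs a∉ rewrite dec-true (a ≟ a) refl =
      trans (ℤ.*-identityˡ _) (∏ℤ.fold-remove-∉ _≟_ xs _ a∉)

    tail-others : ∀ {a j} xs → a ≢ j → others (a ∷ xs) j ≡ factor a j ℤ.* others xs j
    tail-others {a} {j} xs a≢j rewrite dec-false (a ≟ j) a≢j = refl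

    -- Serves a head that is inactive or outside the cut. In every selected summand its factor is
    -- `L a`: either `H a = L a`, or no active element outside an up-closed cut lies above an active
    -- one inside it.
    const-tail : ∀ {a} C xs → a ∉ xs →
      (∀ {j} → j ∈ xs → act j ≡ true → C j ≡ true → factor a j ≡ L a) →
      sumℤ xs (term-at C (a ∷ xs)) ≡ L a ℤ.* sumℤ xs (term-at C xs)
    const-tail {a} C xs a∉ fac = trans (∑ℤ.fold-cong xs λ {j} j∈ → lem j j∈) (sumℤ-* (L a) xs _)
      where
      lem : ∀ j → j ∈ xs → term-at C (a ∷ xs) j ≡ L a ℤ.* term-at C xs j
      lem j j∈ rewrite tail-others {a} {j} xs (λ { refl → a∉ j∈ }) with act j in aj | C j in Cj
      ... | false | _     = sym (ℤ.*-zeroʳ (L a))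
      ... | true  | false = sym (ℤ.*-zeroʳ (L a))
      ... | true  | true  rewrite fac j∈ aj Cj = solve 3 (λ d l o → d :* (l :* o) := l :* (d :* o))
          refl (H j ℤ.- L j) (L a) (others xs j)
        where open ℤ-Solver

    -- Serves a head inside the cut: the summands of `j` above `a` carry `L a`, the other selected
    -- ones `H a`. Starting from `H a` throughout, the correction `L a - H a` runs over the active
    -- elements above `a`, all of which lie in `C`.
    split-tail : ∀ {a} C xs → a ∉ xs → act a ≡ true → UpClosed C → C a ≡ true →
      sumℤ xs (term-at C (a ∷ xs)) ≡
      H a ℤ.* sumℤ xs (term-at C xs) ℤ.+ (L a ℤ.- H a) ℤ.* sumℤ xs (term-at (λ s → gt s a) xs)
    split-tail {a} C xs a∉ aa up Ca = begin
      sumℤ xs (term-at C (a ∷ xs))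
        ≡⟨ ∑ℤ.fold-cong xs (λ {j} → lem j) ⟩
      sumℤ xs (λ j → H a ℤ.* term-at C xs j ℤ.+ (L a ℤ.- H a) ℤ.* term-at (λ s → gt s a) xs j)
        ≡⟨ ∑ℤ.fold-∙ xs _ _ ⟩
      sumℤ xs (λ j → H a ℤ.* term-at C xs j) ℤ.+ sumℤ xs (λ j → (L a ℤ.- H a) ℤ.* term-at (λ s → gt s a) xs j)
        ≡⟨ cong₂ ℤ._+_ (sumℤ-* (H a) xs _) (sumℤ-* (L a ℤ.- H a) xs _) ⟩
      _ ∎
      where
      open ≡-Reasoning
      open ℤ-Solver using (solve; _:*_; _:+_; _:-_; _:=_; con)
      lem : ∀ j → j ∈ xs → term-at C (a ∷ xs) j ≡
            H a ℤ.* term-at C xs j ℤ.+ (L a ℤ.- H a) ℤ.* term-at (λ s → gt s a) xs j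
      lem j j∈ rewrite tail-others {a} {j} xs (λ { refl → a∉ j∈ })
        with act j in aj
      ... | false = solve 2 (λ h l → con 0ℤ := h :* con 0ℤ :+ (l :- h) :* con 0ℤ) refl (H a) (L a)
      ... | true rewrite connected a j aa aj (λ { refl → a∉ j∈ })
        with C j in Cj | gt j a in gja
      ...   | true  | true  = solve 4 (λ h l d o → d :* (l :* o) := h :* (d :* o) :+ (l :- h) :* (d :* o))
          refl (H a) (L a) (H j ℤ.- L j) (others xs j)
      ...   | true  | false = solve 4 (λ h l d o → d :* (h :* o) := h :* (d :* o) :+ (l :- h) :* con 0ℤ)
          refl (H a) (L a) (H j ℤ.- L j) (others xs j)
      ...   | false | true  = ⊥-elim (false≢true (trans (sym Cj) (up a j aa aj Ca gja)))
        where
        false≢true : false ≢ true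
        false≢true ()
      ...   | false | false = solve 2 (λ h l → con 0ℤ := h :* con 0ℤ :+ (l :- h) :* con 0ℤ) refl (H a) (L a)

  telescope : ∀ C → UpClosed C → ∀ {xs} → Unique xs →
    sumℤ xs (term-at C xs) ≡ prodℤ xs (λ s → sel (C s) s) ℤ.- prodℤ xs L
  telescope C up {[]}     _             = refl
  telescope C up {a ∷ xs} (a∉′ ∷ uniq) with act a in aa | C a in Ca
  ... | false | Ca′ = begin
    0ℤ ℤ.+ sumℤ xs (term-at C (a ∷ xs))     ≡⟨ ℤ.+-identityˡ _ ⟩
    sumℤ xs (term-at C (a ∷ xs))            ≡⟨ const-tail C xs a∉ (λ {j} _ _ _ → sel≡L (gt a j)) ⟩
    L a ℤ.* sumℤ xs (term-at C xs)          ≡⟨ cong (L a ℤ.*_) (telescope C up uniq) ⟩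
    L a ℤ.* (∏C ℤ.- ∏L)                     ≡⟨ solve 3 (λ l c d → l :* (c :- d) := l :* c :- l :* d)
        refl (L a) ∏C ∏L ⟩
    L a ℤ.* ∏C ℤ.- L a ℤ.* ∏L               ≡⟨ cong (λ z → z ℤ.* ∏C ℤ.- L a ℤ.* ∏L) (sel≡L Ca′) ⟨
    sel Ca′ a ℤ.* ∏C ℤ.- L a ℤ.* ∏L         ∎
    where
    open ≡-Reasoning
    open ℤ-Solver using (solve; _:*_; _:+_; _:-_; _:=_; con)
    a∉ : a ∉ xs
    a∉ a∈ = All.lookup a∉′ a∈ refl
    ∏C = prodℤ xs (λ s → sel (C s) s)
    ∏L = prodℤ xs L
    sel≡L : ∀ b → sel b a ≡ L a
    sel≡L true  = inactive a aa
    sel≡L false = refl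
  ... | true | false = begin
    0ℤ ℤ.+ sumℤ xs (term-at C (a ∷ xs))     ≡⟨ ℤ.+-identityˡ _ ⟩
    sumℤ xs (term-at C (a ∷ xs))            ≡⟨ const-tail C xs a∉ low ⟩
    L a ℤ.* sumℤ xs (term-at C xs)          ≡⟨ cong (L a ℤ.*_) (telescope C up uniq) ⟩
    L a ℤ.* (∏C ℤ.- ∏L)                     ≡⟨ solve 3 (λ l c d → l :* (c :- d) := l :* c :- l :* d)
        refl (L a) ∏C ∏L ⟩
    L a ℤ.* ∏C ℤ.- L a ℤ.* ∏L               ∎
    where
    open ≡-Reasoning
    open ℤ-Solver using (solve; _:*_; _:+_; _:-_; _:=_; con)
    a∉ : a ∉ xs
    a∉ a∈ = All.lookup a∉′ a∈ refl
    ∏C = prodℤ xs (λ s → sel (C s) s)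
    ∏L = prodℤ xs L
    low : ∀ {j} → j ∈ xs → act j ≡ true → C j ≡ true → sel (gt a j) a ≡ L a
    low {j} _ aj Cj with gt a j in gaj
    ... | false = refl
    ... | true with trans (sym Ca) (up j a aj aa Cj gaj)
    ...   | ()
  -- The induction hypothesis is used for `C` and for the cut of all elements above `a`, up-closed
  -- by transitivity. The product `∏a` of the second cut cancels against the summand of `a` itself.
  ... | true | true = begin
    (H a ℤ.- L a) ℤ.* others (a ∷ xs) a ℤ.+ sumℤ xs (term-at C (a ∷ xs))
      ≡⟨ cong₂ ℤ._+_ (cong ((H a ℤ.- L a) ℤ.*_) (head-others xs a∉)) (split-tail C xs a∉ aa up Ca) ⟩
    (H a ℤ.- L a) ℤ.* ∏a ℤ.+ (H a ℤ.* sumℤ xs (term-at C xs) ℤ.+ (L a ℤ.- H a) ℤ.* sumℤ xs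
        (term-at (λ s → gt s a) xs))
      ≡⟨ cong₂ (λ y z → (H a ℤ.- L a) ℤ.* ∏a ℤ.+ (H a ℤ.* y ℤ.+ (L a ℤ.- H a) ℤ.* z))
           (telescope C up uniq)
           (telescope (λ s → gt s a) (λ b c ab ac gba gcb → gt-trans c b a ac ab aa gcb gba) uniq) ⟩
    (H a ℤ.- L a) ℤ.* ∏a ℤ.+ (H a ℤ.* (∏C ℤ.- ∏L) ℤ.+ (L a ℤ.- H a) ℤ.* (∏a ℤ.- ∏L))
      ≡⟨ solve 5 (λ h l c d g → (h :- l) :* g :+ (h :* (c :- d) :+ (l :- h) :* (g :- d)) := h :* c :- l :* d)
           refl (H a) (L a) ∏C ∏L ∏a ⟩
    H a ℤ.* ∏C ℤ.- L a ℤ.* ∏L ∎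
    where
    open ≡-Reasoning
    open ℤ-Solver using (solve; _:*_; _:+_; _:-_; _:=_; con)
    a∉ : a ∉ xs
    a∉ a∈ = All.lookup a∉′ a∈ refl
    ∏C = prodℤ xs (λ s → sel (C s) s)
    ∏L = prodℤ xs L
    ∏a = prodℤ xs (λ s → sel (gt s a) s)

-- The columns that are not ignored

∈-remaining⁺ : ∀ {J : Subset n} {j} → j ∉ₛ J → j ∈ remaining J
∈-remaining⁺ {J = J} j∉J = ∈-filter⁺ (λ j → ¬? (j Subset.∈? J)) (∈-allFin _) j∉J

∈-remaining⁻ : ∀ {J : Subset n} {j} → j ∈ remaining J → j ∉ₛ J
∈-remaining⁻ {J = J} j∈ = proj₂ (∈-filter⁻ (λ j → ¬? (j Subset.∈? J)) {xs = allFin _} j∈)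

remaining-unique : (J : Subset n) → Unique (remaining J)
remaining-unique J = Unique.filter⁺ (λ j → ¬? (j Subset.∈? J)) (Unique.allFin⁺ _)

∉-∪⁻ : ∀ {J : Subset n} {j t} → t ∉ₛ J ∪ ⁅ j ⁆ → t ∉ₛ J × t ≢ j
∉-∪⁻ {J = J} {j} t∉ =
  (λ t∈J → t∉ (Subset.x∈p∪q⁺ (inj₁ t∈J))) ,
  (λ { refl → t∉ (Subset.x∈p∪q⁺ (inj₂ (Subset.x∈⁅x⁆ j))) })

∉-∪⁺ : ∀ {J : Subset n} {j t} → t ∉ₛ J → t ≢ j → t ∉ₛ J ∪ ⁅ j ⁆
∉-∪⁺ {J = J} {j} t∉J t≢j t∈ with Subset.x∈p∪q⁻ J ⁅ j ⁆ t∈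
... | inj₁ t∈J = t∉J t∈J
... | inj₂ t∈j = t≢j (Subset.x∈⁅y⁆⇒x≡y j t∈j)

module RemainingFold {C : Set} {_∙_ : C → C → C} {ε : C}
                     (isCM : IsCommutativeMonoid _≡_ _∙_ ε) where
  open BigOp isCM

  fold-remaining-⊥ : ∀ (f : Fin n → C) → fold (remaining Subset.⊥) f ≡ fold (allFin n) f
  fold-remaining-⊥ f = trans (fold-filter _ (allFin _) f) (fold-cong (allFin _) λ {j} _ →
    cong (if_then f j else ε) (dec-true (¬? (j Subset.∈? Subset.⊥)) Subset.∉⊥))

  fold-remaining-∪ : ∀ (J : Subset n) j (f : Fin n → C) →
    fold (remaining (J ∪ ⁅ j ⁆)) f ≡ fold (remaining J) (λ s → if does (s Fin.≟ j) then ε else f s)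
  fold-remaining-∪ J j f = trans (fold-filter _ (allFin _) f)
    (trans (fold-cong (allFin _) λ {s} _ → lem s)
        (sym (fold-filter _ (allFin _) (λ s → if does (s Fin.≟ j) then ε else f s))))
    where
    lem : ∀ s → (if does (¬? (s Subset.∈? (J ∪ ⁅ j ⁆))) then f s else ε) ≡
          (if does (¬? (s Subset.∈? J)) then (if does (s Fin.≟ j) then ε else f s) else ε)
    lem s with s Subset.∈? J | s Fin.≟ j
    ... | yes s∈J | _        = cong (if_then f s else ε)
      (dec-false (¬? (s Subset.∈? (J ∪ ⁅ j ⁆))) λ s∉ → proj₁ (∉-∪⁻ s∉) s∈J)
    ... | no _    | yes s≡j  = cong (if_then f s else ε)
      (dec-false (¬? (s Subset.∈? (J ∪ ⁅ j ⁆))) λ s∉ → proj₂ (∉-∪⁻ s∉) s≡j)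
    ... | no s∉J  | no s≢j   = cong (if_then f s else ε)
      (dec-true (¬? (s Subset.∈? (J ∪ ⁅ j ⁆))) (∉-∪⁺ s∉J s≢j))

  fold-remaining-split : ∀ {J : Subset n} {j} (f : Fin n → C) → j ∉ₛ J →
    fold (remaining J) f ≡ f j ∙ fold (remaining (J ∪ ⁅ j ⁆)) f
  fold-remaining-split {J = J} {j} f j∉J = trans
    (fold-remove Fin._≟_ f (remaining-unique J) (∈-remaining⁺ j∉J))
    (cong (f j ∙_) (sym (fold-remaining-∪ J j f)))

module ∑ℚᴿ = RemainingFold ℚ.+-0-isCommutativeMonoid
module ∏ℤᴿ = RemainingFold ℤ.*-1-isCommutativeMonoid

sumℚ-δ : ∀ {n} k (f : Fin n → ℚ) → sumℚ (allFin n) (λ s → (if does (k Fin.≟ s) then 1ℚ else 0ℚ) ℚ.* f s) ≡ f k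
sumℚ-δ {n} k f = begin
  sumℚ (allFin _) g
    ≡⟨ ∑ℚ.fold-remove Fin._≟_ g (Unique.allFin⁺ _) (∈-allFin k) ⟩
  g k ℚ.+ sumℚ (allFin _) (λ s → if does (s Fin.≟ k) then 0ℚ else g s)
    ≡⟨ cong₂ ℚ._+_ (trans (cong (λ d → (if d then 1ℚ else 0ℚ) ℚ.* f k) (dec-true (k Fin.≟ k) refl))
        (ℚ.*-identityˡ (f k)))
         (trans (∑ℚ.fold-cong (allFin _) λ {s} _ → lem s) (∑ℚ.fold-ε (allFin n))) ⟩
  f k ℚ.+ 0ℚ
    ≡⟨ ℚ.+-identityʳ (f k) ⟩
  f k ∎
  where
  open ≡-Reasoning
  g = λ s → (if does (k Fin.≟ s) then 1ℚ else 0ℚ) ℚ.* f s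
  lem : ∀ s → (if does (s Fin.≟ k) then 0ℚ else g s) ≡ 0ℚ
  lem s with s Fin.≟ k
  ... | yes _  = refl
  ... | no s≢k rewrite dec-false (k Fin.≟ s) (s≢k ∘ sym) = ℚ.*-zeroˡ (f s)

col≢lastCol : (j : Fin n) → n ↑ʳ zero {0} ≢ j ↑ˡ 1
col≢lastCol {n} j eq with trans (sym (Fin.splitAt-↑ʳ n 1 zero)) (trans (cong (splitAt n) eq) (Fin.splitAt-↑ˡ n j 1))
... | ()

-- The invariant of a term and its preservation by pivoting

module Invariant {n r : ℕ} (A : Vector (Vector ℤ n) r) (b : Vector ℤ r) where

  OnPlane : Vec ℤ n → Set
  OnPlane α = ∀ i → sumℤ (allFin n) (λ j → A i j ℤ.* Vec.lookup α j) ≡ b i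

  onPlane? : Decidable OnPlane
  onPlane? α = Fin.all? (λ i → _ ℤ.≟ b i)

  -- The column (α, Aα - b) for α on the plane.
  column : Vec ℤ n → Fin (n ℕ.+ r) → ℚ
  column α k = [ (λ t → fromℤ (Vec.lookup α t)) , (λ _ → 0ℚ) ] (splitAt n k)

  -- The part `(0, -b)` of the bottom rows that does not come from `A`. Column operations preserve
  -- `bottom = A·top + offset` because the column being added is never the last one, so its offset
  -- is 0.
  offset : Fin r → Fin (n ℕ.+ 1) → ℚ
  offset i l = [ (λ _ → 0ℚ) , (λ _ → ℚ.- fromℤ (b i)) ] (splitAt n l)

  -- `top-col` and `top-last` make the free coordinates of a point its coefficients in the cone.
  -- `affine` leads from a point of the plane to its expression by these coefficients; `image` leads
  -- back, putting vertex and generators on the plane once all bottom rows vanish.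
  record Inv (τ : Term n r) : Set where
    open Term τ
    field
      top-col     : ∀ {s t} → s ∉ₛ J → t ∉ₛ J → top s (col t) ≡ (if does (s Fin.≟ t) then 1ℚ else 0ℚ)
      top-last    : ∀ {s} → s ∉ₛ J → top s lastCol ≡ 0ℚ
      bottom-col  : ∀ {i t} → i ∈ₛ I → t ∉ₛ J → bottom i (col t) ≡ 0ℚ
      bottom-last : ∀ {i} → i ∈ₛ I → bottom i lastCol ≡ 0ℚ
      affine      : ∀ α → OnPlane α → ∀ k →
                    column α k ≡ O k lastCol ℚ.+ sumℚ (remaining J) (λ s → O k (col s) ℚ.* fromℤ (Vec.lookup α s))
      image       : ∀ i l → bottom i l ≡
                    sumℚ (allFin n) (λ j → fromℤ (A i j) ℚ.* top j l) ℚ.+ offset i l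

  root : Term n r
  root = term Sign.+ (M A b) Subset.⊥ Subset.⊥

  root-inv : Inv root
  root-inv = record
    { top-col     = λ {s} {t} _ _ → M-top-col s t
    ; top-last    = λ {s} _ → M-top-last s
    ; bottom-col  = λ i∈⊥ → ⊥-elim (Subset.∉⊥ i∈⊥)
    ; bottom-last = λ i∈⊥ → ⊥-elim (Subset.∉⊥ i∈⊥)
    ; affine      = root-affine
    ; image       = root-image
    }
    where
    open ≡-Reasoning
    open Term root using (top; bottom; col; lastCol; O)
    M-top-col : ∀ s t → top s (col t) ≡ (if does (s Fin.≟ t) then 1ℚ else 0ℚ)
    M-top-col s t rewrite Fin.splitAt-↑ˡ n s r | Fin.splitAt-↑ˡ n t 1 = refl
    M-top-last : ∀ s → top s lastCol ≡ 0ℚ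
    M-top-last s rewrite Fin.splitAt-↑ˡ n s r | Fin.splitAt-↑ʳ n 1 zero = refl
    M-bottom-col : ∀ i t → bottom i (col t) ≡ fromℤ (A i t)
    M-bottom-col i t rewrite Fin.splitAt-↑ʳ n r i | Fin.splitAt-↑ˡ n t 1 = refl
    M-bottom-last : ∀ i → bottom i lastCol ≡ ℚ.- fromℤ (b i)
    M-bottom-last i rewrite Fin.splitAt-↑ʳ n r i | Fin.splitAt-↑ʳ n 1 zero = refl
    root-affine : ∀ α → OnPlane α → ∀ k →
      column α k ≡ O k lastCol ℚ.+ sumℚ (remaining Subset.⊥) (λ s → O k (col s) ℚ.* fromℤ (Vec.lookup α s))
    root-affine α on k = trans (go (splitAt n k) refl)
      (cong (O k lastCol ℚ.+_) (sym (∑ℚᴿ.fold-remaining-⊥ (λ s → O k (col s) ℚ.* x s))))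
      where
      x = λ s → fromℤ (Vec.lookup α s)
      go : ∀ z → splitAt n k ≡ z → column α k ≡ O k lastCol ℚ.+ sumℚ (allFin n) (λ s → O k (col s) ℚ.* x s)
      go (inj₁ t) eq rewrite sym (Fin.splitAt⁻¹-↑ˡ eq) = begin
        column α (t ↑ˡ r)  ≡⟨ cong [ _ , _ ] (Fin.splitAt-↑ˡ n t r) ⟩
        x t                ≡⟨ sumℚ-δ t x ⟨
        sumℚ (allFin n) (λ s → (if does (t Fin.≟ s) then 1ℚ else 0ℚ) ℚ.* x s)
          ≡⟨ ∑ℚ.fold-cong (allFin n) (λ {s} _ → cong (ℚ._* x s) (M-top-col t s)) ⟨
        S                  ≡⟨ ℚ.+-identityˡ S ⟨
        0ℚ ℚ.+ S           ≡⟨ cong (ℚ._+ S) (M-top-last t) ⟨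
        top t lastCol ℚ.+ S ∎
        where S = sumℚ (allFin n) (λ s → top t (col s) ℚ.* x s)
      go (inj₂ i) eq rewrite sym (Fin.splitAt⁻¹-↑ʳ {m = n} eq) = begin
        column α (n ↑ʳ i)               ≡⟨ cong [ _ , _ ] (Fin.splitAt-↑ʳ n r i) ⟩
        0ℚ                              ≡⟨ ℚ.+-inverseˡ (fromℤ (b i)) ⟨
        ℚ.- fromℤ (b i) ℚ.+ fromℤ (b i) ≡⟨ cong (ℚ.- fromℤ (b i) ℚ.+_) (begin
          fromℤ (b i)                   ≡⟨ cong fromℤ (on i) ⟨
          fromℤ (sumℤ (allFin n) (λ s → A i s ℤ.* Vec.lookup α s))
            ≡⟨ fromℤ-sum (allFin n) (A i) (Vec.lookup α) ⟩
          sumℚ (allFin n) (λ s → fromℤ (A i s) ℚ.* x s)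
            ≡⟨ ∑ℚ.fold-cong (allFin n) (λ {s} _ → cong (ℚ._* x s) (M-bottom-col i s)) ⟨
          S                             ∎) ⟩
        ℚ.- fromℤ (b i) ℚ.+ S           ≡⟨ cong (ℚ._+ S) (M-bottom-last i) ⟨
        bottom i lastCol ℚ.+ S ∎
        where S = sumℚ (allFin n) (λ s → bottom i (col s) ℚ.* x s)
    root-image : ∀ i l → bottom i l ≡ sumℚ (allFin n) (λ j → fromℤ (A i j) ℚ.* top j l) ℚ.+ offset i l
    root-image i l = go (splitAt n l) refl
      where
      go : ∀ z → splitAt n l ≡ z → bottom i l ≡ sumℚ (allFin n) (λ j → fromℤ (A i j) ℚ.* top j l) ℚ.+ offset i l
      go (inj₁ t) eq rewrite sym (Fin.splitAt⁻¹-↑ˡ eq) = begin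
        bottom i (col t)     ≡⟨ M-bottom-col i t ⟩
        fromℤ (A i t)        ≡⟨ sumℚ-δ t (fromℤ ∘ A i) ⟨
        sumℚ (allFin n) (λ s → (if does (t Fin.≟ s) then 1ℚ else 0ℚ) ℚ.* fromℤ (A i s))
          ≡⟨ ∑ℚ.fold-cong (allFin n) (λ {s} _ → lem s) ⟩
        S                    ≡⟨ ℚ.+-identityʳ S ⟨
        S ℚ.+ 0ℚ             ≡⟨ cong (S ℚ.+_) (cong [ _ , _ ] (Fin.splitAt-↑ˡ n t 1)) ⟨
        S ℚ.+ offset i (col t) ∎
        where
        S = sumℚ (allFin n) (λ s → fromℤ (A i s) ℚ.* top s (col t))
        lem : ∀ s → (if does (t Fin.≟ s) then 1ℚ else 0ℚ) ℚ.* fromℤ (A i s) ≡ fromℤ (A i s) ℚ.* top s (col t)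
        lem s = trans (ℚ.*-comm (if does (t Fin.≟ s) then 1ℚ else 0ℚ) (fromℤ (A i s)))
          (cong (fromℤ (A i s) ℚ.*_) (trans
            (cong (if_then 1ℚ else 0ℚ) (does-⇔ (mk⇔ sym sym) (t Fin.≟ s) (s Fin.≟ t)))
            (sym (M-top-col s t))))
      go (inj₂ zero) eq rewrite sym (Fin.splitAt⁻¹-↑ʳ {m = n} eq) = begin
        bottom i lastCol               ≡⟨ M-bottom-last i ⟩
        ℚ.- fromℤ (b i)                ≡⟨ ℚ.+-identityˡ _ ⟨
        0ℚ ℚ.+ ℚ.- fromℤ (b i)         ≡⟨ cong₂ ℚ._+_ (∑ℚ.fold-ε (allFin n))
            (cong [ _ , _ ] (Fin.splitAt-↑ʳ n 1 zero)) ⟨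
        sumℚ (allFin n) (λ _ → 0ℚ) ℚ.+ offset i lastCol
          ≡⟨ cong (ℚ._+ offset i lastCol) (∑ℚ.fold-cong (allFin n) λ {s} _ →
               trans (cong (fromℤ (A i s) ℚ.*_) (M-top-last s)) (ℚ.*-zeroʳ (fromℤ (A i s)))) ⟨
        sumℚ (allFin n) (λ s → fromℤ (A i s) ℚ.* top s lastCol) ℚ.+ offset i lastCol ∎

  module Pivot (τ : Term n r) (i : Fin r) (j : Fin n) (p≢0 : Term.p τ i j ≢ 0ℚ) where
    open Term τ

    inv : ℚ
    inv = (ℚ.1/ p i j) {{ℚ.≢-nonZero p≢0}}

    p*inv : p i j ℚ.* inv ≡ 1ℚ
    p*inv = ℚ.*-inverseʳ (p i j) {{ℚ.≢-nonZero p≢0}}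

    factor : Fin (n ℕ.+ 1) → ℚ
    factor l = ℚ.- (bottom i l ℚ.* inv)

    O′ : Matrix (n ℕ.+ r) (n ℕ.+ 1)
    O′ = pivot i j {{ℚ.≢-nonZero p≢0}}

    pivot-other : ∀ k {l} → l ≢ col j → O′ k l ≡ O k l ℚ.+ factor l ℚ.* O k (col j)
    pivot-other k {l} l≢ rewrite dec-false (l Fin.≟ col j) l≢ = refl

    pivot-col : ∀ k {t} → t ≢ j → O′ k (col t) ≡ O k (col t) ℚ.+ factor (col t) ℚ.* O k (col j)
    pivot-col k t≢j = pivot-other k (t≢j ∘ Fin.↑ˡ-injective 1 _ _)

    pivot-last : ∀ k → O′ k lastCol ≡ O k lastCol ℚ.+ factor lastCol ℚ.* O k (col j)
    pivot-last k = pivot-other k (col≢lastCol j)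

    add-zero : ∀ x f {y} → y ≡ 0ℚ → x ℚ.+ f ℚ.* y ≡ x
    add-zero x f refl = trans (cong (x ℚ.+_) (ℚ.*-zeroʳ f)) (ℚ.+-identityʳ x)

    pivot-row-zero : ∀ x → x ℚ.+ ℚ.- (x ℚ.* inv) ℚ.* p i j ≡ 0ℚ
    pivot-row-zero x = begin
      x ℚ.+ ℚ.- (x ℚ.* inv) ℚ.* p i j    ≡⟨ solve 3
          (λ x v q → x :+ :- (x :* v) :* q := x :- x :* (q :* v)) refl x inv (p i j) ⟩
      x ℚ.- x ℚ.* (p i j ℚ.* inv)        ≡⟨ cong (λ z → x ℚ.- x ℚ.* z) p*inv ⟩
      x ℚ.- x ℚ.* 1ℚ                     ≡⟨ cong (λ z → x ℚ.- z) (ℚ.*-identityʳ x) ⟩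
      x ℚ.- x                            ≡⟨ ℚ.+-inverseʳ x ⟩
      0ℚ                                 ∎
      where
      open ≡-Reasoning
      open ℚ-Solver

    module _ (inv-τ : Inv τ) (j∉J : j ∉ₛ J) (s′ : Sign) where
      open Inv inv-τ

      -- Column `j` is zero in the top rows that stay free, so adding multiples of it leaves their
      -- identity block intact. It is also zero in the rows of `I`, which therefore stay cleared,
      -- while row `i` is cleared by the choice of the factor.
      child-inv : Inv (child τ s′ i j p≢0)
      child-inv = record
        { top-col     = λ {s} {t} s∉ t∉ →
            let (s∉J , s≢j) = ∉-∪⁻ s∉
                (t∉J , t≢j) = ∉-∪⁻ t∉
            in trans (pivot-col (s ↑ˡ r) t≢j)
                 (trans (add-zero (top s (col t)) (factor (col t)) (off-diag s∉J s≢j)) (top-col s∉J t∉J))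
        ; top-last    = λ {s} s∉ →
            let (s∉J , s≢j) = ∉-∪⁻ s∉
            in trans (pivot-last (s ↑ˡ r))
                 (trans (add-zero (top s lastCol) (factor lastCol) (off-diag s∉J s≢j)) (top-last s∉J))
        ; bottom-col  = λ {i′} {t} i∈ t∉ →
            let (t∉J , t≢j) = ∉-∪⁻ t∉
            in trans (pivot-col (n ↑ʳ i′) t≢j) (row (col t) (Subset.x∈p∪q⁻ I ⁅ i ⁆ i∈) λ i∈I → bottom-col i∈I t∉J)
        ; bottom-last = λ {i′} i∈ →
            trans (pivot-last (n ↑ʳ i′)) (row lastCol (Subset.x∈p∪q⁻ I ⁅ i ⁆ i∈) bottom-last)
        ; affine      = child-affine
        ; image       = child-image
        }
        where
        open ≡-Reasoning
        off-diag : ∀ {s} → s ∉ₛ J → s ≢ j → top s (col j) ≡ 0ℚ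
        off-diag {s} s∉J s≢j = trans (top-col s∉J j∉J) (cong (if_then 1ℚ else 0ℚ) (dec-false (s Fin.≟ j) s≢j))
        row : ∀ {i′} l → i′ ∈ₛ I ⊎ i′ ∈ₛ ⁅ i ⁆ → (i′ ∈ₛ I → bottom i′ l ≡ 0ℚ) →
              bottom i′ l ℚ.+ factor l ℚ.* bottom i′ (col j) ≡ 0ℚ
        row {i′} l (inj₁ i∈I) h = trans (add-zero (bottom i′ l) (factor l) (bottom-col i∈I j∉J)) (h i∈I)
        row {i′} l (inj₂ i∈i) h with Subset.x∈⁅y⁆⇒x≡y i i∈i
        ... | refl = pivot-row-zero (bottom i l)

        -- Row `i` of `affine` reads 0 on the plane and has a non-zero coefficient at `αⱼ`. Solving
        -- it for `αⱼ` and substituting into the other rows is exactly the column operation.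
        child-affine : ∀ α → OnPlane α → ∀ k → column α k ≡
          O′ k lastCol ℚ.+ sumℚ (remaining (J ∪ ⁅ j ⁆)) (λ s → O′ k (col s) ℚ.* fromℤ (Vec.lookup α s))
        child-affine α on k = begin
          column α k
            ≡⟨ affine α on k ⟩
          O k lastCol ℚ.+ sumℚ (remaining J) (λ s → O k (col s) ℚ.* x s)
            ≡⟨ cong (O k lastCol ℚ.+_) (∑ℚᴿ.fold-remaining-split (λ s → O k (col s) ℚ.* x s) j∉J) ⟩
          O k lastCol ℚ.+ (c ℚ.* x j ℚ.+ S)
            ≡⟨ cong (λ z → O k lastCol ℚ.+ (c ℚ.* z ℚ.+ S)) xj ⟩
          O k lastCol ℚ.+ (c ℚ.* (factor lastCol ℚ.+ T) ℚ.+ S)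
            ≡⟨ solve 5 (λ o c f t s → o :+ (c :* (f :+ t) :+ s) := (o :+ f :* c) :+ (s :+ c :* t)) refl
                 (O k lastCol) c (factor lastCol) T S ⟩
          (O k lastCol ℚ.+ factor lastCol ℚ.* c) ℚ.+ (S ℚ.+ c ℚ.* T)
            ≡⟨ cong₂ ℚ._+_ (sym (pivot-last k)) sums ⟩
          O′ k lastCol ℚ.+ sumℚ J′ (λ s → O′ k (col s) ℚ.* x s) ∎
          where
          open ℚ-Solver using (solve; _:+_; _:*_; _:-_; :-_; _:=_; con)
          J′ = remaining (J ∪ ⁅ j ⁆)
          x : Fin n → ℚ
          x s = fromℤ (Vec.lookup α s)
          c = O k (col j)
          S = sumℚ J′ (λ s → O k (col s) ℚ.* x s)
          T = sumℚ J′ (λ s → factor (col s) ℚ.* x s)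
          Q = sumℚ J′ (λ s → bottom i (col s) ℚ.* x s)
          T≡ : T ≡ ℚ.- inv ℚ.* Q
          T≡ = trans
            (∑ℚ.fold-cong J′ λ {s} _ → solve 3 (λ q v y → :- (q :* v) :* y := :- v :* (q :* y))
                refl (bottom i (col s)) inv (x s))
            (sumℚ-* (ℚ.- inv) J′ _)
          row-i : 0ℚ ≡ bottom i lastCol ℚ.+ (p i j ℚ.* x j ℚ.+ Q)
          row-i = trans (sym (cong [ _ , _ ] (Fin.splitAt-↑ʳ n r i))) (trans (affine α on (n ↑ʳ i))
            (cong (bottom i lastCol ℚ.+_) (∑ℚᴿ.fold-remaining-split (λ s → bottom i (col s) ℚ.* x s) j∉J)))
          xj : x j ≡ factor lastCol ℚ.+ T
          xj = begin
            x j
              ≡⟨ solve 2 (λ y v → y := y :- v :* con 0ℚ) refl (x j) inv ⟩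
            x j ℚ.- inv ℚ.* 0ℚ
              ≡⟨ cong (λ z → x j ℚ.- inv ℚ.* z) row-i ⟩
            x j ℚ.- inv ℚ.* (bottom i lastCol ℚ.+ (p i j ℚ.* x j ℚ.+ Q))
              ≡⟨ solve 5 (λ y v o q s → y :- v :* (o :+ (q :* y :+ s)) := (y :- (q :* v) :* y) :+
                  (:- (o :* v) :+ :- v :* s)) refl
                   (x j) inv (bottom i lastCol) (p i j) Q ⟩
            (x j ℚ.- (p i j ℚ.* inv) ℚ.* x j) ℚ.+ (factor lastCol ℚ.+ ℚ.- inv ℚ.* Q)
              ≡⟨ cong₂ ℚ._+_ (trans (cong (λ z → x j ℚ.- z ℚ.* x j) p*inv)
                   (solve 1 (λ y → y :- con 1ℚ :* y := con 0ℚ) refl (x j)))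
                   (cong (factor lastCol ℚ.+_) (sym T≡)) ⟩
            0ℚ ℚ.+ (factor lastCol ℚ.+ T)
              ≡⟨ ℚ.+-identityˡ _ ⟩
            factor lastCol ℚ.+ T ∎
          sums : S ℚ.+ c ℚ.* T ≡ sumℚ J′ (λ s → O′ k (col s) ℚ.* x s)
          sums = begin
            S ℚ.+ c ℚ.* T
              ≡⟨ cong (S ℚ.+_) (sym (sumℚ-* c J′ _)) ⟩
            S ℚ.+ sumℚ J′ (λ s → c ℚ.* (factor (col s) ℚ.* x s))
              ≡⟨ sym (∑ℚ.fold-∙ J′ _ _) ⟩
            sumℚ J′ (λ s → O k (col s) ℚ.* x s ℚ.+ c ℚ.* (factor (col s) ℚ.* x s))
              ≡⟨ ∑ℚ.fold-cong J′ (λ {s} s∈ → trans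
                   (solve 4 (λ o y c f → o :* y :+ c :* (f :* y) := (o :+ f :* c) :* y)
                       refl (O k (col s)) (x s) c (factor (col s)))
                   (cong (ℚ._* x s) (sym (pivot-col k (proj₂ (∉-∪⁻ (∈-remaining⁻ s∈))))))) ⟩
            sumℚ J′ (λ s → O′ k (col s) ℚ.* x s) ∎

        child-image : ∀ i′ l → O′ (n ↑ʳ i′) l ≡
          sumℚ (allFin n) (λ t → fromℤ (A i′ t) ℚ.* O′ (t ↑ˡ r) l) ℚ.+ offset i′ l
        child-image i′ l = go (l Fin.≟ col j)
          where
          open ℚ-Solver using (solve; _:+_; _:*_; _:-_; :-_; _:=_; con)
          a : Fin n → ℚ
          a t = fromℤ (A i′ t)
          S : Fin (n ℕ.+ 1) → ℚ
          S l = sumℚ (allFin n) (λ t → a t ℚ.* top t l)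
          offset-j : offset i′ (col j) ≡ 0ℚ
          offset-j = cong [ _ , _ ] (Fin.splitAt-↑ˡ n j 1)
          go : Dec (l ≡ col j) → O′ (n ↑ʳ i′) l ≡ sumℚ (allFin n) (λ t → a t ℚ.* O′ (t ↑ˡ r) l) ℚ.+ offset i′ l
          go (yes refl) rewrite dec-true (col j Fin.≟ col j) refl = image i′ l
          go (no l≢) = begin
            O′ (n ↑ʳ i′) l
              ≡⟨ pivot-other (n ↑ʳ i′) l≢ ⟩
            bottom i′ l ℚ.+ factor l ℚ.* bottom i′ (col j)
              ≡⟨ cong₂ (λ y z → y ℚ.+ factor l ℚ.* z) (image i′ l)
                   (trans (image i′ (col j)) (trans (cong (S (col j) ℚ.+_) offset-j) (ℚ.+-identityʳ _))) ⟩
            (S l ℚ.+ offset i′ l) ℚ.+ factor l ℚ.* S (col j)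
              ≡⟨ solve 4 (λ s o f c → (s :+ o) :+ f :* c := (s :+ f :* c) :+ o)
                  refl (S l) (offset i′ l) (factor l) (S (col j)) ⟩
            (S l ℚ.+ factor l ℚ.* S (col j)) ℚ.+ offset i′ l
              ≡⟨ cong (λ z → S l ℚ.+ z ℚ.+ offset i′ l) (sym (sumℚ-* (factor l) (allFin n) _)) ⟩
            (S l ℚ.+ sumℚ (allFin n) (λ t → factor l ℚ.* (a t ℚ.* top t (col j)))) ℚ.+ offset i′ l
              ≡⟨ cong (ℚ._+ offset i′ l) (sym (∑ℚ.fold-∙ (allFin n) _ _)) ⟩
            sumℚ (allFin n) (λ t → a t ℚ.* top t l ℚ.+ factor l ℚ.* (a t ℚ.* top t (col j))) ℚ.+ offset i′ l
              ≡⟨ cong (ℚ._+ offset i′ l) (∑ℚ.fold-cong (allFin n) λ {t} _ → trans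
                   (solve 4 (λ a o f c → a :* o :+ f :* (a :* c) := a :* (o :+ f :* c))
                       refl (a t) (top t l) (factor l) (top t (col j)))
                   (cong (a t ℚ.*_) (sym (pivot-other (t ↑ˡ r) l≢)))) ⟩
            sumℚ (allFin n) (λ t → a t ℚ.* O′ (t ↑ˡ r) l) ℚ.+ offset i′ l ∎

-- Signs, half-line factors and smallness under scaling

does-true⁻ : ∀ {X : Set} (X? : Dec X) → does X? ≡ true → X
does-true⁻ (yes x) _ = x

does-false⁻ : ∀ {X : Set} (X? : Dec X) → does X? ≡ false → ¬ X
does-false⁻ (no ¬x) _ = ¬x

sgn : ℚ → ℤ
sgn q = ℤ.sign (ℚ.numerator q) ℤ.◃ 1

sgn-pos : ∀ {q} → 0ℚ ℚ.< q → sgn q ≡ 1ℤ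
sgn-pos {q} 0<q with q | ℚ.positive 0<q
... | ℚ.mkℚ (+ ℕ.suc _) _ _ | _ = refl

sgn-neg : ∀ {q} → q ℚ.< 0ℚ → sgn q ≡ -1ℤ
sgn-neg {q} q<0 with q | ℚ.negative q<0
... | ℚ.mkℚ -[1+ _ ] _ _ | _ = refl

◃-* : ∀ s t → (s Sign.* t) ℤ.◃ 1 ≡ (s ℤ.◃ 1) ℤ.* (t ℤ.◃ 1)
◃-* Sign.+ Sign.+ = refl
◃-* Sign.+ Sign.- = refl
◃-* Sign.- Sign.+ = refl
◃-* Sign.- Sign.- = refl

opposite-◃ : ∀ s → Sign.opposite s ℤ.◃ 1 ≡ ℤ.- (s ℤ.◃ 1)
opposite-◃ Sign.+ = refl
opposite-◃ Sign.- = refl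

[0≤_] : ℤ → ℤ
[0≤ k ] = if does (0ℤ ℤ.≤? k) then 1ℤ else 0ℤ

-- χ false k = - [k < 0]: the expansion of 1/(1-x) in powers of 1/x.
χ : Bool → ℤ → ℤ
χ true  k = [0≤ k ]
χ false k = [0≤ k ] ℤ.- 1ℤ

[0≤]≢0 : ∀ k → [0≤ k ] ≢ 0ℤ → 0ℤ ℤ.≤ k
[0≤]≢0 k h with 0ℤ ℤ.≤? k
... | yes 0≤k = 0≤k
... | no _    = ⊥-elim (h refl)

-- Integrality gives `k ≤ -1` instead of `k < 0`. This unit gap is the source of the sums of `pⱼ`
-- inside `deg` and `ord`.
[0≤]-1≢0 : ∀ k → [0≤ k ] ℤ.- 1ℤ ≢ 0ℤ → k ℤ.≤ -1ℤ
[0≤]-1≢0 k h with 0ℤ ℤ.≤? k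
... | yes _  = ⊥-elim (h refl)
... | no 0≰k = neg k 0≰k
  where
  neg : ∀ k → ¬ 0ℤ ℤ.≤ k → k ℤ.≤ -1ℤ
  neg (+ _)    0≰k = ⊥-elim (0≰k (ℤ.+≤+ ℕ.z≤n))
  neg -[1+ _ ] _   = ℤ.-≤- ℕ.z≤n

pos-scale : ∀ {X : Set} (xs : List X) {f g : X → ℚ} c → 0ℚ ℚ.< c → (∀ x → f x ≡ c ℚ.* g x) →
  does (small? (map f xs)) ≡ does (small? (map g xs))
pos-scale xs {f} {g} c 0<c f≡cg = does-⇔ (mk⇔
  (λ f>0 → pos-cong xs unscale (pos-* xs c⁻¹ 0<c⁻¹ f>0))
  (λ g>0 → pos-cong xs (λ x → sym (f≡cg x)) (pos-* xs c 0<c g>0)))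
  (small? _) (small? _)
  where
  instance
    c+ : ℚ.Positive c
    c+ = ℚ.positive 0<c
    c≢0 : ℚ.NonZero c
    c≢0 = ℚ.pos⇒nonZero c
  c⁻¹ = ℚ.1/ c
  0<c⁻¹ : 0ℚ ℚ.< c⁻¹
  0<c⁻¹ = ℚ.positive⁻¹ c⁻¹ {{ℚ.1/pos⇒pos c}}
  unscale : ∀ x → c⁻¹ ℚ.* f x ≡ g x
  unscale x = trans (cong (c⁻¹ ℚ.*_) (f≡cg x)) (trans (sym (ℚ.*-assoc c⁻¹ c (g x)))
    (trans (cong (ℚ._* g x) (ℚ.*-inverseˡ c)) (ℚ.*-identityˡ (g x))))

pos-neg : ∀ {X : Set} (xs : List X) {f : X → ℚ} {x} → x ∈ xs → f x ≢ 0ℚ →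
  does (small? (map (ℚ.-_ ∘ f) xs)) ≡ not (does (small? (map f xs)))
pos-neg xs {f} x∈ fx≢0 = does-⇔ (mk⇔
  (λ -f>0 f>0 → pos-asym xs f>0 -f>0) (pos-total xs x∈ fx≢0))
  (small? _) (¬? (small? (map f xs)))

pos-scale-neg : ∀ {X : Set} (xs : List X) {f g : X → ℚ} c {x} → c ℚ.< 0ℚ → x ∈ xs → g x ≢ 0ℚ →
  (∀ x → f x ≡ c ℚ.* g x) → does (small? (map f xs)) ≡ not (does (small? (map g xs)))
pos-scale-neg xs {f} {g} c c<0 x∈ gx≢0 f≡cg = trans
  (pos-scale xs (ℚ.- c) (ℚ.neg-antimono-< c<0) (λ x → trans (f≡cg x) (lem c (g x))))
  (pos-neg xs x∈ gx≢0)
  where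
  open ℚ-Solver
  lem : ∀ c y → c ℚ.* y ≡ ℚ.- c ℚ.* ℚ.- y
  lem = solve 2 (λ c y → c :* y := :- c :* :- y) refl

sumℤ-mapMaybe : ∀ {X Y : Set} (g : X → Maybe Y) (v : Y → ℤ) xs →
  sumℤ (mapMaybe g xs) v ≡ sumℤ xs (λ x → maybe v 0ℤ (g x))
sumℤ-mapMaybe g v []       = refl
sumℤ-mapMaybe g v (x ∷ xs) with g x
... | just y  = cong (λ z → v y ℤ.+ z) (sumℤ-mapMaybe g v xs)
... | nothing = trans (sumℤ-mapMaybe g v xs) (sym (ℤ.+-identityˡ _))

∑ℚ-filter : ∀ {X : Set} {p} {P : Pred ℚ p} (P? : Decidable P) (f : X → ℚ) xs →
  ∑ℚ (filter P? (map f xs)) ≡ sumℚ xs (λ x → if does (P? (f x)) then f x else 0ℚ)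
∑ℚ-filter P? f xs = begin
  ∑ℚ (filter P? (map f xs))          ≡⟨ cong ∑ℚ (List.map-id (filter P? (map f xs))) ⟨
  sumℚ (filter P? (map f xs)) id     ≡⟨ ∑ℚ.fold-filter P? (map f xs) id ⟩
  sumℚ (map f xs) (λ q → if does (P? q) then q else 0ℚ) ≡⟨ ∑ℚ.fold-∘ xs f _ ⟩
  sumℚ xs (λ x → if does (P? (f x)) then f x else 0ℚ)   ∎
  where open ≡-Reasoning

rows : List (Fin r) → List (Fin (n ℕ.+ r))
rows {r} {n} ys = map (_↑ˡ r) (allFin n) ++ map (n ↑ʳ_) ys

top∈rows : ∀ (s : Fin n) (ys : List (Fin r)) → (s ↑ˡ r) ∈ rows ys
top∈rows s ys = ∈-++⁺ˡ (∈-map⁺ _ (∈-allFin s))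

-- Expanding a term conserves its series

module Step {n r : ℕ} (A : Vector (Vector ℤ n) r) (b : Vector ℤ r) where
  open Invariant A b

  -- The ignored rows are included: they vanish on the columns in use and do not change smallness,
  -- and one list for all terms makes the columns of parent and child comparable.
  allRows : List (Fin (n ℕ.+ r))
  allRows = rows (allFin r)

  flag : Term n r → Fin n → Bool
  flag τ t = does (small? (map (λ k → Term.O τ k (Term.col τ t)) allRows))

  indicator : Vec ℤ n → ℤ
  indicator α = if does (onPlane? α) then 1ℤ else 0ℤ

  -- The coefficients of the full constant term of the Laurent expansion that
  -- the order small/large prescribes for the term τ.
  val : Term n r → Series n
  val τ α = (Term.s τ ℤ.◃ 1) ℤ.*
    (indicator α ℤ.* prodℤ (remaining (Term.J τ)) (λ t → χ (flag τ t) (Vec.lookup α t)))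

  val-off : ∀ τ α → ¬ OnPlane α → val τ α ≡ 0ℤ
  val-off τ α off rewrite dec-false (onPlane? α) off = ℤ.*-zeroʳ (Term.s τ ℤ.◃ 1)

  module _ (τ : Term n r) (inv-τ : Inv τ) (i : Fin r) where
    open Term τ
    open Inv inv-τ

    private
      module _ (c : ℚ) (j : Fin n) (j∉J : j ∉ₛ J) where
        f : Fin (n ℕ.+ r) → ℚ
        f k = c ℚ.* O k (col j)

        γ-rows : map (c ℚ.*_) (γ j) ≡ map f (rows (remaining I))
        γ-rows = begin
          map (c ℚ.*_) (tabulate (λ k → top k (col j)) ++ map (λ i → bottom i (col j)) (remaining I))
            ≡⟨ List.map-++ (c ℚ.*_) (tabulate (λ k → top k (col j))) _ ⟩
          map (c ℚ.*_) (tabulate (λ k → top k (col j))) ++ map (c ℚ.*_) (map (λ i → bottom i (col j)) (remaining I))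
            ≡⟨ cong₂ _++_ (trans (List.map-tabulate _ _)
                (sym (trans (sym (List.map-∘ (allFin n))) (List.map-tabulate id _))))
                 (trans (sym (List.map-∘ (remaining I))) (List.map-∘ (remaining I))) ⟩
          map f (map (_↑ˡ r) (allFin n)) ++ map f (map (n ↑ʳ_) (remaining I))
            ≡⟨ List.map-++ f (map (_↑ˡ r) (allFin n)) _ ⟨
          map f (rows (remaining I)) ∎
          where open ≡-Reasoning

        zero-on-I : ∀ i → ¬ i ∉ₛ I → f (n ↑ʳ i) ≡ 0ℚ
        zero-on-I i ¬i∉I = trans (cong (c ℚ.*_) (bottom-col (decidable-stable (i Subset.∈? I) ¬i∉I) j∉J))
            (ℚ.*-zeroʳ c)

        γ-small : does (small? (map (c ℚ.*_) (γ j))) ≡ does (small? (map f allRows))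
        γ-small = does-⇔ (mk⇔ to from) (small? _) (small? _)
          where
          ¬∈I? : Decidable (_∉ₛ I)
          ¬∈I? i = ¬? (i Subset.∈? I)
          to : Small (map (c ℚ.*_) (γ j)) → Pos allRows f
          to p = pos-++ (map (_↑ˡ r) (allFin n)) {f = f}
            (λ q → subst Small (List.map-∘ (allFin r))
              (pos-filter⁻ ¬∈I? (allFin r) zero-on-I (subst Small (sym (List.map-∘ (remaining I))) q)))
            (subst Small γ-rows p)
          from : Pos allRows f → Small (map (c ℚ.*_) (γ j))
          from p = subst Small (sym γ-rows) (pos-++ (map (_↑ˡ r) (allFin n)) {f = f}
            (λ q → subst Small (List.map-∘ (remaining I))
              (pos-filter⁺ ¬∈I? (allFin r) zero-on-I (subst Small (sym (List.map-∘ (allFin r))) q)))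
            p)

    act? : ∀ s → Dec (p i s ≢ 0ℚ × s ∉ₛ J)
    act? s = ¬? (p i s ℚ.≟ 0ℚ) ×-dec ¬? (s Subset.∈? J)

    act : Fin n → Bool
    act s = does (act? s)

    act⇒ : ∀ {s} → act s ≡ true → p i s ≢ 0ℚ × s ∉ₛ J
    act⇒ {s} = does-true⁻ (act? s)

    -- A total reciprocal, so that `key`, `gt` and `C` carry no proof of non-vanishing. The default
    -- 0 is harmless because `H` and `L` agree on inactive columns.
    inverse : ∀ q → Dec (q ≡ 0ℚ) → ℚ
    inverse q (yes _)  = 0ℚ
    inverse q (no q≢0) = (ℚ.1/ q) {{ℚ.≢-nonZero q≢0}}

    inv : Fin n → ℚ
    inv s = inverse (p i s) (p i s ℚ.≟ 0ℚ)

    p*inv : ∀ {s} → p i s ≢ 0ℚ → p i s ℚ.* inv s ≡ 1ℚ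
    p*inv {s} p≢0 with p i s ℚ.≟ 0ℚ
    ... | yes p≡0 = ⊥-elim (p≢0 p≡0)
    ... | no p≢0′ = ℚ.*-inverseʳ (p i s) {{ℚ.≢-nonZero p≢0′}}

    inv≢0 : ∀ {s} → p i s ≢ 0ℚ → inv s ≢ 0ℚ
    inv≢0 {s} p≢0 inv≡0 with trans (sym (p*inv p≢0)) (trans (cong (p i s ℚ.*_) inv≡0) (ℚ.*-zeroʳ (p i s)))
    ... | ()

    -- The column scaled to have entry 1 in row `i`. Pivoting on `j` turns the column `p·key s` into
    -- `p·(key s - key j)`, so smallness after the pivot is the comparison of `key s` with `key j`,
    -- reversed when `p < 0`.
    key : Fin n → Fin (n ℕ.+ r) → ℚ
    key s k = inv s ℚ.* O k (col s)

    gt : Fin n → Fin n → Bool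
    gt s j = does (small? (map (λ k → key s k ℚ.- key j k) allRows))

    C : Fin n → Bool
    C s = does (small? (map (key s) allRows))

    key-own : ∀ {s} → s ∉ₛ J → key s (s ↑ˡ r) ≡ inv s
    key-own {s} s∉J = trans (cong (inv s ℚ.*_)
        (trans (top-col s∉J s∉J) (cong (if_then 1ℚ else 0ℚ) (dec-true (s Fin.≟ s) refl))))
      (ℚ.*-identityʳ (inv s))

    key-other : ∀ {s j} → s ∉ₛ J → j ∉ₛ J → s ≢ j → key j (s ↑ˡ r) ≡ 0ℚ
    key-other {s} {j} s∉J j∉J s≢j = trans (cong (inv j ℚ.*_) (trans (top-col s∉J j∉J)
      (cong (if_then 1ℚ else 0ℚ) (dec-false (s Fin.≟ j) s≢j)))) (ℚ.*-zeroʳ (inv j))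

    -- The identity block of the top rows separates columns: row `s` is zero in column `j` but not
    -- in column `s`. Hence no two active columns tie.
    key-diff≢0 : ∀ {s j} → p i s ≢ 0ℚ → s ∉ₛ J → j ∉ₛ J → s ≢ j → key s (s ↑ˡ r) ℚ.- key j (s ↑ˡ r) ≢ 0ℚ
    key-diff≢0 {s} {j} p≢0 s∉J j∉J s≢j eq = inv≢0 p≢0 (begin
      inv s                                  ≡⟨ ℚ.+-identityʳ (inv s) ⟨
      inv s ℚ.- 0ℚ                           ≡⟨ cong₂ ℚ._-_ (key-own s∉J) (key-other s∉J j∉J s≢j) ⟨
      key s (s ↑ˡ r) ℚ.- key j (s ↑ˡ r)      ≡⟨ eq ⟩
      0ℚ                                     ∎)
      where open ≡-Reasoning

    O≡p*key : ∀ {s} → p i s ≢ 0ℚ → ∀ k → O k (col s) ≡ p i s ℚ.* key s k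
    O≡p*key {s} p≢0 k = begin
      O k (col s)                         ≡⟨ ℚ.*-identityˡ _ ⟨
      1ℚ ℚ.* O k (col s)                  ≡⟨ cong (ℚ._* O k (col s)) (p*inv p≢0) ⟨
      p i s ℚ.* inv s ℚ.* O k (col s)     ≡⟨ ℚ.*-assoc (p i s) (inv s) _ ⟩
      p i s ℚ.* key s k                   ∎
      where open ≡-Reasoning

    -- The vector tested is `p·γ = p²·key`, and `p²` is positive whatever the sign of `p`.
    contributing-C : ∀ {j} → p i j ≢ 0ℚ → j ∉ₛ J → does (small? (map (p i j ℚ.*_) (γ j))) ≡ C j
    contributing-C {j} p≢0 j∉J = trans (γ-small (p i j) j j∉J)
      (pos-scale allRows (p i j ℚ.* p i j) 0<p²
          (λ k → trans (cong (p i j ℚ.*_) (O≡p*key p≢0 k)) (sym (ℚ.*-assoc (p i j) (p i j) _))))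
      where
      0<p² : 0ℚ ℚ.< p i j ℚ.* p i j
      0<p² with ℚ.<-cmp (p i j) 0ℚ
      ... | tri< p<0 _ _ = subst (ℚ._< p i j ℚ.* p i j) (ℚ.*-zeroʳ (p i j))
          (ℚ.*-monoʳ-<-neg (p i j) {{ℚ.negative p<0}} p<0)
      ... | tri≈ _ p≡0 _ = ⊥-elim (p≢0 p≡0)
      ... | tri> _ _ 0<p = subst (ℚ._< p i j ℚ.* p i j) (ℚ.*-zeroʳ (p i j))
          (ℚ.*-monoʳ-<-pos (p i j) {{ℚ.positive 0<p}} 0<p)

    connected : ∀ s t → act s ≡ true → act t ≡ true → s ≢ t → gt s t ≡ not (gt t s)
    connected s t as at s≢t = pos-scale-neg allRows -1ℚ (ℚ.negative⁻¹ -1ℚ) (top∈rows t (allFin r))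
      (let (p≢0 , t∉J) = act⇒ at ; (_ , s∉J) = act⇒ as in key-diff≢0 p≢0 t∉J s∉J (s≢t ∘ sym))
      (λ k → lem (key s k) (key t k))
      where
      open ℚ-Solver
      -1ℚ = ℚ.- 1ℚ
      lem : ∀ x y → x ℚ.- y ≡ -1ℚ ℚ.* (y ℚ.- x)
      lem = solve 2 (λ x y → x :- y := con -1ℚ :* (y :- x)) refl

    private
      small⁻ : ∀ {xs} → does (small? xs) ≡ true → Small xs
      small⁻ {xs} = does-true⁻ (small? xs)

      small⁺ : ∀ {xs} → Small xs → does (small? xs) ≡ true
      small⁺ {xs} s = dec-true (small? xs) s

    gt-trans : ∀ x y z → act x ≡ true → act y ≡ true → act z ≡ true →
               gt x y ≡ true → gt y z ≡ true → gt x z ≡ true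
    gt-trans x y z _ _ _ xy yz =
      small⁺ (pos-cong allRows (λ k → lem (key x k) (key y k) (key z k)) (pos-+ allRows (small⁻ xy) (small⁻ yz)))
      where
      open ℚ-Solver
      lem : ∀ x y z → (x ℚ.- y) ℚ.+ (y ℚ.- z) ≡ x ℚ.- z
      lem = solve 3 (λ x y z → (x :- y) :+ (y :- z) := x :- z) refl

    C-upClosed : ∀ x y → act x ≡ true → act y ≡ true → C x ≡ true → gt y x ≡ true → C y ≡ true
    C-upClosed x y _ _ Cx yx =
      small⁺ (pos-cong allRows (λ k → lem (key x k) (key y k)) (pos-+ allRows (small⁻ Cx) (small⁻ yx)))
      where
      open ℚ-Solver
      lem : ∀ x y → x ℚ.+ (y ℚ.- x) ≡ y
      lem = solve 2 (λ x y → x :+ (y :- x) := y) refl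

    module _ (α : Vec ℤ n) where

      k : Fin n → ℤ
      k = Vec.lookup α

      -- The half-line factor of a column whose key lies above, respectively below, the cut. The
      -- column itself is `p` times its key, so `p < 0` exchanges small and large. A column with
      -- `p = 0` is untouched by the pivot and keeps its factor.
      high low : ∀ s → Tri (p i s ℚ.< 0ℚ) (p i s ≡ 0ℚ) (0ℚ ℚ.< p i s) → Dec (p i s ≢ 0ℚ × s ∉ₛ J) → ℤ
      high s _            (no _)  = χ (flag τ s) (k s)
      high s (tri< _ _ _) (yes _) = χ false (k s)
      high s (tri≈ _ _ _) (yes _) = χ (flag τ s) (k s)
      high s (tri> _ _ _) (yes _) = χ true (k s)
      low s _            (no _)  = χ (flag τ s) (k s)
      low s (tri< _ _ _) (yes _) = χ true (k s)
      low s (tri≈ _ _ _) (yes _) = χ (flag τ s) (k s)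
      low s (tri> _ _ _) (yes _) = χ false (k s)

      H L : Fin n → ℤ
      H s = high s (ℚ.<-cmp (p i s) 0ℚ) (act? s)
      L s = low  s (ℚ.<-cmp (p i s) 0ℚ) (act? s)

      inactive : ∀ s → act s ≡ false → H s ≡ L s
      inactive s as = high≡low (ℚ.<-cmp (p i s) 0ℚ) (act? s) (does-false⁻ (act? s) as)
        where
        high≡low : ∀ t d → ¬ (p i s ≢ 0ℚ × s ∉ₛ J) → high s t d ≡ low s t d
        high≡low t (no _)  _    = refl
        high≡low t (yes a) ¬act = ⊥-elim (¬act a)

      open Telescope Fin._≟_ act gt H L inactive gt-trans connected

      -- One case analysis for two cuts. Here `φ` is the smallness of a column and `β` that of the
      -- column divided by `p`: `key s` for the parent, `key s - key j` for the child.
      select : ∀ s t d β φ →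
        (¬ (p i s ≢ 0ℚ × s ∉ₛ J) → φ ≡ flag τ s) →
        (0ℚ ℚ.< p i s → p i s ≢ 0ℚ → φ ≡ β) →
        (p i s ℚ.< 0ℚ → p i s ≢ 0ℚ → φ ≡ not β) →
        (if β then high s t d else low s t d) ≡ χ φ (k s)
      select s t              (no ¬act)      true  _ z _ _ = cong (λ b → χ b (k s)) (sym (z ¬act))
      select s t              (no ¬act)      false _ z _ _ = cong (λ b → χ b (k s)) (sym (z ¬act))
      select s (tri≈ _ p≡0 _) (yes (p≢0 , _)) _    _ _ _ _ = ⊥-elim (p≢0 p≡0)
      select s (tri< p<0 _ _) (yes (p≢0 , _)) true  _ _ _ n = cong (λ b → χ b (k s)) (sym (n p<0 p≢0))
      select s (tri< p<0 _ _) (yes (p≢0 , _)) false _ _ _ n = cong (λ b → χ b (k s)) (sym (n p<0 p≢0))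
      select s (tri> _ _ 0<p) (yes (p≢0 , _)) true  _ _ q _ = cong (λ b → χ b (k s)) (sym (q 0<p p≢0))
      select s (tri> _ _ 0<p) (yes (p≢0 , _)) false _ _ q _ = cong (λ b → χ b (k s)) (sym (q 0<p p≢0))

      sel-C : ∀ {s} → s ∉ₛ J → sel (C s) s ≡ χ (flag τ s) (k s)
      sel-C {s} s∉J = select s (ℚ.<-cmp (p i s) 0ℚ) (act? s) (C s) (flag τ s)
        (λ _ → refl)
        (λ 0<p p≢0 → pos-scale allRows (p i s) 0<p (O≡p*key p≢0))
        (λ p<0 p≢0 → pos-scale-neg allRows (p i s) p<0 (top∈rows s (allFin r))
          (inv≢0 p≢0 ∘ trans (sym (key-own s∉J))) (O≡p*key p≢0))

      module _ {j} (p≢0 : p i j ≢ 0ℚ) (j∉J : j ∉ₛ J) (s′ : Sign) where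
        open Pivot τ i j p≢0 using (pivot-col)
        τ′ = child τ s′ i j p≢0

        inv-j : (ℚ.1/ p i j) {{ℚ.≢-nonZero p≢0}} ≡ inv j
        inv-j with p i j ℚ.≟ 0ℚ
        ... | yes p≡0 = ⊥-elim (p≢0 p≡0)
        ... | no _    = refl

        new-col : ∀ {s} → s ≢ j → ∀ k → Term.O τ′ k (col s) ≡ O k (col s) ℚ.- p i s ℚ.* key j k
        new-col {s} s≢j k = trans (pivot-col k s≢j) (trans
          (cong (λ v → O k (col s) ℚ.+ ℚ.- (p i s ℚ.* v) ℚ.* O k (col j)) inv-j)
          (solve 4 (λ o q v c → o :+ :- (q :* v) :* c := o :- q :* (v :* c))
              refl (O k (col s)) (p i s) (inv j) (O k (col j))))
          where open ℚ-Solver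

        new-col′ : ∀ {s} → p i s ≢ 0ℚ → s ≢ j → ∀ k → Term.O τ′ k (col s) ≡ p i s ℚ.* (key s k ℚ.- key j k)
        new-col′ {s} ps≢0 s≢j k = trans (new-col s≢j k) (trans (cong (ℚ._- p i s ℚ.* key j k) (O≡p*key ps≢0 k))
          (solve 3 (λ q x y → q :* x :- q :* y := q :* (x :- y)) refl (p i s) (key s k) (key j k)))
          where open ℚ-Solver

        sel-gt : ∀ {s} → s ∉ₛ J → s ≢ j → sel (gt s j) s ≡ χ (flag τ′ s) (k s)
        sel-gt {s} s∉J s≢j = select s (ℚ.<-cmp (p i s) 0ℚ) (act? s) (gt s j) (flag τ′ s)
          (λ ¬act → cong (does ∘ small?) (List.map-cong (unchanged ¬act) allRows))
          (λ 0<p ps≢0 → pos-scale allRows (p i s) 0<p (new-col′ ps≢0 s≢j))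
          (λ p<0 ps≢0 → pos-scale-neg allRows (p i s) p<0 (top∈rows s (allFin r))
            (key-diff≢0 ps≢0 s∉J j∉J s≢j) (new-col′ ps≢0 s≢j))
          where
          unchanged : ¬ (p i s ≢ 0ℚ × s ∉ₛ J) → ∀ k → Term.O τ′ k (col s) ≡ O k (col s)
          unchanged ¬act k = trans (new-col s≢j k) (trans
            (cong (λ z → O k (col s) ℚ.- z ℚ.* key j k)
              (decidable-stable (p i s ℚ.≟ 0ℚ) λ ps≢0 → ¬act (ps≢0 , s∉J)))
            (solve 2 (λ o y → o :- con 0ℚ :* y := o) refl (O k (col s)) (key j k)))
            where open ℚ-Solver

      -- `[k ≥ 0] + [k < 0] = 1`: the two expansions of the pivot column differ by no condition at
      -- all on `αⱼ`, which is why the child drops this factor and keeps only a sign.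
      high-low : ∀ j t d → p i j ≢ 0ℚ × j ∉ₛ J → high j t d ℤ.- low j t d ≡ sgn (p i j)
      high-low j t              (no ¬act) act       = ⊥-elim (¬act act)
      high-low j (tri≈ _ p≡0 _) (yes _)   (p≢0 , _) = ⊥-elim (p≢0 p≡0)
      high-low j (tri< p<0 _ _) (yes _)   _         = trans (lem [0≤ k j ]) (sym (sgn-neg p<0))
        where
        open ℤ-Solver
        lem : ∀ e → e ℤ.- 1ℤ ℤ.- e ≡ -1ℤ
        lem = solve 1 (λ e → e :- con 1ℤ :- e := con -1ℤ) refl
      high-low j (tri> _ _ 0<p) (yes _)   _         = trans (lem [0≤ k j ]) (sym (sgn-pos 0<p))
        where
        open ℤ-Solver
        lem : ∀ e → e ℤ.- (e ℤ.- 1ℤ) ≡ 1ℤ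
        lem = solve 1 (λ e → e :- (e :- con 1ℤ) := con 1ℤ) refl

      pk : Fin n → ℚ
      pk s = p i s ℚ.* fromℤ (k s)

      positivePart negativePart : Fin n → ℚ
      positivePart s = if does (0ℚ ℚ.<? p i s) then p i s else 0ℚ
      negativePart s = if does (p i s ℚ.<? 0ℚ) then p i s else 0ℚ

      private
        pk≡0 : ∀ {s} → s ∉ₛ J → ¬ (p i s ≢ 0ℚ × s ∉ₛ J) → p i s ≡ 0ℚ × pk s ≡ 0ℚ
        pk≡0 {s} s∉J ¬act =
          let p≡0 = decidable-stable (p i s ℚ.≟ 0ℚ) λ p≢0 → ¬act (p≢0 , s∉J)
          in p≡0 , trans (cong (ℚ._* fromℤ (k s)) p≡0) (ℚ.*-zeroˡ (fromℤ (k s)))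

        positivePart≡0 : ∀ {s} → ¬ 0ℚ ℚ.< p i s → ℚ.- positivePart s ≡ 0ℚ
        positivePart≡0 {s} p≯0 = cong (λ d → ℚ.- (if d then p i s else 0ℚ)) (dec-false (0ℚ ℚ.<? p i s) p≯0)

        negativePart≡0 : ∀ {s} → ¬ p i s ℚ.< 0ℚ → ℚ.- negativePart s ≡ 0ℚ
        negativePart≡0 {s} p≮0 = cong (λ d → ℚ.- (if d then p i s else 0ℚ)) (dec-false (p i s ℚ.<? 0ℚ) p≮0)

        p*-1 : ∀ q → q ℚ.* ℚ.- 1ℚ ≡ ℚ.- q
        p*-1 = solve 1 (λ q → q :* con (ℚ.- 1ℚ) := :- q) refl
          where open ℚ-Solver

      -- Non-vanishing forces `k ≤ -1` when `p > 0` and `k ≥ 0` when `p < 0`, so both kinds of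
      -- summand of row `i` are bounded above, by `-p` and by 0. `high-bound` is the mirror image.
      low-bound : ∀ s t d → s ∉ₛ J → low s t d ≢ 0ℤ → pk s ℚ.≤ ℚ.- positivePart s
      low-bound s t (no ¬act) s∉J _ = let (p≡0 , pk≡0′) = pk≡0 s∉J ¬act in
        ℚ.≤-reflexive (trans pk≡0′ (sym (positivePart≡0 (ℚ.<-irrefl (sym p≡0)))))
      low-bound s (tri≈ _ p≡0 _) (yes (p≢0 , _)) _ _ = ⊥-elim (p≢0 p≡0)
      low-bound s (tri< p<0 _ p≯0) (yes _) _ L≢0 = subst₂ ℚ._≤_
          refl (trans (ℚ.*-zeroʳ (p i s)) (sym (positivePart≡0 p≯0)))
        (ℚ.*-monoˡ-≤-nonPos (p i s) {{ℚ.nonPositive (ℚ.<⇒≤ p<0)}} (fromℤ-mono ([0≤]≢0 (k s) L≢0)))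
      low-bound s (tri> _ _ 0<p) (yes _) _ L≢0 = subst₂ ℚ._≤_ refl
        (trans (p*-1 (p i s)) (cong (λ d → ℚ.- (if d then p i s else 0ℚ)) (sym (dec-true (0ℚ ℚ.<? p i s) 0<p))))
        (ℚ.*-monoˡ-≤-nonNeg (p i s) {{ℚ.nonNegative (ℚ.<⇒≤ 0<p)}} (fromℤ-mono ([0≤]-1≢0 (k s) L≢0)))

      high-bound : ∀ s t d → s ∉ₛ J → high s t d ≢ 0ℤ → ℚ.- negativePart s ℚ.≤ pk s
      high-bound s t (no ¬act) s∉J _ = let (p≡0 , pk≡0′) = pk≡0 s∉J ¬act in
        ℚ.≤-reflexive (trans (negativePart≡0 (ℚ.<-irrefl p≡0)) (sym pk≡0′))
      high-bound s (tri≈ _ p≡0 _) (yes (p≢0 , _)) _ _ = ⊥-elim (p≢0 p≡0)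
      high-bound s (tri> p≮0 _ 0<p) (yes _) _ H≢0 = subst₂ ℚ._≤_
          (trans (ℚ.*-zeroʳ (p i s)) (sym (negativePart≡0 p≮0))) refl
        (ℚ.*-monoˡ-≤-nonNeg (p i s) {{ℚ.nonNegative (ℚ.<⇒≤ 0<p)}} (fromℤ-mono ([0≤]≢0 (k s) H≢0)))
      high-bound s (tri< p<0 _ _) (yes _) _ H≢0 = subst₂ ℚ._≤_
        (trans (p*-1 (p i s)) (cong (λ d → ℚ.- (if d then p i s else 0ℚ)) (sym (dec-true (p i s ℚ.<? 0ℚ) p<0)))) refl
        (ℚ.*-monoˡ-≤-nonPos (p i s) {{ℚ.nonPositive (ℚ.<⇒≤ p<0)}} (fromℤ-mono ([0≤]-1≢0 (k s) H≢0)))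

      module _ (on : OnPlane α) where

        row-zero : b₀ i ℚ.+ sumℚ (remaining J) pk ≡ 0ℚ
        row-zero = trans (sym (affine α on (n ↑ʳ i))) (cong [ _ , _ ] (Fin.splitAt-↑ʳ n r i))

        private
          sumℚ-neg : ∀ (xs : List (Fin n)) f → sumℚ xs (λ x → ℚ.- f x) ≡ ℚ.- sumℚ xs f
          sumℚ-neg []       f = refl
          sumℚ-neg (x ∷ xs) f = trans (cong (ℚ.- f x ℚ.+_) (sumℚ-neg xs f)) (sym (ℚ.neg-distrib-+ (f x) _))

          nonzero-factors : ∀ f → prodℤ (remaining J) f ≢ 0ℤ → ∀ {s} → s ∈ remaining J → f s ≢ 0ℤ
          nonzero-factors f ∏≢0 s∈ fs≡0 = ∏≢0 (prodℤ-zero (remaining J) f s∈ fs≡0)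

        -- Applicability of a formula says that a half-open orthant has no lattice
        -- point on the hyperplane of row i.
        prod-L≡0 : deg i ℚ.< 0ℚ → prodℤ (remaining J) L ≡ 0ℤ
        prod-L≡0 deg<0 = decidable-stable (_ ℤ.≟ 0ℤ) λ ∏≢0 →
          ℚ.<-irrefl refl (begin-strict
            0ℚ                                                   ≡⟨ row-zero ⟨
            b₀ i ℚ.+ sumℚ (remaining J) pk                       ≤⟨ ℚ.+-monoʳ-≤ (b₀ i)
                (sumℚ-mono (remaining J) λ s s∈ →
                                                                      low-bound s (ℚ.<-cmp (p i s) 0ℚ) (act? s)
                                                                          (∈-remaining⁻ s∈) (nonzero-factors L ∏≢0 s∈)) ⟩
            b₀ i ℚ.+ sumℚ (remaining J) (λ s → ℚ.- positivePart s) ≡⟨ cong (b₀ i ℚ.+_)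
                (sumℚ-neg (remaining J) positivePart) ⟩
            b₀ i ℚ.- sumℚ (remaining J) positivePart             ≡⟨ cong (λ z → b₀ i ℚ.- z)
                (∑ℚ-filter (0ℚ ℚ.<?_) (p i) (remaining J)) ⟨
            deg i                                                <⟨ deg<0 ⟩
            0ℚ                                                   ∎)
          where open ℚ.≤-Reasoning

        prod-H≡0 : ord i ℚ.< 0ℚ → prodℤ (remaining J) H ≡ 0ℤ
        prod-H≡0 ord<0 = decidable-stable (_ ℤ.≟ 0ℤ) λ ∏≢0 →
          ℚ.<-irrefl refl (begin-strict
            0ℚ                                                   <⟨ ℚ.neg-antimono-< ord<0 ⟩
            ℚ.- ord i                                            ≡⟨ cong (λ z → ℚ.- (ℚ.- b₀ i ℚ.+ z))
                (∑ℚ-filter (ℚ._<? 0ℚ) (p i) (remaining J)) ⟩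
            ℚ.- (ℚ.- b₀ i ℚ.+ sumℚ (remaining J) negativePart)   ≡⟨ lem (b₀ i) (sumℚ (remaining J) negativePart) ⟩
            b₀ i ℚ.- sumℚ (remaining J) negativePart             ≡⟨ cong (b₀ i ℚ.+_)
                (sumℚ-neg (remaining J) negativePart) ⟨
            b₀ i ℚ.+ sumℚ (remaining J) (λ s → ℚ.- negativePart s) ≤⟨ ℚ.+-monoʳ-≤ (b₀ i)
                (sumℚ-mono (remaining J) λ s s∈ →
                                                                      high-bound s (ℚ.<-cmp (p i s) 0ℚ) (act? s)
                                                                          (∈-remaining⁻ s∈) (nonzero-factors H ∏≢0 s∈)) ⟩
            b₀ i ℚ.+ sumℚ (remaining J) pk                       ≡⟨ row-zero ⟩
            0ℚ                                                   ∎)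
          where
          open ℚ.≤-Reasoning
          lem : ∀ x y → ℚ.- (ℚ.- x ℚ.+ y) ≡ x ℚ.- y
          lem = solve 2 (λ x y → :- (:- x :+ y) := x :- y) refl
            where open ℚ-Solver

        xs : List (Fin n)
        xs = remaining J

        s± : ℤ
        s± = s ℤ.◃ 1

        prod-others : ∀ {j} (p≢0 : p i j ≢ 0ℚ) → j ∉ₛ J → ∀ s′ →
          prodℤ (remaining (J ∪ ⁅ j ⁆)) (λ t → χ (flag (child τ s′ i j p≢0) t) (k t)) ≡ others xs j
        prod-others {j} p≢0 j∉J s′ = trans (∏ℤᴿ.fold-remaining-∪ J j _)
          (∏ℤ.fold-cong xs λ {t} t∈ → lem t (∈-remaining⁻ t∈) (t Fin.≟ j))
          where
          lem : ∀ t → t ∉ₛ J → (d : Dec (t ≡ j)) →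
            (if does d then 1ℤ else χ (flag (child τ s′ i j p≢0) t) (k t)) ≡ (if does d then 1ℤ else sel (gt t j) t)
          lem t t∉J (yes _)  = refl
          lem t t∉J (no t≢j) = sym (sel-gt p≢0 j∉J s′ t∉J t≢j)

        child-val : ∀ {j} (p≢0 : p i j ≢ 0ℚ) → j ∉ₛ J → ∀ s′ →
          val (child τ s′ i j p≢0) α ≡ (s′ ℤ.◃ 1) ℤ.* (indicator α ℤ.* ((H j ℤ.- L j) ℤ.* others xs j))
        child-val {j} p≢0 j∉J s′ = begin
          ((s′ Sign.* ℤ.sign (ℚ.numerator (p i j))) ℤ.◃ 1) ℤ.* (indicator α ℤ.* ∏′)
            ≡⟨ cong₂ (λ y z → y ℤ.* (indicator α ℤ.* z)) (◃-* s′ _) (prod-others p≢0 j∉J s′) ⟩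
          ((s′ ℤ.◃ 1) ℤ.* sgn (p i j)) ℤ.* (indicator α ℤ.* others xs j)
            ≡⟨ solve 4 (λ s q i o → (s :* q) :* (i :* o) := s :* (i :* (q :* o)))
                refl (s′ ℤ.◃ 1) (sgn (p i j)) (indicator α) (others xs j) ⟩
          (s′ ℤ.◃ 1) ℤ.* (indicator α ℤ.* (sgn (p i j) ℤ.* others xs j))
            ≡⟨ cong (λ z → (s′ ℤ.◃ 1) ℤ.* (indicator α ℤ.* (z ℤ.* others xs j)))
                 (high-low j (ℚ.<-cmp (p i j) 0ℚ) (act? j) (p≢0 , j∉J)) ⟨
          (s′ ℤ.◃ 1) ℤ.* (indicator α ℤ.* ((H j ℤ.- L j) ℤ.* others xs j)) ∎
          where
          open ≡-Reasoning
          open ℤ-Solver using (solve; _:*_; _:=_)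
          ∏′ = prodℤ (remaining (J ∪ ⁅ j ⁆)) (λ t → χ (flag (child τ s′ i j p≢0) t) (k t))

        act-p : ∀ {j} → j ∉ₛ J → act j ≡ not (does (p i j ℚ.≟ 0ℚ))
        act-p {j} j∉J = trans (cong (not (does (p i j ℚ.≟ 0ℚ)) ∧_) (dec-true (¬? (j Subset.∈? J)) j∉J))
            (∧-identityʳ _)

        contributing-act : ∀ {j} → j ∉ₛ J → does (contributing? τ i j) ≡ act j ∧ C j
        contributing-act {j} j∉J = trans (go (p i j ℚ.≟ 0ℚ)) (cong (_∧ C j) (sym (act-p j∉J)))
          where
          go : (d : Dec (p i j ≡ 0ℚ)) → not (does d) ∧ does (small? (map (p i j ℚ.*_) (γ j))) ≡ not (does d) ∧ C j
          go (yes _)  = refl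
          go (no p≢0) = contributing-C p≢0 j∉J

        duallyContributing-act : ∀ {j} → j ∉ₛ J → does (duallyContributing? τ i j) ≡ act j ∧ not (C j)
        duallyContributing-act {j} j∉J = trans (go (p i j ℚ.≟ 0ℚ)) (cong (_∧ not (C j)) (sym (act-p j∉J)))
          where
          go : (d : Dec (p i j ≡ 0ℚ)) → not (does d) ∧ not (does (small? (map (p i j ℚ.*_) (γ j)))) ≡ not
              (does d) ∧ not (C j)
          go (yes _)  = refl
          go (no p≢0) = cong not (contributing-C p≢0 j∉J)

        scale-sum : ∀ f → sumℤ xs (λ j → s± ℤ.* (indicator α ℤ.* f j)) ≡ s± ℤ.* (indicator α ℤ.* sumℤ xs f)
        scale-sum f = trans (sumℤ-* s± xs _) (cong (s± ℤ.*_) (sumℤ-* (indicator α) xs f))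

        private
          maybe-val : ∀ {P : Set} (d : Dec P) (g : P → Term n r) {y} → (∀ q → val (g q) α ≡ y) →
            maybe (λ τ′ → val τ′ α) 0ℤ (Maybe.map g (dec⇒maybe d)) ≡ (if does d then y else 0ℤ)
          maybe-val (yes q) g h = h q
          maybe-val (no _)  g h = refl

          zero-case : s± ℤ.* (indicator α ℤ.* 0ℤ) ≡ 0ℤ
          zero-case = trans (cong (s± ℤ.*_) (ℤ.*-zeroʳ (indicator α))) (ℤ.*-zeroʳ s±)

        contributing-val : deg i ℚ.< 0ℚ → sumℤ (children τ contributing i) (λ τ′ → val τ′ α) ≡ val τ α
        contributing-val deg<0 = begin
          sumℤ (children τ contributing i) (λ τ′ → val τ′ α)
            ≡⟨ sumℤ-mapMaybe _ (λ τ′ → val τ′ α) xs ⟩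
          sumℤ xs (λ j → maybe (λ τ′ → val τ′ α) 0ℤ
              (Maybe.map (child τ s i j ∘ proj₁) (dec⇒maybe (contributing? τ i j))))
            ≡⟨ ∑ℤ.fold-cong xs (λ {j} j∈ → summand j (∈-remaining⁻ j∈)) ⟩
          sumℤ xs (λ j → s± ℤ.* (indicator α ℤ.* term-at C xs j))
            ≡⟨ scale-sum (term-at C xs) ⟩
          s± ℤ.* (indicator α ℤ.* sumℤ xs (term-at C xs))
            ≡⟨ cong (λ z → s± ℤ.* (indicator α ℤ.* z)) (telescope C C-upClosed (remaining-unique J)) ⟩
          s± ℤ.* (indicator α ℤ.* (prodℤ xs (λ t → sel (C t) t) ℤ.- prodℤ xs L))
            ≡⟨ cong (λ z → s± ℤ.* (indicator α ℤ.* z)) (trans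
                 (cong₂ ℤ._-_ (∏ℤ.fold-cong xs λ t∈ → sel-C (∈-remaining⁻ t∈)) (prod-L≡0 deg<0))
                 (ℤ.+-identityʳ _)) ⟩
          val τ α ∎
          where
          open ≡-Reasoning
          summand : ∀ j → j ∉ₛ J →
            maybe (λ τ′ → val τ′ α) 0ℤ (Maybe.map (child τ s i j ∘ proj₁) (dec⇒maybe (contributing? τ i j)))
            ≡ s± ℤ.* (indicator α ℤ.* term-at C xs j)
          summand j j∉J = trans (maybe-val (contributing? τ i j) (child τ s i j ∘ proj₁) λ
              (p≢0 , _) → child-val p≢0 j∉J s)
            (trans (cong (λ β → if β then s± ℤ.* (indicator α ℤ.* ((H j ℤ.- L j) ℤ.* others xs j)) else 0ℤ)
                (contributing-act j∉J)) (lem (act j ∧ C j)))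
            where
            lem : ∀ β {y} → (if β then s± ℤ.* (indicator α ℤ.* y) else 0ℤ) ≡ s± ℤ.*
                (indicator α ℤ.* (if β then y else 0ℤ))
            lem true  = refl
            lem false = sym zero-case

        -- The columns outside the cut are all columns minus those inside it. Telescoping both gives
        -- `(∏C - ∏L) - (∏H - ∏L)`, where `∏H` vanishes; the minus sign is the opposite sign of the
        -- dual formula.
        dual-val : ord i ℚ.< 0ℚ → sumℤ (children τ dual i) (λ τ′ → val τ′ α) ≡ val τ α
        dual-val ord<0 = begin
          sumℤ (children τ dual i) (λ τ′ → val τ′ α)
            ≡⟨ sumℤ-mapMaybe _ (λ τ′ → val τ′ α) xs ⟩
          sumℤ xs (λ j → maybe (λ τ′ → val τ′ α) 0ℤ
              (Maybe.map (child τ (Sign.opposite s) i j ∘ proj₁) (dec⇒maybe (duallyContributing? τ i j))))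
            ≡⟨ ∑ℤ.fold-cong xs (λ {j} j∈ → summand j (∈-remaining⁻ j∈)) ⟩
          sumℤ xs (λ j → s± ℤ.* (indicator α ℤ.* (term-at C xs j ℤ.+ -1ℤ ℤ.* term-at (const true) xs j)))
            ≡⟨ scale-sum (λ j → term-at C xs j ℤ.+ -1ℤ ℤ.* term-at (const true) xs j) ⟩
          s± ℤ.* (indicator α ℤ.* sumℤ xs (λ j → term-at C xs j ℤ.+ -1ℤ ℤ.* term-at (const true) xs j))
            ≡⟨ cong (λ z → s± ℤ.* (indicator α ℤ.* z)) (trans (∑ℤ.fold-∙ xs _ _)
                 (cong₂ ℤ._+_ (telescope C C-upClosed (remaining-unique J))
                   (trans (sumℤ-* -1ℤ xs _) (cong (-1ℤ ℤ.*_)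
                       (telescope (const true) (λ _ _ _ _ _ _ → refl) (remaining-unique J)))))) ⟩
          s± ℤ.* (indicator α ℤ.* ((∏C ℤ.- ∏L) ℤ.+ -1ℤ ℤ.* (prodℤ xs H ℤ.- ∏L)))
            ≡⟨ cong (λ z → s± ℤ.* (indicator α ℤ.* ((∏C ℤ.- ∏L) ℤ.+ -1ℤ ℤ.* (z ℤ.- ∏L)))) (prod-H≡0 ord<0) ⟩
          s± ℤ.* (indicator α ℤ.* ((∏C ℤ.- ∏L) ℤ.+ -1ℤ ℤ.* (0ℤ ℤ.- ∏L)))
            ≡⟨ cong (λ z → s± ℤ.* (indicator α ℤ.* z))
                (solve 2 (λ c l → (c :- l) :+ con -1ℤ :* (con 0ℤ :- l) := c) refl ∏C ∏L) ⟩
          s± ℤ.* (indicator α ℤ.* ∏C)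
            ≡⟨ cong (λ z → s± ℤ.* (indicator α ℤ.* z)) (∏ℤ.fold-cong xs λ t∈ → sel-C (∈-remaining⁻ t∈)) ⟩
          val τ α ∎
          where
          open ≡-Reasoning
          open ℤ-Solver using (solve; _:*_; _:+_; _:-_; :-_; _:=_; con)
          ∏C = prodℤ xs (λ t → sel (C t) t)
          ∏L = prodℤ xs L
          summand : ∀ j → j ∉ₛ J →
            maybe (λ τ′ → val τ′ α) 0ℤ
                (Maybe.map (child τ (Sign.opposite s) i j ∘ proj₁) (dec⇒maybe (duallyContributing? τ i j)))
            ≡ s± ℤ.* (indicator α ℤ.* (term-at C xs j ℤ.+ -1ℤ ℤ.* term-at (const true) xs j))
          summand j j∉J = trans
            (maybe-val (duallyContributing? τ i j) (child τ (Sign.opposite s) i j ∘ proj₁) λ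
                (p≢0 , _) → child-val p≢0 j∉J (Sign.opposite s))
            (trans (cong (λ β → if β then (Sign.opposite s ℤ.◃ 1) ℤ.*
                (indicator α ℤ.* ((H j ℤ.- L j) ℤ.* others xs j)) else 0ℤ) (duallyContributing-act j∉J))
                (lem (act j) (C j)))
            where
            lem : ∀ a c {y} → (if a ∧ not c then (Sign.opposite s ℤ.◃ 1) ℤ.* (indicator α ℤ.* y) else 0ℤ) ≡
              s± ℤ.* (indicator α ℤ.* ((if a ∧ c then y else 0ℤ) ℤ.+ -1ℤ ℤ.* (if a ∧ true then y else 0ℤ)))
            lem false _     = sym zero-case
            lem true  true {y} = sym (trans
              (cong (λ z → s± ℤ.* (indicator α ℤ.* z))
                  (solve 1 (λ y → y :+ con -1ℤ :* y := con 0ℤ) refl y)) zero-case)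
            lem true  false {y} = trans (cong (ℤ._* (indicator α ℤ.* y)) (opposite-◃ s))
              (solve 3 (λ s i y → :- s :* (i :* y) := s :* (i :* (con 0ℤ :+ con -1ℤ :* y))) refl s± (indicator α) y)

  expand-val : ∀ τ → Inv τ → (c : Choice τ) → ∀ α → sumℤ (expand τ c) (λ τ′ → val τ′ α) ≡ val τ α
  expand-val τ inv-τ c α with onPlane? α
  ... | no off = trans (trans (∑ℤ.fold-cong (expand τ c) λ {τ′} _ → val-off τ′ α off) (∑ℤ.fold-ε (expand τ c)))
      (sym (val-off τ α off))
  ... | yes on with Choice.formula c | Choice.applicable c
  ...   | contributing | deg<0 = contributing-val τ inv-τ (Choice.index c) α on deg<0
  ...   | dual         | ord<0 = dual-val τ inv-τ (Choice.index c) α on ord<0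

-- All rounds of the algorithm, from the root to the leaves

∣I∣<∣I∪i∣ : ∀ {I : Subset r} {i} → i ∉ₛ I → Subset.∣ I ∣ ℕ.< Subset.∣ I ∪ ⁅ i ⁆ ∣
∣I∣<∣I∪i∣ {I = I} {i} i∉I = Subset.p⊂q⇒∣p∣<∣q∣
  (Subset.p⊆p∪q ⁅ i ⁆ , i , Subset.x∈p∪q⁺ (inj₂ (Subset.x∈⁅x⁆ i)) , i∉I)

mapMaybe-All : ∀ {X Y : Set} {Q : Y → Set} (P? : X → Maybe Y) xs →
  (∀ {x y} → x ∈ xs → P? x ≡ just y → Q y) → All Q (mapMaybe P? xs)
mapMaybe-All P? []       h = []
mapMaybe-All P? (x ∷ xs) h with P? x in eq
... | just y  = h (here refl) eq ∷ mapMaybe-All P? xs (h ∘ there)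
... | nothing = mapMaybe-All P? xs (h ∘ there)

-- Applied to the columns of `M`: the unit vector in the top rows decides before the rows of `A` are
-- reached.
pos-nonNeg : ∀ {X : Set} (xs ys : List X) {f : X → ℚ} {x} → (∀ {y} → y ∈ xs → 0ℚ ℚ.≤ f y) →
  x ∈ xs → 0ℚ ℚ.< f x → Pos (xs ++ ys) f
pos-nonNeg (y ∷ xs) ys {f} 0≤f x∈ 0<fx with ℚ.<-cmp 0ℚ (f y) | x∈
... | tri< 0<fy _ _ | _          = here 0<fy
... | tri> _ _ fy<0 | _          = ⊥-elim (ℚ.<-irrefl refl (ℚ.<-≤-trans fy<0 (0≤f (here refl))))
... | tri≈ _ 0≡fy _ | here refl  = ⊥-elim (ℚ.<-irrefl 0≡fy 0<fx)
... | tri≈ _ 0≡fy _ | there x∈xs = there (sym 0≡fy) (pos-nonNeg xs ys (0≤f ∘ there) x∈xs 0<fx)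

module Run {n r : ℕ} (A : Vector (Vector ℤ n) r) (b : Vector ℤ r) where
  open Invariant A b
  open Step A b

  -- A lower bound on the size of `I` suffices: after `r` rounds it meets `∣I∣ ≤ r` and forces
  -- `I = [r]`.
  AfterRounds : ℕ → Term n r → Set
  AfterRounds t τ = Inv τ × t ℕ.≤ Subset.∣ Term.I τ ∣

  expand-inv : ∀ {t τ} → AfterRounds t τ → (c : Choice τ) → All (AfterRounds (ℕ.suc t)) (expand τ c)
  expand-inv {t} {τ} (inv-τ , t≤) c = go (Choice.formula c)
    where
    open Term τ
    i = Choice.index c
    step : ∀ {P : Fin n → Set} s′ (P? : ∀ j → Dec (P j)) (p≢0 : ∀ {j} → P j → p i j ≢ 0ℚ) →
      All (AfterRounds (ℕ.suc t)) (mapMaybe (λ j → Maybe.map (child τ s′ i j ∘ p≢0) (dec⇒maybe (P? j))) (remaining J))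
    step s′ P? p≢0 = mapMaybe-All _ (remaining J) λ {j} j∈ → at (P? j) (∈-remaining⁻ j∈)
      where
      at : ∀ {j τ′} (d : Dec _) → j ∉ₛ J → Maybe.map (child τ s′ i j ∘ p≢0) (dec⇒maybe d)
          ≡ just τ′ → AfterRounds (ℕ.suc t) τ′
      at {j} (yes q) j∉J refl = Pivot.child-inv τ i j (p≢0 q) inv-τ j∉J s′ ,
        ℕ.≤-trans (ℕ.s≤s t≤) (∣I∣<∣I∪i∣ (Choice.index∉I c))
    go : ∀ f → All (AfterRounds (ℕ.suc t)) (children τ f i)
    go contributing = step s (contributing? τ i) proj₁
    go dual         = step (Sign.opposite s) (duallyContributing? τ i) proj₁

  nextTerms-inv : ∀ {t ts} → All (AfterRounds t) ts → (cs : All Choice ts) → All (AfterRounds (ℕ.suc t))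
      (nextTerms cs)
  nextTerms-inv []        []       = []
  nextTerms-inv (h ∷ hs) (c ∷ cs) = All-++⁺ (expand-inv h c) (nextTerms-inv hs cs)

  nextTerms-val : ∀ {t ts} → All (AfterRounds t) ts → (cs : All Choice ts) → ∀ α →
    sumℤ (nextTerms cs) (λ τ → val τ α) ≡ sumℤ ts (λ τ → val τ α)
  nextTerms-val []       []       α = refl
  nextTerms-val {ts = τ ∷ ts} ((h , _) ∷ hs) (c ∷ cs) α = trans
    (∑ℤ.fold-++ (expand τ c) (nextTerms cs) _)
    (cong₂ ℤ._+_ (expand-val τ h c α) (nextTerms-val hs cs α))

  final-inv : ∀ {t u ts} → All (AfterRounds t) ts → (S : Rounds u ts) → All (AfterRounds (u ℕ.+ t)) (final S)
  final-inv hs stop = hs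
  final-inv {t} {ℕ.suc u} hs (cs ▸ S) =
    subst (λ v → All (AfterRounds v) (final S)) (ℕ.+-suc u t) (final-inv (nextTerms-inv hs cs) S)

  final-val : ∀ {t u ts} → All (AfterRounds t) ts → (S : Rounds u ts) → ∀ α →
    sumℤ (final S) (λ τ → val τ α) ≡ sumℤ ts (λ τ → val τ α)
  final-val hs stop     α = refl
  final-val hs (cs ▸ S) α = trans (final-val (nextTerms-inv hs cs) S α) (nextTerms-val hs cs α)

  root-flag : ∀ t → flag root t ≡ true
  root-flag t = dec-true (small? _)
      (pos-nonNeg (map (_↑ˡ r) (allFin n)) (map (n ↑ʳ_) (allFin r)) {f = λ k → O k (col t)}
    nonNeg (∈-map⁺ _ (∈-allFin t))
        (subst (0ℚ ℚ.<_) (sym (trans (unit t) (cong (if_then 1ℚ else 0ℚ) (dec-true (t Fin.≟ t) refl))))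
        (ℚ.positive⁻¹ 1ℚ)))
    where
    open Term root using (O; col)
    unit : ∀ s → O (s ↑ˡ r) (col t) ≡ (if does (s Fin.≟ t) then 1ℚ else 0ℚ)
    unit s = Inv.top-col root-inv Subset.∉⊥ Subset.∉⊥
    0≤if : ∀ d → 0ℚ ℚ.≤ (if d then 1ℚ else 0ℚ)
    0≤if true  = ℚ.<⇒≤ (ℚ.positive⁻¹ 1ℚ)
    0≤if false = ℚ.≤-refl
    nonNeg : ∀ {k} → k ∈ map (_↑ˡ r) (allFin n) → 0ℚ ℚ.≤ O k (col t)
    nonNeg k∈ with ∈-map⁻ (_↑ˡ r) k∈
    ... | s , _ , refl = subst (0ℚ ℚ.≤_) (sym (unit s)) (0≤if (does (s Fin.≟ t)))

  NonNegOn : List (Fin n) → Vec ℤ n → Set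
  NonNegOn xs α = ∀ {t} → t ∈ xs → 0ℤ ℤ.≤ Vec.lookup α t

  nonNegOn? : ∀ xs → Decidable (NonNegOn xs)
  nonNegOn? xs α = map′ All.lookup All.tabulate (All.all? (λ t → 0ℤ ℤ.≤? Vec.lookup α t) xs)

  -- The membership tests `P?` and `cone?` are `map′` of such a `d`, and `map′` leaves `does`
  -- unchanged, so this evaluates σ of the polyhedron and of every final cone.
  indicator-prod : ∀ xs α (d : Dec (OnPlane α × NonNegOn xs α)) →
    (if does d then 1ℤ else 0ℤ) ≡ indicator α ℤ.* prodℤ xs (λ t → [0≤ Vec.lookup α t ])
  indicator-prod xs α (yes (on , 0≤α)) = sym (begin
    indicator α ℤ.* prodℤ xs (λ t → [0≤ Vec.lookup α t ])
      ≡⟨ cong₂ ℤ._*_ (cong (if_then 1ℤ else 0ℤ) (dec-true (onPlane? α) on))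
           (∏ℤ.fold-cong xs λ {t} t∈ → cong (if_then 1ℤ else 0ℤ) (dec-true (0ℤ ℤ.≤? Vec.lookup α t) (0≤α t∈))) ⟩
    1ℤ ℤ.* prodℤ xs (λ _ → 1ℤ)
      ≡⟨ trans (ℤ.*-identityˡ _) (∏ℤ.fold-ε xs) ⟩
    1ℤ ∎)
    where open ≡-Reasoning
  indicator-prod xs α (no ¬h) = sym (go (onPlane? α))
    where
    ∏ = prodℤ xs (λ t → [0≤ Vec.lookup α t ])
    go : (d : Dec (OnPlane α)) → (if does d then 1ℤ else 0ℤ) ℤ.* ∏ ≡ 0ℤ
    go (no _)   = refl
    go (yes on) = trans (ℤ.*-identityˡ ∏) (decidable-stable (∏ ℤ.≟ 0ℤ) λ ∏≢0 →
      ¬h (on , λ {t} t∈ → [0≤]≢0 (Vec.lookup α t) λ f≡0 → ∏≢0 (prodℤ-zero xs _ t∈ f≡0)))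

  root-val : ∀ α → val root α ≡ indicator α ℤ.* prodℤ (allFin n) (λ t → [0≤ Vec.lookup α t ])
  root-val α = trans (ℤ.*-identityˡ _) (cong (indicator α ℤ.*_) (trans
    (∏ℤᴿ.fold-remaining-⊥ (λ t → χ (flag root t) (Vec.lookup α t)))
    (∏ℤ.fold-cong (allFin n) λ {t} _ → cong (λ d → χ d (Vec.lookup α t)) (root-flag t))))

-- Null sequences

Null : (ℕ → ℚ) → Set
Null x = ∀ ε → 0ℚ ℚ.< ε → ∃[ N ] (∀ k → k ℕ.≥ N → ℚ.∣ x k ∣ ℚ.< ε)

null-cong : ∀ {x y} → (∀ k → x k ≡ y k) → Null x → Null y
null-cong x≗y nx ε 0<ε = let (N , h) = nx ε 0<ε in N , λ k k≥N → subst (λ z → ℚ.∣ z ∣ ℚ.< ε) (x≗y k) (h k k≥N)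

null-0 : Null (λ _ → 0ℚ)
null-0 ε 0<ε = 0 , λ _ _ → 0<ε

null-self : ∀ q → Null (λ _ → q ℚ.- q)
null-self q = null-cong (λ _ → sym (ℚ.+-inverseʳ q)) null-0

-- `x ≈ y` unfolds to `Null` of the difference. For rational points the difference is constant, and
-- this turns `≈` back into an equation.
null-const : ∀ {q} → Null (λ _ → q) → q ≡ 0ℚ
null-const {q} nq with q ℚ.≟ 0ℚ
... | yes q≡0 = q≡0
... | no q≢0  = ⊥-elim (ℚ.<-irrefl refl (proj₂ (nq ℚ.∣ q ∣ 0<∣q∣) _ ℕ.≤-refl))
  where
  0<∣q∣ : 0ℚ ℚ.< ℚ.∣ q ∣
  0<∣q∣ = ℚ.≰⇒> λ ∣q∣≤0 → q≢0 (ℚ.∣p∣≡0⇒p≡0 q (ℚ.≤-antisym ∣q∣≤0 (ℚ.0≤∣p∣ q)))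

null-+ : ∀ {x y} → Null x → Null y → Null (λ k → x k ℚ.+ y k)
null-+ {x} {y} nx ny ε 0<ε =
  let (N₁ , h₁) = nx (½ ℚ.* ε) 0<½ε
      (N₂ , h₂) = ny (½ ℚ.* ε) 0<½ε
  in N₁ ℕ.⊔ N₂ , λ k k≥ → begin-strict
    ℚ.∣ x k ℚ.+ y k ∣             ≤⟨ ℚ.∣p+q∣≤∣p∣+∣q∣ (x k) (y k) ⟩
    ℚ.∣ x k ∣ ℚ.+ ℚ.∣ y k ∣       <⟨ ℚ.+-mono-< (h₁ k (ℕ.m⊔n≤o⇒m≤o N₁ N₂ k≥)) (h₂ k (ℕ.m⊔n≤o⇒n≤o N₁ N₂ k≥)) ⟩
    ½ ℚ.* ε ℚ.+ ½ ℚ.* ε           ≡⟨ ℚ.*-distribʳ-+ ε ½ ½ ⟨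
    1ℚ ℚ.* ε                      ≡⟨ ℚ.*-identityˡ ε ⟩
    ε                             ∎
  where
  open ℚ.≤-Reasoning
  0<½ε : 0ℚ ℚ.< ½ ℚ.* ε
  0<½ε = subst (ℚ._< ½ ℚ.* ε) (ℚ.*-zeroʳ ½) (ℚ.*-monoʳ-<-pos ½ 0<ε)

null-* : ∀ c {x} → Null x → Null (λ k → c ℚ.* x k)
null-* c {x} nx with c ℚ.≟ 0ℚ
... | yes refl = null-cong (λ k → sym (ℚ.*-zeroˡ (x k))) null-0
... | no c≢0 = λ ε 0<ε → let (N , h) = nx (d ℚ.* ε) (0<dε ε 0<ε) in N , λ k k≥N → begin-strict
    ℚ.∣ c ℚ.* x k ∣             ≡⟨ ℚ.∣p*q∣≡∣p∣*∣q∣ c (x k) ⟩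
    ∣c∣ ℚ.* ℚ.∣ x k ∣           <⟨ ℚ.*-monoʳ-<-pos ∣c∣ (h k k≥N) ⟩
    ∣c∣ ℚ.* (d ℚ.* ε)           ≡⟨ ℚ.*-assoc ∣c∣ d ε ⟨
    ∣c∣ ℚ.* d ℚ.* ε             ≡⟨ cong (ℚ._* ε) (ℚ.*-inverseʳ ∣c∣) ⟩
    1ℚ ℚ.* ε                    ≡⟨ ℚ.*-identityˡ ε ⟩
    ε                           ∎
  where
  open ℚ.≤-Reasoning
  ∣c∣ = ℚ.∣ c ∣
  instance
    ∣c∣+ : ℚ.Positive ∣c∣
    ∣c∣+ = ℚ.positive (ℚ.≰⇒> λ ∣c∣≤0 → c≢0 (ℚ.∣p∣≡0⇒p≡0 c (ℚ.≤-antisym ∣c∣≤0 (ℚ.0≤∣p∣ c))))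
    ∣c∣≢0 : ℚ.NonZero ∣c∣
    ∣c∣≢0 = ℚ.pos⇒nonZero ∣c∣
  d = ℚ.1/ ∣c∣
  0<dε : ∀ ε → 0ℚ ℚ.< ε → 0ℚ ℚ.< d ℚ.* ε
  0<dε ε 0<ε = subst (ℚ._< d ℚ.* ε) (ℚ.*-zeroʳ d) (ℚ.*-monoʳ-<-pos d {{ℚ.1/pos⇒pos ∣c∣}} 0<ε)

null-sum : ∀ {X : Set} (xs : List X) (f : X → ℕ → ℚ) → (∀ x → Null (f x)) → Null (λ k → sumℚ xs (λ x → f x k))
null-sum []       f nf = null-0
null-sum (x ∷ xs) f nf = null-+ (nf x) (null-sum xs f nf)

seq-∑ℝ : ∀ {m} (v : Vector ℝ m) k → seq (∑ℝ v) k ≡ sumℚ (allFin m) (λ i → seq (v i) k)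
seq-∑ℝ v k = trans (go v) (∑ℚ.fold-allFin (λ i → seq (v i) k))
  where
  go : ∀ {m} (v : Vector ℝ m) → seq (∑ℝ v) k ≡ Vector.foldr ℚ._+_ 0ℚ (λ i → seq (v i) k)
  go {ℕ.zero}  v = refl
  go {ℕ.suc m} v = cong (seq (v zero) k ℚ.+_) (go (v ∘ suc))

p≤∣p∣ : ∀ p → p ℚ.≤ ℚ.∣ p ∣
p≤∣p∣ p with ℚ.≤-total 0ℚ p
... | inj₁ 0≤p = ℚ.≤-reflexive (sym (ℚ.0≤p⇒∣p∣≡p 0≤p))
... | inj₂ p≤0 = ℚ.≤-trans p≤0 (ℚ.0≤∣p∣ p)

0≤⇒fromℚ : ∀ {q} → 0ℚ ℚ.≤ q → 0ℝ ≤ fromℚ q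
0≤⇒fromℚ {q} 0≤q ε 0<ε = 0 , λ _ _ → ℚ.+-mono-≤-< 0≤q 0<ε

≈fromℚ⇒0≤ : ∀ {x q} → 0ℝ ≤ x → Null (λ k → seq x k ℚ.- q) → 0ℚ ℚ.≤ q
≈fromℚ⇒0≤ {x} {q} 0≤x nx = ℚ.≮⇒≥ λ q<0 →
  -- Half of `-q`, because it is spent twice: `0 < xₖ + ε < q + 2ε = 0`.
  let ε          = ½ ℚ.* ℚ.- q
      0<ε        = subst (ℚ._< ε) (ℚ.*-zeroʳ ½) (ℚ.*-monoʳ-<-pos ½ (ℚ.neg-antimono-< q<0))
      (N₁ , h₁)  = 0≤x ε 0<ε
      (N₂ , h₂)  = nx ε 0<ε
      k          = N₁ ℕ.⊔ N₂
      xk         = seq x k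
  in ℚ.<-irrefl refl (begin-strict
    0ℚ                          <⟨ h₁ k (ℕ.m≤m⊔n N₁ N₂) ⟩
    xk ℚ.+ ε                    ≡⟨ lem₁ xk q ε ⟩
    (xk ℚ.- q) ℚ.+ (q ℚ.+ ε)    <⟨ ℚ.+-monoˡ-< (q ℚ.+ ε) (ℚ.≤-<-trans (p≤∣p∣ (xk ℚ.- q)) (h₂ k (ℕ.m≤n⊔m N₁ N₂))) ⟩
    ε ℚ.+ (q ℚ.+ ε)             ≡⟨ lem₂ q ⟩
    0ℚ                          ∎)
  where
  open ℚ.≤-Reasoning
  open ℚ-Solver using (solve; _:+_; _:*_; _:-_; :-_; _:=_; con)
  lem₁ : ∀ x q e → x ℚ.+ e ≡ (x ℚ.- q) ℚ.+ (q ℚ.+ e)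
  lem₁ = solve 3 (λ x q e → x :+ e := (x :- q) :+ (q :+ e)) refl
  lem₂ : ∀ q → ½ ℚ.* ℚ.- q ℚ.+ (q ℚ.+ ½ ℚ.* ℚ.- q) ≡ 0ℚ
  lem₂ = solve 1 (λ q → con ½ :* :- q :+ (q :+ con ½ :* :- q) := con 0ℚ) refl

lookup-injective : ∀ {X : Set} {xs : List X} → Unique xs → ∀ {i j} → lookup xs i ≡ lookup xs j → i ≡ j
lookup-injective (x∉ ∷ uniq) {zero}  {zero}  _  = refl
lookup-injective (x∉ ∷ uniq) {zero}  {suc j} eq = ⊥-elim (All.lookup x∉ (∈-lookup j) eq)
lookup-injective (x∉ ∷ uniq) {suc i} {zero}  eq = ⊥-elim (All.lookup x∉ (∈-lookup i) (sym eq))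
lookup-injective (x∉ ∷ uniq) {suc i} {suc j} eq = cong suc (lookup-injective uniq eq)

∈⇒lookup : ∀ {X : Set} {xs : List X} {x} → x ∈ xs → ∃[ i ] lookup xs i ≡ x
∈⇒lookup (here refl) = zero , refl
∈⇒lookup (there x∈)  = let (i , eq) = ∈⇒lookup x∈ in suc i , eq

-- Lattice points of the polyhedron and of the final cones

module Membership {n r : ℕ} (A : Vector (Vector ℤ n) r) (b : Vector ℤ r) where
  open Invariant A b
  open Step A b
  open Run A b

  pt : Vec ℤ n → Fin n → ℚ
  pt α j = fromℤ (Vec.lookup α j)

  latticePoint-row : ∀ α i k → seq (∑ℝ (λ j → fromℤ (A i j) ⊙ latticePoint α j)) k ≡
    fromℤ (sumℤ (allFin n) (λ j → A i j ℤ.* Vec.lookup α j))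
  latticePoint-row α i k = trans (seq-∑ℝ (λ j → fromℤ (A i j) ⊙ latticePoint α j) k)
      (sym (fromℤ-sum (allFin n) (A i) (Vec.lookup α)))

  P⇒ : ∀ α → P A b (latticePoint α) → OnPlane α × NonNegOn (allFin n) α
  P⇒ α (0≤α , Aα≈b) =
    (λ i → fromℤ-injective (ℚ-Group.x∙y⁻¹≈ε⇒x≈y _ _ (null-const (null-cong
      (λ k → cong (ℚ._- fromℤ (b i)) (latticePoint-row α i k)) (Aα≈b i))))) ,
    (λ {t} _ → fromℤ-cancel (≈fromℚ⇒0≤ {latticePoint α t} (0≤α t) (null-self (pt α t))))

  ⇒P : ∀ α → OnPlane α × NonNegOn (allFin n) α → P A b (latticePoint α)
  ⇒P α (on , 0≤α) =
    (λ t → 0≤⇒fromℚ (fromℤ-mono (0≤α (∈-allFin t)))) ,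
    (λ i → null-cong (λ k → cong (ℚ._- fromℤ (b i)) (trans (cong fromℤ (sym (on i))) (sym (latticePoint-row α i k))))
      (null-self (fromℤ (b i))))

  P? : Decidable (P A b ∘ latticePoint)
  P? α = map′ (⇒P α) (P⇒ α) (onPlane? α ×-dec nonNegOn? (allFin n) α)

  module FinalCone (τ : Term n r) (inv-τ : Inv τ) where
    open Term τ
    open Inv inv-τ

    W : Matrix n (length (remaining J))
    W = generators

    ι : Fin (length (remaining J)) → Fin n
    ι = lookup (remaining J)

    ι∉J : ∀ c → ι c ∉ₛ J
    ι∉J c = ∈-remaining⁻ (∈-lookup c)

    -- The rows `ι c` of the generators form an identity block, so coefficients can be read off
    -- there. Linear independence and the recovery of the coefficients of a point both rest on this.
    W-own : ∀ c (f : Fin _ → ℚ) → sumℚ (allFin _) (λ c′ → W (ι c) c′ ℚ.* f c′) ≡ f c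
    W-own c f = trans (∑ℚ.fold-cong (allFin _) λ {c′} _ → cong (ℚ._* f c′) (trans
      (top-col (ι∉J c) (ι∉J c′))
      (cong (if_then 1ℚ else 0ℚ)
          (does-⇔ (mk⇔ (lookup-injective (remaining-unique J)) (cong ι)) (ι c Fin.≟ ι c′) (c Fin.≟ c′)))))
      (sumℚ-δ c f)

    independent : LinearlyIndependentColumns W
    independent c Wc≈0 i = null-cong
        (λ k → cong (ℚ._- 0ℚ) (trans (seq-∑ℝ (λ c′ → W (ι i) c′ ⊙ c c′) k) (W-own i (λ c′ → seq (c c′) k))))
        (Wc≈0 (ι i))

    sum-ι : ∀ (f : Fin n → ℚ) → sumℚ (allFin _) (f ∘ ι) ≡ sumℚ (remaining J) f
    sum-ι f = trans (sym (∑ℚ.fold-allFin (f ∘ ι))) (∑ℚ.fold-lookup (remaining J) f)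

    -- The affine hull of the cone, with the coefficients already replaced by the free coordinates
    -- of the point, so that no real number is left.
    Spanned : Vec ℤ n → Set
    Spanned α = ∀ t → pt α t ≡ top t lastCol ℚ.+ sumℚ (remaining J) (λ s → top t (col s) ℚ.* pt α s)

    onPlane⇒spanned : ∀ α → OnPlane α → Spanned α
    onPlane⇒spanned α on t = trans (sym (cong [ _ , _ ] (Fin.splitAt-↑ˡ n t r))) (affine α on (t ↑ˡ r))

    -- The given coefficients `κ` are reals. Row `ι c` shows that `κ c` has the limit `α` at `ι c`;
    -- replacing it by that limit in the other rows changes them by null sequences, and an equation
    -- between rationals remains.
    cone⇒spanned : ∀ α → cone (latticePoint α) → Spanned α × NonNegOn (remaining J) α
    cone⇒spanned α (κ , 0≤κ , α≈) = spanned , nonNeg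
      where
      open ℚ-Solver using (solve; _:+_; _:*_; _:-_; :-_; _:=_; con)
      seq-row : ∀ t k → seq (fromℚ (vertex t) ⊕ ∑ℝ (λ c → W t c ⊙ κ c)) k ≡
        vertex t ℚ.+ sumℚ (allFin _) (λ c → W t c ℚ.* seq (κ c) k)
      seq-row t k = cong (vertex t ℚ.+_) (seq-∑ℝ (λ c → W t c ⊙ κ c) k)
      κ≈ : ∀ c → Null (λ k → seq (κ c) k ℚ.- pt α (ι c))
      κ≈ c = null-cong (λ k → trans
          (cong (λ z → ℚ.- 1ℚ ℚ.* (pt α (ι c) ℚ.- z)) (trans (seq-row (ι c) k)
            (trans (cong₂ ℚ._+_ (top-last (ι∉J c)) (W-own c (λ c′ → seq (κ c′) k))) (ℚ.+-identityˡ _))))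
          (solve 2 (λ a x → con (ℚ.- 1ℚ) :* (a :- x) := x :- a) refl (pt α (ι c)) (seq (κ c) k)))
        (null-* (ℚ.- 1ℚ) (α≈ (ι c)))
      spanned : Spanned α
      spanned t = trans (ℚ-Group.x∙y⁻¹≈ε⇒x≈y _ _ (null-const (null-cong combine
          (null-+ (α≈ t) (null-sum (allFin _) (λ c k → W t c ℚ.* (seq (κ c) k ℚ.- pt α (ι c)))
            λ c → null-* (W t c) (κ≈ c))))))
          (cong (vertex t ℚ.+_) (sum-ι (λ s → top t (col s) ℚ.* pt α s)))
        where
        X : Fin _ → ℚ
        X c = W t c ℚ.* pt α (ι c)
        combine : ∀ k → (pt α t ℚ.- seq (fromℚ (vertex t) ⊕ ∑ℝ (λ c → W t c ⊙ κ c)) k) ℚ.+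
            sumℚ (allFin _) (λ c → W t c ℚ.* (seq (κ c) k ℚ.- pt α (ι c)))
            ≡ pt α t ℚ.- (vertex t ℚ.+ sumℚ (allFin _) X)
        combine k = begin
          (pt α t ℚ.- seq (fromℚ (vertex t) ⊕ ∑ℝ (λ c → W t c ⊙ κ c)) k) ℚ.+ sumℚ (allFin _)
              (λ c → W t c ℚ.* (seq (κ c) k ℚ.- pt α (ι c)))
            ≡⟨ cong₂ (λ y z → (pt α t ℚ.- y) ℚ.+ z) (seq-row t k)
                 (trans (∑ℚ.fold-cong (allFin _) λ {c} _ → solve 3
                     (λ w x y → w :* (x :- y) := w :* x :+ con (ℚ.- 1ℚ) :* (w :* y))
                     refl (W t c) (seq (κ c) k) (pt α (ι c)))
                   (trans (∑ℚ.fold-∙ (allFin _) Y (λ c → ℚ.- 1ℚ ℚ.* X c))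
                       (cong (sumℚ (allFin _) Y ℚ.+_) (sumℚ-* (ℚ.- 1ℚ) (allFin _) X)))) ⟩
          (pt α t ℚ.- (vertex t ℚ.+ sumℚ (allFin _) Y)) ℚ.+ (sumℚ (allFin _) Y ℚ.+ ℚ.- 1ℚ ℚ.* sumℚ (allFin _) X)
            ≡⟨ solve 4 (λ a v y x → (a :- (v :+ y)) :+ (y :+ con (ℚ.- 1ℚ) :* x) := a :- (v :+ x))
                refl (pt α t) (vertex t) (sumℚ (allFin _) Y) (sumℚ (allFin _) X) ⟩
          pt α t ℚ.- (vertex t ℚ.+ sumℚ (allFin _) X) ∎
          where
          open ≡-Reasoning
          Y : Fin _ → ℚ
          Y c = W t c ℚ.* seq (κ c) k
      nonNeg : NonNegOn (remaining J) α
      nonNeg t∈ with ∈⇒lookup t∈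
      ... | c , refl = fromℤ-cancel (≈fromℚ⇒0≤ {κ c} (0≤κ c) (κ≈ c))

    ⇒cone : ∀ α → OnPlane α × NonNegOn (remaining J) α → cone (latticePoint α)
    ⇒cone α (on , 0≤α) =
      (λ c → fromℚ (pt α (ι c))) ,
      (λ c → 0≤⇒fromℚ (fromℤ-mono (0≤α (∈-lookup c)))) ,
      (λ t → null-cong (λ k → cong (λ z → pt α t ℚ.- z) (trans (onPlane⇒spanned α on t)
          (cong (vertex t ℚ.+_) (sym (trans (seq-∑ℝ (λ c → W t c ⊙ fromℚ (pt α (ι c))) k)
            (sum-ι (λ s → top t (col s) ℚ.* pt α s)))))))
        (null-self (pt α t)))

    module _ (I-full : ∀ i → i ∈ₛ I) where

      A·generator≡0 : ∀ i {s} → s ∉ₛ J → sumℚ (allFin n) (λ t → fromℤ (A i t) ℚ.* top t (col s)) ≡ 0ℚ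
      A·generator≡0 i {s} s∉J = begin
        S                          ≡⟨ ℚ.+-identityʳ S ⟨
        S ℚ.+ 0ℚ                   ≡⟨ cong (S ℚ.+_) (cong [ _ , _ ] (Fin.splitAt-↑ˡ n s 1)) ⟨
        S ℚ.+ offset i (col s)     ≡⟨ image i (col s) ⟨
        bottom i (col s)           ≡⟨ bottom-col (I-full i) s∉J ⟩
        0ℚ                         ∎
        where
        open ≡-Reasoning
        S = sumℚ (allFin n) (λ t → fromℤ (A i t) ℚ.* top t (col s))

      A·vertex≡b : ∀ i → sumℚ (allFin n) (λ t → fromℤ (A i t) ℚ.* top t lastCol) ≡ fromℤ (b i)
      A·vertex≡b i = ℚ-Group.x∙y⁻¹≈ε⇒x≈y _ _ (begin
        S ℚ.- fromℤ (b i)          ≡⟨ cong (S ℚ.+_) (cong [ _ , _ ] (Fin.splitAt-↑ʳ n 1 zero)) ⟨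
        S ℚ.+ offset i lastCol     ≡⟨ image i lastCol ⟨
        bottom i lastCol           ≡⟨ bottom-last (I-full i) ⟩
        0ℚ                         ∎)
        where
        open ≡-Reasoning
        S = sumℚ (allFin n) (λ t → fromℤ (A i t) ℚ.* top t lastCol)

      spanned⇒onPlane : ∀ α → Spanned α → OnPlane α
      spanned⇒onPlane α sp i = fromℤ-injective (begin
        fromℤ (sumℤ (allFin n) (λ t → A i t ℤ.* Vec.lookup α t))
          ≡⟨ fromℤ-sum (allFin n) (A i) (Vec.lookup α) ⟩
        sumℚ (allFin n) (λ t → a t ℚ.* pt α t)
          ≡⟨ ∑ℚ.fold-cong (allFin n) (λ {t} _ → trans (cong (a t ℚ.*_) (sp t)) (trans (ℚ.*-distribˡ-+ (a t) _ _)
               (cong (a t ℚ.* top t lastCol ℚ.+_) (sym (sumℚ-* (a t) (remaining J) _))))) ⟩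
        sumℚ (allFin n) (λ t → a t ℚ.* top t lastCol ℚ.+ sumℚ (remaining J)
            (λ s → a t ℚ.* (top t (col s) ℚ.* pt α s)))
          ≡⟨ ∑ℚ.fold-∙ (allFin n) _ _ ⟩
        sumℚ (allFin n) (λ t → a t ℚ.* top t lastCol) ℚ.+ sumℚ (allFin n)
            (λ t → sumℚ (remaining J) (λ s → a t ℚ.* (top t (col s) ℚ.* pt α s)))
          ≡⟨ cong₂ ℚ._+_ (A·vertex≡b i) (trans (∑ℚ.fold-swap (allFin n) (remaining J) _)
               (trans (∑ℚ.fold-cong (remaining J) λ {s} s∈ → vanish s (∈-remaining⁻ s∈)) (∑ℚ.fold-ε (remaining J)))) ⟩
        fromℤ (b i) ℚ.+ 0ℚ
          ≡⟨ ℚ.+-identityʳ _ ⟩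
        fromℤ (b i) ∎)
        where
        open ≡-Reasoning
        a : Fin n → ℚ
        a t = fromℤ (A i t)
        vanish : ∀ s → s ∉ₛ J → sumℚ (allFin n) (λ t → a t ℚ.* (top t (col s) ℚ.* pt α s)) ≡ 0ℚ
        vanish s s∉J = begin
          sumℚ (allFin n) (λ t → a t ℚ.* (top t (col s) ℚ.* pt α s))
            ≡⟨ ∑ℚ.fold-cong (allFin n) (λ {t} _ → solve 3 (λ a w x → a :* (w :* x) := x :* (a :* w))
                refl (a t) (top t (col s)) (pt α s)) ⟩
          sumℚ (allFin n) (λ t → pt α s ℚ.* (a t ℚ.* top t (col s)))
            ≡⟨ sumℚ-* (pt α s) (allFin n) _ ⟩
          pt α s ℚ.* sumℚ (allFin n) (λ t → a t ℚ.* top t (col s))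
            ≡⟨ cong (pt α s ℚ.*_) (A·generator≡0 i s∉J) ⟩
          pt α s ℚ.* 0ℚ
            ≡⟨ ℚ.*-zeroʳ (pt α s) ⟩
          0ℚ ∎
          where open ℚ-Solver using (solve; _:*_; _:=_)

      -- Membership quantifies over real coefficients. It is decidable because those of a lattice
      -- point are forced to be its free coordinates.
      cone? : Decidable (cone ∘ latticePoint)
      cone? α = map′ (⇒cone α) (λ c → let (sp , 0≤α) = cone⇒spanned α c in spanned⇒onPlane α sp , λ {t} → 0≤α {t})
        (onPlane? α ×-dec nonNegOn? (remaining J) α)

-- Laurent polynomials with prescribed finitely supported coefficients

interval : ℕ → List ℤ
interval B = map +_ (upTo (ℕ.suc B)) ++ map -[1+_] (upTo B)

∈-interval : ∀ {B} z → ℤ.∣ z ∣ ℕ.≤ B → z ∈ interval B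
∈-interval (+ k)    k≤B = ∈-++⁺ˡ (∈-map⁺ +_ (∈-upTo⁺ (ℕ.s≤s k≤B)))
∈-interval -[1+ k ] k<B = ∈-++⁺ʳ (map +_ (upTo _)) (∈-map⁺ -[1+_] (∈-upTo⁺ k<B))

box : (Fin n → ℕ) → List (Vec ℤ n)
box {ℕ.zero}  B = [] ∷ []
box {ℕ.suc n} B = cartesianProductWith _∷_ (interval (B zero)) (box (B ∘ suc))

∈-box : ∀ (B : Fin n → ℕ) α → (∀ t → ℤ.∣ Vec.lookup α t ∣ ℕ.≤ B t) → α ∈ box B
∈-box B []      _ = here refl
∈-box B (x ∷ α) h = ∈-cartesianProductWith⁺ _∷_ (∈-interval x (h zero)) (∈-box (B ∘ suc) α (h ∘ suc))

-- Deduplication ensures that no coefficient is counted twice, whatever list of candidate exponents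
-- is supplied.
polynomialOf : List (Vec ℤ n) → Series n → LaurentPolynomial n
polynomialOf xs h = map (λ u → h u , u) (deduplicate _≟ᵛ_ xs)

coeff-polynomialOf : ∀ (xs : List (Vec ℤ n)) h → (∀ α → h α ≢ 0ℤ → α ∈ xs) → ∀ α →
  coeff (polynomialOf xs h) α ≡ h α
coeff-polynomialOf xs h supp α = trans (∑ℤ.fold-∘ ys (λ u → h u , u) _) (go (h α ℤ.≟ 0ℤ))
  where
  ys = deduplicate _≟ᵛ_ xs
  f = λ u → if does (u ≟ᵛ α) then h u else 0ℤ
  go : Dec (h α ≡ 0ℤ) → sumℤ ys f ≡ h α
  go (yes hα≡0) = trans (trans (∑ℤ.fold-cong ys λ {u} _ → zero-term u (u ≟ᵛ α)) (∑ℤ.fold-ε ys)) (sym hα≡0)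
    where
    zero-term : ∀ u (d : Dec (u ≡ α)) → (if does d then h u else 0ℤ) ≡ 0ℤ
    zero-term u (yes refl) = hα≡0
    zero-term u (no _)     = refl
  go (no hα≢0) = begin
    sumℤ ys f
      ≡⟨ ∑ℤ.fold-remove _≟ᵛ_ f (deduplicate-! _≟ᵛ_ xs) (∈-deduplicate⁺ _≟ᵛ_ (supp α hα≢0)) ⟩
    f α ℤ.+ sumℤ ys (λ u → if does (u ≟ᵛ α) then 0ℤ else f u)
      ≡⟨ cong₂ ℤ._+_ (cong (if_then h α else 0ℤ) (dec-true (α ≟ᵛ α) refl))
           (trans (∑ℤ.fold-cong ys λ {u} _ → other (does (u ≟ᵛ α)) {h u}) (∑ℤ.fold-ε ys)) ⟩
    h α ℤ.+ 0ℤ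
      ≡⟨ ℤ.+-identityʳ _ ⟩
    h α ∎
    where
    open ≡-Reasoning
    other : ∀ d {y} → (if d then 0ℤ else (if d then y else 0ℤ)) ≡ 0ℤ
    other true  = refl
    other false = refl

-- Common denominators

Clears : ℚ → ℕ → Set
Clears q N = ∃[ z ] fromℤ (+ N) ℚ.* q ≡ fromℤ z

clears-denominator : ∀ q → Clears q (ℚ.denominatorℕ q)
clears-denominator q@(ℚ.mkℚ a d _) = a , ℚ.toℚᵘ-injective (begin
  ℚ.toℚᵘ (fromℤ (ℚ.↧ q) ℚ.* q)           ≈⟨ ℚ.toℚᵘ-homo-* (fromℤ (ℚ.↧ q)) q ⟩
  ℚ.toℚᵘ (fromℤ (ℚ.↧ q)) ℚᵘ.* ℚ.toℚᵘ q   ≈⟨ ℚᵘ.*-cong (ℚ.toℚᵘ-fromℚᵘ (ℚᵘ.mkℚᵘ (ℚ.↧ q) 0)) (ℚᵘ.≃-refl {ℚ.toℚᵘ q}) ⟩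
  ℚᵘ.mkℚᵘ (+ ℕ.suc d) 0 ℚᵘ.* ℚᵘ.mkℚᵘ a d ≈⟨ ℚᵘ.*≡* (lem (+ ℕ.suc d) a) ⟩
  ℚᵘ.mkℚᵘ a 0                            ≈⟨ ℚ.toℚᵘ-fromℚᵘ (ℚᵘ.mkℚᵘ a 0) ⟨
  ℚ.toℚᵘ (fromℤ a)                       ∎)
  where
  open ℚᵘ.≃-Reasoning
  lem : ∀ x y → x ℤ.* y ℤ.* 1ℤ ≡ y ℤ.* (1ℤ ℤ.* x)
  lem = solve 2 (λ x y → x :* y :* con 1ℤ := y :* (con 1ℤ :* x)) refl
    where open ℤ-Solver

clears-* : ∀ q N M → Clears q N → Clears q (M ℕ.* N)
clears-* q N M (z , eq) = + M ℤ.* z , (begin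
  fromℤ (+ (M ℕ.* N)) ℚ.* q              ≡⟨ cong (λ y → fromℤ y ℚ.* q) (ℤ.pos-* M N) ⟩
  fromℤ (+ M ℤ.* + N) ℚ.* q              ≡⟨ cong (ℚ._* q) (fromℤ-* (+ M) (+ N)) ⟩
  fromℤ (+ M) ℚ.* fromℤ (+ N) ℚ.* q      ≡⟨ ℚ.*-assoc (fromℤ (+ M)) (fromℤ (+ N)) q ⟩
  fromℤ (+ M) ℚ.* (fromℤ (+ N) ℚ.* q)    ≡⟨ cong (fromℤ (+ M) ℚ.*_) eq ⟩
  fromℤ (+ M) ℚ.* fromℤ z                ≡⟨ fromℤ-* (+ M) z ⟨
  fromℤ (+ M ℤ.* z)                      ∎)
  where open ≡-Reasoning

common-multiple : ∀ {m} (Q : Fin m → ℕ → Set) → (∀ i N M → Q i N → Q i (M ℕ.* N)) →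
  (∀ i → ∃[ N ] Q i (ℕ.suc N)) → ∃[ N ] ∀ i → Q i (ℕ.suc N)
common-multiple {ℕ.zero}  Q up q = 0 , λ ()
common-multiple {ℕ.suc m} Q up q =
  let (N , qN) = q zero
      (M , qM) = common-multiple (Q ∘ suc) (up ∘ suc) (q ∘ suc)
  in _ , λ { zero    → subst (Q zero) (ℕ.*-comm (ℕ.suc M) (ℕ.suc N)) (up zero (ℕ.suc N) (ℕ.suc M) qN)
           ; (suc i) → up (suc i) (ℕ.suc M) (ℕ.suc N) (qM i) }

abstract
  -- Opaque, so that the denominator is never computed from the matrix and only its clearing
  -- property is used.
  common-denominator : ∀ {m l} (X : Matrix m l) → ∃[ N ] ∀ i j → Clears (X i j) (ℕ.suc N)
  common-denominator X = common-multiple (λ i N → ∀ j → Clears (X i j) N)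
    (λ i N M h j → clears-* (X i j) N M (h j))
    λ i → common-multiple (λ j → Clears (X i j)) (λ j → clears-* (X i j))
      λ j → ℚ.denominator-1 (X i j) , clears-denominator (X i j)

∣sumℤ∣≤ : ∀ {X : Set} (xs : List X) (f g : X → ℤ) B → (∀ {x} → x ∈ xs → ℤ.∣ g x ∣ ℕ.≤ B) →
  ℤ.∣ sumℤ xs (λ x → f x ℤ.* g x) ∣ ℕ.≤ sum (map (λ x → ℤ.∣ f x ∣ ℕ.* B) xs)
∣sumℤ∣≤ []       f g B h = ℕ.z≤n
∣sumℤ∣≤ (x ∷ xs) f g B h = ℕ.≤-trans (ℤ.∣i+j∣≤∣i∣+∣j∣ (f x ℤ.* g x) _)
  (ℕ.+-mono-≤ (ℕ.≤-trans (ℕ.≤-reflexive (ℤ.∣i*j∣≡∣i∣*∣j∣ (f x) (g x))) (ℕ.*-monoʳ-≤ ℤ.∣ f x ∣ (h (here refl))))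
    (∣sumℤ∣≤ xs f g B (h ∘ there)))

-- The rational function of a final cone

module GeneratingFunction {n r : ℕ} (A : Vector (Vector ℤ n) r) (b : Vector ℤ r)
  (τ : Term n r) (inv-τ : Invariant.Inv A b τ) (I-full : ∀ i → i ∈ₛ Term.I τ) where
  open Invariant A b
  open Step A b
  open Run A b
  open Membership A b
  open FinalCone τ inv-τ
  open Term τ
  open Inv inv-τ

  cd : ∃[ N ] ∀ k l → Clears (top k l) (ℕ.suc N)
  cd = common-denominator top

  N : ℕ
  N = ℕ.suc (proj₁ cd)

  scaled : Fin n → Fin (n ℕ.+ 1) → ℤ
  scaled k l = proj₁ (proj₂ cd k l)

  scaled-spec : ∀ k l → fromℤ (+ N) ℚ.* top k l ≡ fromℤ (scaled k l)
  scaled-spec k l = proj₂ (proj₂ cd k l)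

  -- The generator of column `s` times `N`, hence integral. Translation by it moves the free
  -- coordinate `s` by `N` and fixes the other free coordinates.
  u : Fin n → Vec ℤ n
  u s = Vec.tabulate (λ k → scaled k (col s))

  lookup-u : ∀ s k → Vec.lookup (u s) k ≡ scaled k (col s)
  lookup-u s k = Vec.lookup∘tabulate (λ k → scaled k (col s)) k

  u-diag : ∀ {s t} → s ∉ₛ J → t ∉ₛ J → Vec.lookup (u s) t ≡ (if does (t Fin.≟ s) then + N else 0ℤ)
  u-diag {s} {t} s∉J t∉J = trans (lookup-u s t) (fromℤ-injective (trans (sym (scaled-spec t (col s)))
    (trans (cong (fromℤ (+ N) ℚ.*_) (top-col t∉J s∉J)) (lem (does (t Fin.≟ s))))))
    where
    lem : ∀ d → fromℤ (+ N) ℚ.* (if d then 1ℚ else 0ℚ) ≡ fromℤ (if d then + N else 0ℤ)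
    lem true  = ℚ.*-identityʳ _
    lem false = ℚ.*-zeroʳ (fromℤ (+ N))

  A·u≡0 : ∀ i {s} → s ∉ₛ J → sumℤ (allFin n) (λ t → A i t ℤ.* Vec.lookup (u s) t) ≡ 0ℤ
  A·u≡0 i {s} s∉J = fromℤ-injective (begin
    fromℤ (sumℤ (allFin n) (λ t → A i t ℤ.* Vec.lookup (u s) t))
      ≡⟨ fromℤ-sum (allFin n) (A i) (Vec.lookup (u s)) ⟩
    sumℚ (allFin n) (λ t → a t ℚ.* fromℤ (Vec.lookup (u s) t))
      ≡⟨ ∑ℚ.fold-cong (allFin n) (λ {t} _ → trans
           (cong (a t ℚ.*_) (trans (cong fromℤ (lookup-u s t)) (sym (scaled-spec t (col s)))))
           (solve 3 (λ a m w → a :* (m :* w) := m :* (a :* w)) refl (a t) (fromℤ (+ N)) (top t (col s)))) ⟩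
    sumℚ (allFin n) (λ t → fromℤ (+ N) ℚ.* (a t ℚ.* top t (col s)))
      ≡⟨ sumℚ-* (fromℤ (+ N)) (allFin n) _ ⟩
    fromℤ (+ N) ℚ.* sumℚ (allFin n) (λ t → a t ℚ.* top t (col s))
      ≡⟨ cong (fromℤ (+ N) ℚ.*_) (A·generator≡0 I-full i s∉J) ⟩
    fromℤ (+ N) ℚ.* 0ℚ
      ≡⟨ ℚ.*-zeroʳ (fromℤ (+ N)) ⟩
    0ℚ ∎)
    where
    open ≡-Reasoning
    open ℚ-Solver using (solve; _:*_; _:=_)
    a : Fin n → ℚ
    a t = fromℤ (A i t)

  indicator-shift : ∀ α {s} → s ∉ₛ J → indicator (α ⊖ u s) ≡ indicator α
  indicator-shift α {s} s∉J = cong (if_then 1ℤ else 0ℤ) (does-⇔ (mk⇔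
    (λ on i → trans (sym (shift i)) (on i)) (λ on i → trans (shift i) (on i)))
    (onPlane? (α ⊖ u s)) (onPlane? α))
    where
    shift : ∀ i → sumℤ (allFin n) (λ t → A i t ℤ.* Vec.lookup (α ⊖ u s) t) ≡ sumℤ (allFin n)
        (λ t → A i t ℤ.* Vec.lookup α t)
    shift i = begin
      sumℤ (allFin n) (λ t → A i t ℤ.* Vec.lookup (α ⊖ u s) t)
        ≡⟨ ∑ℤ.fold-cong (allFin n) (λ {t} _ → trans
             (cong (A i t ℤ.*_) (Vec.lookup-zipWith ℤ._-_ t α (u s)))
             (solve 3 (λ a x y → a :* (x :- y) := a :* x :+ con -1ℤ :* (a :* y))
                 refl (A i t) (Vec.lookup α t) (Vec.lookup (u s) t))) ⟩
      sumℤ (allFin n) (λ t → A i t ℤ.* Vec.lookup α t ℤ.+ -1ℤ ℤ.* (A i t ℤ.* Vec.lookup (u s) t))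
        ≡⟨ ∑ℤ.fold-∙ (allFin n) _ _ ⟩
      S ℤ.+ sumℤ (allFin n) (λ t → -1ℤ ℤ.* (A i t ℤ.* Vec.lookup (u s) t))
        ≡⟨ cong (λ z → S ℤ.+ z) (trans (sumℤ-* -1ℤ (allFin n) _) (cong (-1ℤ ℤ.*_) (A·u≡0 i s∉J))) ⟩
      S ℤ.+ 0ℤ
        ≡⟨ ℤ.+-identityʳ S ⟩
      S ∎
      where
      open ≡-Reasoning
      open ℤ-Solver using (solve; _:+_; _:*_; _:-_; _:=_; con)
      S = sumℤ (allFin n) (λ t → A i t ℤ.* Vec.lookup α t)

  free : List (Fin n)
  free = remaining J

  -- The common shape of σ of the cone, of its flipped versions and of what multiplication by
  -- factors `1 - y^(u s)` makes of them: each such factor acts on `φ s` alone, as the difference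
  -- `Δ`.
  productSeries : (Fin n → ℤ → ℤ) → Series n
  productSeries φ α = indicator α ℤ.* prodℤ free (λ t → φ t (Vec.lookup α t))

  Δ : (ℤ → ℤ) → ℤ → ℤ
  Δ f x = f x ℤ.- f (x ℤ.- + N)

  1-y^u-productSeries : ∀ {s} → s ∈ free → ∀ φ ψ → (∀ x → ψ s x ≡ Δ (φ s) x) → (∀ {t} → t ≢ s → ∀ x → ψ t x ≡ φ t x) →
    ∀ α → (1-y^ (u s) • productSeries φ) α ≡ productSeries ψ α
  1-y^u-productSeries {s} s∈ φ ψ ψs ψt α = begin
    (1-y^ (u s) • productSeries φ) α
      ≡⟨ 1-y^-• (u s) (productSeries φ) α ⟩
    indicator α ℤ.* prodℤ free F ℤ.- indicator (α ⊖ u s) ℤ.* prodℤ free G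
      ≡⟨ cong₂ (λ y z → indicator α ℤ.* y ℤ.- z) (split F)
           (cong₂ ℤ._*_ (indicator-shift α s∉J)
               (trans (split G) (cong₂ ℤ._*_ G-s (∏ℤ.fold-cong free λ {t} t∈ → others-G t t∈ (t Fin.≟ s))))) ⟩
    indicator α ℤ.* (φ s x ℤ.* R) ℤ.- indicator α ℤ.* (φ s (x ℤ.- + N) ℤ.* R)
      ≡⟨ solve 4 (λ i f g r → i :* (f :* r) :- i :* (g :* r) := i :* ((f :- g) :* r))
          refl (indicator α) (φ s x) (φ s (x ℤ.- + N)) R ⟩
    indicator α ℤ.* (Δ (φ s) x ℤ.* R)
      ≡⟨ cong (indicator α ℤ.*_)
          (trans (cong₂ ℤ._*_ (sym (ψs x)) (∏ℤ.fold-cong free λ {t} _ → others-ψ t (t Fin.≟ s)))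
          (sym (split (λ t → ψ t (Vec.lookup α t))))) ⟩
    productSeries ψ α ∎
    where
    open ≡-Reasoning
    open ℤ-Solver using (solve; _:+_; _:*_; _:-_; _:=_)
    s∉J : s ∉ₛ J
    s∉J = ∈-remaining⁻ s∈
    x = Vec.lookup α s
    F G : Fin n → ℤ
    F t = φ t (Vec.lookup α t)
    G t = φ t (Vec.lookup (α ⊖ u s) t)
    split : ∀ f → prodℤ free f ≡ f s ℤ.* prodℤ free (λ t → if does (t Fin.≟ s) then 1ℤ else f t)
    split f = ∏ℤ.fold-remove Fin._≟_ f (remaining-unique J) s∈
    R = prodℤ free (λ t → if does (t Fin.≟ s) then 1ℤ else F t)
    coord : ∀ {t} → t ∉ₛ J → Vec.lookup (α ⊖ u s) t ≡ Vec.lookup α t ℤ.- (if does (t Fin.≟ s) then + N else 0ℤ)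
    coord {t} t∉J = trans (Vec.lookup-zipWith ℤ._-_ t α (u s)) (cong (λ z → Vec.lookup α t ℤ.- z) (u-diag s∉J t∉J))
    G-s : G s ≡ φ s (x ℤ.- + N)
    G-s = cong (φ s) (trans (coord s∉J) (cong (λ d → x ℤ.- (if d then + N else 0ℤ)) (dec-true (s Fin.≟ s) refl)))
    others-G : ∀ t → t ∈ free → (d : Dec (t ≡ s)) → (if does d then 1ℤ else G t) ≡ (if does d then 1ℤ else F t)
    others-G t t∈ (yes _)  = refl
    others-G t t∈ (no t≢s) = cong (φ t) (trans (coord (∈-remaining⁻ t∈))
      (trans (cong (λ d → Vec.lookup α t ℤ.- (if d then + N else 0ℤ)) (dec-false (t Fin.≟ s) t≢s)) (ℤ.+-identityʳ _)))
    others-ψ : ∀ t → (d : Dec (t ≡ s)) → (if does d then 1ℤ else F t) ≡ (if does d then 1ℤ else ψ t (Vec.lookup α t))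
    others-ψ t (yes _)  = refl
    others-ψ t (no t≢s) = sym (ψt t≢s (Vec.lookup α t))

  denominator : List (Fin n) → LaurentPolynomial n
  denominator []       = monomial 1ℤ
  denominator (s ∷ ys) = 1-y^ (u s) ⊛ denominator ys

  denominator-nzd : ∀ ys → (∀ {s} → s ∈ ys → s ∈ free) → NonZeroDivisor (denominator ys)
  denominator-nzd []       _  = nzd-1
  denominator-nzd (s ∷ ys) ys⊆ = nzd-⊛ (1-y^ (u s)) (denominator ys)
    (nzd-1-y^ (u s) s (subst (0ℤ ℤ.<_)
        (sym (trans (u-diag s∉J s∉J) (cong (if_then + N else 0ℤ) (dec-true (s Fin.≟ s) refl))))
        (ℤ.+<+ (ℕ.s≤s ℕ.z≤n))))
    (denominator-nzd ys (ys⊆ ∘ there))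
    where
    s∉J : s ∉ₛ J
    s∉J = ∈-remaining⁻ (ys⊆ (here refl))

  denominator-• : ∀ {ys} → Unique ys → (∀ {s} → s ∈ ys → s ∈ free) → ∀ φ ψ →
    (∀ {t} → t ∈ ys → ∀ x → ψ t x ≡ Δ (φ t) x) → (∀ {t} → t ∉ ys → ∀ x → ψ t x ≡ φ t x) →
    ∀ α → (denominator ys • productSeries φ) α ≡ productSeries ψ α
  denominator-• {[]} _ _ φ ψ _ ψ≡φ α = trans (monomial-• 1ℤ (productSeries φ) α) (trans (ℤ.*-identityˡ _)
    (cong (indicator α ℤ.*_) (∏ℤ.fold-cong free λ {t} _ → sym (ψ≡φ (λ ()) (Vec.lookup α t)))))
  denominator-• {s ∷ ys} (s∉′ ∷ uniq) ys⊆ φ ψ ψΔ ψ≡φ α = begin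
    ((1-y^ (u s) ⊛ denominator ys) • productSeries φ) α
      ≡⟨ ⊛-• (1-y^ (u s)) (denominator ys) (productSeries φ) α ⟩
    (1-y^ (u s) • (denominator ys • productSeries φ)) α
      ≡⟨ •-cong (1-y^ (u s)) (denominator-• uniq (ys⊆ ∘ there) φ θ
           (λ {t} t∈ x → trans (θ-other (λ { refl → s∉ t∈ }) x) (ψΔ (there t∈) x))
           (λ {t} t∉ x → θ-φ t∉ x (t Fin.≟ s))) α ⟩
    (1-y^ (u s) • productSeries θ) α
      ≡⟨ 1-y^u-productSeries (ys⊆ (here refl)) θ ψ
           (λ x → trans (ψΔ (here refl) x) (cong₂ ℤ._-_ (sym (θ-s x)) (sym (θ-s (x ℤ.- + N)))))
           (λ t≢s x → sym (θ-other t≢s x)) α ⟩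
    productSeries ψ α ∎
    where
    open ≡-Reasoning
    s∉ : s ∉ ys
    s∉ s∈ = All.lookup s∉′ s∈ refl
    -- The state after the factors of `ys` have acted and before that of `s`.
    θ : Fin n → ℤ → ℤ
    θ t x = if does (t Fin.≟ s) then φ t x else ψ t x
    θ-s : ∀ x → θ s x ≡ φ s x
    θ-s x = cong (if_then φ s x else ψ s x) (dec-true (s Fin.≟ s) refl)
    θ-other : ∀ {t} → t ≢ s → ∀ x → θ t x ≡ ψ t x
    θ-other {t} t≢s x = cong (if_then φ t x else ψ t x) (dec-false (t Fin.≟ s) t≢s)
    θ-φ : ∀ {t} → t ∉ ys → ∀ x (d : Dec (t ≡ s)) → θ t x ≡ φ t x
    θ-φ t∉ x (yes refl) = θ-s x
    θ-φ t∉ x (no t≢s)   = trans (θ-other t≢s x) (ψ≡φ (λ { (here t≡s) → t≢s t≡s ; (there t∈) → t∉ t∈ }) x)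

  -- `Δ [0≤_]` is the indicator of `0 ≤ x < N`, so this is σ of the half-open parallelepiped spanned
  -- at the vertex by the vectors `u s`.
  parallelepiped : Series n
  parallelepiped = productSeries (λ _ → Δ [0≤_])

  Δ-support : ∀ x → Δ [0≤_] x ≢ 0ℤ → ℤ.∣ x ∣ ℕ.≤ N
  Δ-support x = go x (0ℤ ℤ.≤? x) (0ℤ ℤ.≤? (x ℤ.- + N))
    where
    go : ∀ x (d : Dec (0ℤ ℤ.≤ x)) (e : Dec (0ℤ ℤ.≤ x ℤ.- + N)) →
      (if does d then 1ℤ else 0ℤ) ℤ.- (if does e then 1ℤ else 0ℤ) ≢ 0ℤ → ℤ.∣ x ∣ ℕ.≤ N
    go x     (yes _)   (yes _)  h = ⊥-elim (h refl)
    go x     (no _)    (no _)   h = ⊥-elim (h refl)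
    go x     (no 0≰x)  (yes N≤) h = ⊥-elim (0≰x (ℤ.≤-trans (ℤ.+≤+ ℕ.z≤n) (ℤ.0≤i-j⇒j≤i {x} {+ N} N≤)))
    go (+ k) (yes _)   (no N≰)  h = ℕ.<⇒≤ (ℕ.≰⇒> λ N≤k → N≰ (ℤ.i≤j⇒0≤j-i (ℤ.+≤+ N≤k)))
    go -[1+ _ ] (yes ()) (no _) h

  bound : Fin n → ℕ
  bound t = ℤ.∣ scaled t lastCol ∣ ℕ.+ sum (map (λ s → ℤ.∣ scaled t (col s) ∣ ℕ.* N) free)

  -- The free coordinates are at most `N` in absolute value and determine the point. Multiplied by
  -- `N`, the affine formula for any coordinate has integer coefficients, which yield the bound.
  parallelepiped-bounded : ∀ α → parallelepiped α ≢ 0ℤ → ∀ t → ℤ.∣ Vec.lookup α t ∣ ℕ.≤ bound t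
  parallelepiped-bounded α h t = begin
    ℤ.∣ x ∣                            ≤⟨ ℕ.m≤n*m ℤ.∣ x ∣ N ⟩
    N ℕ.* ℤ.∣ x ∣                      ≡⟨ ℤ.∣i*j∣≡∣i∣*∣j∣ (+ N) x ⟨
    ℤ.∣ + N ℤ.* x ∣                    ≡⟨ cong ℤ.∣_∣ Nx ⟩
    ℤ.∣ scaled t lastCol ℤ.+ S ∣       ≤⟨ ℤ.∣i+j∣≤∣i∣+∣j∣ (scaled t lastCol) S ⟩
    ℤ.∣ scaled t lastCol ∣ ℕ.+ ℤ.∣ S ∣ ≤⟨ ℕ.+-monoʳ-≤ ℤ.∣ scaled t lastCol ∣
                                           (∣sumℤ∣≤ free (λ s → scaled t (col s)) (Vec.lookup α) N coords) ⟩
    bound t                            ∎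
    where
    open ℕ.≤-Reasoning
    x = Vec.lookup α t
    S = sumℤ free (λ s → scaled t (col s) ℤ.* Vec.lookup α s)
    on : OnPlane α
    on = decidable-stable (onPlane? α) λ off → h
        (cong (λ d → (if d then 1ℤ else 0ℤ) ℤ.* prodℤ free (λ t → Δ [0≤_] (Vec.lookup α t)))
        (dec-false (onPlane? α) off))
    coords : ∀ {s} → s ∈ free → ℤ.∣ Vec.lookup α s ∣ ℕ.≤ N
    coords {s} s∈ = Δ-support (Vec.lookup α s) λ f≡0 → h (trans
      (cong (indicator α ℤ.*_) (prodℤ-zero free (λ t → Δ [0≤_] (Vec.lookup α t)) s∈ f≡0)) (ℤ.*-zeroʳ (indicator α)))
    Nx : + N ℤ.* x ≡ scaled t lastCol ℤ.+ S
    Nx = fromℤ-injective (trans (fromℤ-* (+ N) x) (trans (cong (fromℤ (+ N) ℚ.*_) (onPlane⇒spanned α on t))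
      (trans (ℚ.*-distribˡ-+ (fromℤ (+ N)) (top t lastCol) _) (trans
        (cong₂ ℚ._+_ (scaled-spec t lastCol) (trans (sym (sumℚ-* (fromℤ (+ N)) free _)) (trans
          (∑ℚ.fold-cong free λ {s} _ → trans (sym (ℚ.*-assoc (fromℤ (+ N)) (top t (col s)) (pt α s)))
              (cong (ℚ._* pt α s) (scaled-spec t (col s))))
          (sym (fromℤ-sum free (λ s → scaled t (col s)) (Vec.lookup α))))))
        (sym (fromℤ-+ (scaled t lastCol) S))))))

  fraction : Fraction n
  fraction = polynomialOf (box bound) parallelepiped ÷ denominator free

  -- Flipping the sign of a coordinate, χ true ↦ χ false, changes the series
  -- but not its differences, hence not the fraction.
  fraction-represents : ∀ (β : Fin n → Bool) → fraction Represents productSeries (λ t → χ (β t))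
  fraction-represents β α = begin
    (denominator free • productSeries φ) α
      ≡⟨ denominator-• (remaining-unique J) id φ ψ
          (λ {t} t∈ x → ψ-∈ (does (t ∈? free)) (dec-true (t ∈? free) t∈) (β t) x)
           (λ {t} t∉ x → ψ-∉ (does (t ∈? free)) (dec-false (t ∈? free) t∉) x) α ⟩
    productSeries ψ α
      ≡⟨ cong (indicator α ℤ.*_)
          (∏ℤ.fold-cong free λ {t} t∈ → cong (if_then Δ [0≤_] (Vec.lookup α t) else χ (β t) (Vec.lookup α t))
          (dec-true (t ∈? free) t∈)) ⟩
    parallelepiped α
      ≡⟨ coeff-polynomialOf (box bound) parallelepiped (λ α h → ∈-box bound α (parallelepiped-bounded α h)) α ⟨
    coeff (num fraction) α ∎
    where
    open ≡-Reasoning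
    open DecMembership (Fin._≟_ {n}) using (_∈?_)
    φ ψ : Fin n → ℤ → ℤ
    φ t = χ (β t)
    -- The product reads `ψ` only on `free`; the other branch is there because `denominator-•` asks
    -- for agreement with `φ` off the list.
    ψ t x = if does (t ∈? free) then Δ [0≤_] x else φ t x
    Δχ : ∀ c x → Δ [0≤_] x ≡ Δ (χ c) x
    Δχ true  x = refl
    Δχ false x = solve 2 (λ e f → e :- f := (e :- con 1ℤ) :- (f :- con 1ℤ)) refl [0≤ x ] [0≤ x ℤ.- + N ]
      where open ℤ-Solver
    ψ-∈ : ∀ {y} d → d ≡ true → ∀ c x → (if d then Δ [0≤_] x else y) ≡ Δ (χ c) x
    ψ-∈ true _ = Δχ
    ψ-∉ : ∀ {t} d → d ≡ false → ∀ x → (if d then Δ [0≤_] x else φ t x) ≡ φ t x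
    ψ-∉ false _ x = refl

  σ-cone-represented : σ[ cone ]represents fraction
  σ-cone-represented = record
    { den≉0     = nzd⇒≉[] (denominator free) (denominator-nzd free id)
    ; member?   = cone? I-full
    ; den·σ≡num = λ α → trans
        (•-cong (denominator free) (λ β → indicator-prod free β (onPlane? β ×-dec nonNegOn? free β)) α)
        (fraction-represents (λ _ → true) α)
    }

-- The rational function of the polyhedron, assembled from the leaves

mainTheorem1 : (n r : ℕ) (A : Vector (Vector ℤ n) r) (b : Vector ℤ r) (S : Strategy A b) →
    let τ : Fin (length (SimpCone A b S)) → Term n r
        τ = lookup (SimpCone A b S)
    in (∀ i → LinearlyIndependentColumns (Term.generators (τ i))) ×
       (Σ[ f ∈ Fraction n ] Σ[ g ∈ Vector (Fraction n) _ ]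
                       (σ[ P A b ]represents f) ×
                       (∀ i → σ[ Term.cone (τ i) ]represents g i) ×
                       f ≃ ∑ᶠ (λ i → Term.s (τ i) *ᶠ g i))
mainTheorem1 n r A b S =
  (λ i → FinalCone.independent (τ i) (inv-τ i)) ,
  f , g , σ-P , (λ i → GeneratingFunction.σ-cone-represented A b (τ i) (inv-τ i) (I-full i)) ,
  (den≉0 , den≉0 , λ _ → refl)
  where
  open Invariant A b
  open Step A b
  open Run A b
  open Membership A b
  module G i = GeneratingFunction A b (lookup (SimpCone A b S) i)
  ts = SimpCone A b S
  τ = lookup ts
  rootAfter : All (AfterRounds 0) (root ∷ [])
  rootAfter = (root-inv , ℕ.z≤n) ∷ []
  after : ∀ i → AfterRounds (r ℕ.+ 0) (τ i)
  after i = All.lookup (final-inv rootAfter S) (∈-lookup i)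
  inv-τ : ∀ i → Inv (τ i)
  inv-τ i = proj₁ (after i)
  I-full : ∀ i j → j ∈ₛ Term.I (τ i)
  I-full i j = subst (j ∈ₛ_) (sym (Subset.∣p∣≡n⇒p≡⊤ (ℕ.≤-antisym (Subset.∣p∣≤n (Term.I (τ i)))
    (subst (ℕ._≤ Subset.∣ Term.I (τ i) ∣) (ℕ.+-identityʳ r) (proj₂ (after i)))))) Subset.∈⊤
  g : Vector (Fraction n) (length ts)
  g i = G.fraction i (inv-τ i) (I-full i)
  sg : Vector (Fraction n) (length ts)
  sg i = Term.s (τ i) *ᶠ g i
  -- With the signed sum itself as the rational function of the polyhedron, the required equation is
  -- reflexivity. The content lies in `σ-P`.
  f : Fraction n
  f = ∑ᶠ sg
  den≉0 : ¬ den f ≋ []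
  den≉0 = nzd⇒≉[] (den f) (nzd-∑ᶠ sg λ i → G.denominator-nzd i (inv-τ i) (I-full i) (remaining (Term.J (τ i))) id)
  vals : ∀ α → Vector.foldr ℤ._+_ 0ℤ (λ i → val (τ i) α) ≡ indicator α ℤ.* prodℤ (allFin n)
      (λ t → [0≤ Vec.lookup α t ])
  vals α = trans (∑ℤ.fold-lookup ts (λ τ → val τ α)) (trans (final-val rootAfter S α)
    (trans (ℤ.+-identityʳ _) (root-val α)))
  -- The exchange of flips takes place here: the same `g i` that represents σ of the cone also
  -- represents the series with the flags of the final term, and only the latter add up to σ of the
  -- polyhedron.
  f-represents : f Represents (λ α → Vector.foldr ℤ._+_ 0ℤ (λ i → val (τ i) α))
  f-represents = represents-∑ᶠ sg (val ∘ τ) λ i → represents-*ᶠ (Term.s (τ i)) (g i)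
    (G.productSeries i (inv-τ i) (I-full i) (λ t → χ (flag (τ i) t)))
    (G.fraction-represents i (inv-τ i) (I-full i) (flag (τ i)))
  σ-P : σ[ P A b ]represents f
  σ-P = record
    { den≉0     = den≉0
    ; member?   = P?
    ; den·σ≡num = λ α → trans
        (•-cong (den f) (λ β → trans (indicator-prod (allFin n) β (onPlane? β ×-dec nonNegOn? (allFin n) β))
            (sym (vals β))) α)
        (f-represents α)
    }
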